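{- Let $p$ be a prime and suppose $A\subset\mathbb{F}_p^{*}$ with $|A|\leq p^{1/2}$. Then $$\Big|\frac{A+1}{A}\Big|\gtrsim|A|^{110/109},$$ where $\frac{A+1}{A}=\{(a+1)/b: a,b\in A\}$.
   Context: $X\gtrsim Y$ means $X\ge cY$ for an absolute constant $c>0$. -}

module Defs where

open import Data.Nat using (ℕ; suc; NonZero; _*_)
open import Data.Nat.DivMod using (_%_; m%n<n)
open import Data.Fin using (Fin; toℕ; fromℕ<) renaming (_≟_ to _≟ᶠ_)
open import Data.Fin.Subset using (Subset; _∈_)
open import Data.Fin.Subset.Properties using (_∈?_)
open import Data.Fin.Properties using (any?)
open import Data.Product using (Σ; _×_; ∃)
open import Data.Vec using (tabulate)
open import Relation.Nullary.Decidable using (⌊_⌋; _×-dec_)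
open import Relation.Binary.PropositionalEquality using (_≡_)

-- The prime field F_p is modelled as Fin p (residues 0..p-1) with
-- arithmetic modulo p.
module _ {p : ℕ} .{{_ : NonZero p}} where

  _·ₚ_ : Fin p → Fin p → Fin p
  a ·ₚ b = fromℕ< (m%n<n (toℕ a * toℕ b) p)

  sucₚ : Fin p → Fin p
  sucₚ a = fromℕ< (m%n<n (suc (toℕ a)) p)

  -- x ∈ (A+1)/A  iff  there are a, b ∈ A with x · b = a + 1,
  -- i.e. x = (a+1)/b (b is invertible since A ⊆ F_p^*).
  InQuot : Subset p → Fin p → Set
  InQuot A x = ∃ λ a → ∃ λ b → (a ∈ A) × (b ∈ A) × (x ·ₚ b ≡ sucₚ a)

  quotSet : Subset p → Subset p
  quotSet A = tabulate λ x →
    ⌊ any? (λ a → any? (λ b → (a ∈? A) ×-dec (b ∈? A) ×-dec (x ·ₚ b ≟ᶠ sucₚ a))) ⌋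

{-# OPTIONS --safe #-}
module Submission where

-- Put n = |A|, Q = (A+1)/A, q = |Q|.  Plünnecke's inequality gives |AA| ≲ q²/n, so A has
-- large multiplicative energy.  For v ∈ 1/A and u ∈ vA the sum v + u lies in Q; a path
-- v₀, u₁, v₂, u₃, … of such pairs therefore represents v₀ + u₃ or v₀ − v₂ as an alternating
-- sum of elements of Q.  Dependent random choice over (t , τ) selects a set
-- Z = {a ∈ A : t/a ∈ A, τa ∈ A} and a set W = A ∩ tτ/A such that almost all pairs and triples
-- are joined by many paths.  A large part Y of Z then has a small difference set, and for
-- a, b, c, d ∈ Y the sum of t/W′ and aY ∪ bY ∪ cY ∪ dY is small for a large W′ ⊆ W, so that
-- |Y − rY| is small whenever r = (a−b)/(c−d).  Since F_p is generated by 1, either some such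
-- r has r + 1 ∉ R(Y) = {(a−b)/(c−d)}, so that |Y|³ ≲ |Y − Y||Y − rY|, or R(Y) = F_p and
-- averaging gives some r with |Y|² ≲ |Y − rY|.  Collecting exponents, n¹⁰⁵ ≲ q¹⁰⁴.

open import Defs
open import Level using (0ℓ)
open import Algebra.Bundles using (CommutativeRing)
open import Algebra.Structures using (IsCommutativeRing)
open import Algebra.Solver.Ring.AlmostCommutativeRing using (fromCommutativeRing; _-Raw-AlmostCommutative⟶_)
import Algebra.Properties.AbelianGroup as AbelianGroupProperties
import Algebra.Properties.Ring as RingProperties
import Algebra.Properties.Semiring.Mult as Multiples
import Algebra.Properties.Semiring.Sum as SemiringSum
import Algebra.Solver.Ring as RingSolver
open import Data.Bool.Base using (Bool; true; false; _∧_; _∨_; not; T)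
import Data.Bool.Properties as Boolₚ
open import Data.Empty using (⊥; ⊥-elim)
open import Data.Fin.Base using (Fin; zero; suc; toℕ; fromℕ<)
open import Data.Fin.Permutation using (permutation)
open import Data.Fin.Properties using (any?; all?; toℕ-fromℕ<; fromℕ<-cong; toℕ<n; toℕ-injective) renaming (_≟_ to _≟ᶠ_)
open import Data.Fin.Subset using (Subset; _∉_; ∣_∣)
open import Data.Fin.Subset.Properties using (_∈?_; anySubset?)
open import Data.Integer.Base using (0ℤ)
import Data.Integer.Base as ℤ
import Data.Integer.Properties as ℤₚ
open import Data.List.Base using (List; []; _∷_; allFin; filter)
open import Data.List.Membership.Propositional using (_∈_)
open import Data.List.Membership.Propositional.Properties using (∈-filter⁺; ∈-filter⁻; ∈-allFin)
open import Data.List.Relation.Unary.Any using (here; there)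
open import Data.Maybe.Base using (Maybe; just; nothing)
open import Data.Nat
open import Data.Nat.Coprimality using (prime⇒coprime; coprime-Bézout)
open import Data.Nat.DivMod using (m%n<n; n%n≡0; m*n%n≡0; m<n⇒m%n≡m; [m+kn]%n≡m%n; %-distribˡ-+; %-distribˡ-*)
open import Data.Nat.GCD using (module Bézout)
open import Data.Nat.Primality using (Prime; prime⇒nonTrivial)
open import Data.Nat.Properties
open import Data.Nat.Solver using (module +-*-Solver)
open import Data.Nat.Tactic.RingSolver using (solve-∀)
open import Data.Product using (Σ; ∃; _×_; _,_; proj₁; proj₂)
open import Data.Unit using (tt)
open import Data.Vec.Base using ([]; _∷_; lookup; tabulate)
open import Data.Vec.Properties using (lookup∘tabulate; lookup⇒[]=)
open import Function.Base using (_∘_; id; case_of_)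
open import Relation.Binary.PropositionalEquality
open import Relation.Nullary using (¬_; Dec; yes; no; does)
open import Relation.Nullary.Decidable using (_×-dec_; _→-dec_; ¬?; dec-true; decidable-stable; isYes≗does)

-- Finite sums

-- The obstacle is that `Q` sees sums `v + u` only along the pairs with `u ∈ vA`, not over a full
-- product of two sets, so sumset inequalities do not apply at once; many paths through intermediate
-- points turn this partial information into honest difference sets and sumsets. Two random
-- parameters make the averages exact counts: once `a` is fixed, `t = y a` and `τ = c / a` with `y`,
-- `c` ranging freely over `A`, and `t τ = y c`. With `k = |AA|` the selection gives
-- `ζ = |Z| ≳ n³/k²` and `ω = |W| ≳ n²/k`, and path counts are tested against `m² ≈ m₂ ≈ n⁵/k³`.
-- Then `|Y − Y| ≲ q⁴/(ζ m²)`, while `V = |T₀ + S₄| ≲ q⁵/(ζ m m₂)` and `|Y − rY| ≲ V⁴/ω³`. Inserted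
-- in `|Y|³ ≲ |Y − Y||Y − rY|` this reads `ζ⁸ ω³ m⁶ m₂⁴ ≲ q²⁴`, that is `n⁶⁵ ≲ k⁴⁰ q²⁴`, and forty
-- uses of `k n ≲ q²` remove `k`. The resulting exponent 105/104 exceeds 110/109, and `n ≤ q` passes
-- from one to the other.

module ΣP = SemiringSum +-*-semiring

abstract
  ∑ : ∀ {n} → (Fin n → ℕ) → ℕ
  ∑ {zero}  f = 0
  ∑ {suc n} f = f zero + ∑ (f ∘ suc)

  ∑≡sum : ∀ {n} (f : Fin n → ℕ) → ∑ f ≡ ΣP.sum f
  ∑≡sum {zero}  f = refl
  ∑≡sum {suc n} f = cong (f zero +_) (∑≡sum (f ∘ suc))

  ∑-cong : ∀ {n} {f g : Fin n → ℕ} → (∀ i → f i ≡ g i) → ∑ f ≡ ∑ g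
  ∑-cong {zero}  h = refl
  ∑-cong {suc n} h = cong₂ _+_ (h zero) (∑-cong (h ∘ suc))

  ∑-mono : ∀ {n} {f g : Fin n → ℕ} → (∀ i → f i ≤ g i) → ∑ f ≤ ∑ g
  ∑-mono {zero}  h = z≤n
  ∑-mono {suc n} h = +-mono-≤ (h zero) (∑-mono (h ∘ suc))

  ∑-+ : ∀ {n} (f g : Fin n → ℕ) → ∑ (λ i → f i + g i) ≡ ∑ f + ∑ g
  ∑-+ f g = trans (∑≡sum (λ i → f i + g i))
    (trans (ΣP.∑-distrib-+ f g) (sym (cong₂ _+_ (∑≡sum f) (∑≡sum g))))

  ∑-*ˡ : ∀ {n} c (f : Fin n → ℕ) → ∑ (λ i → c * f i) ≡ c * ∑ f
  ∑-*ˡ c f = trans (∑≡sum (λ i → c * f i))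
    (trans (sym (ΣP.*-distribˡ-sum c f)) (cong (c *_) (sym (∑≡sum f))))

  ∑-*ʳ : ∀ {n} c (f : Fin n → ℕ) → ∑ (λ i → f i * c) ≡ ∑ f * c
  ∑-*ʳ c f = trans (∑-cong (λ i → *-comm (f i) c)) (trans (∑-*ˡ c f) (*-comm c (∑ f)))

  ∑-swap : ∀ {m n} (f : Fin m → Fin n → ℕ) →
           ∑ (λ i → ∑ (λ j → f i j)) ≡ ∑ (λ j → ∑ (λ i → f i j))
  ∑-swap {m} {n} f =
    trans (∑-cong (λ i → ∑≡sum (f i)))
    (trans (∑≡sum (λ i → ΣP.sum (f i)))
    (trans (ΣP.∑-comm f)
    (trans (sym (∑≡sum (λ j → ΣP.sum (λ i → f i j))))
           (∑-cong (λ j → sym (∑≡sum (λ i → f i j)))))))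

  ∑-reindex : ∀ {n} (f g : Fin n → Fin n) → (∀ i → f (g i) ≡ i) → (∀ i → g (f i) ≡ i) →
              (h : Fin n → ℕ) → ∑ (λ i → h (f i)) ≡ ∑ h
  ∑-reindex f g fg gf h =
    trans (∑≡sum (h ∘ f)) (trans (sym (ΣP.sum-permute h (permutation f g fg gf))) (sym (∑≡sum h)))

  ∑-const : ∀ n c → ∑ {n} (λ _ → c) ≡ n * c
  ∑-const zero    c = refl
  ∑-const (suc n) c = cong (c +_) (∑-const n c)

  term≤∑ : ∀ {n} (f : Fin n → ℕ) i → f i ≤ ∑ f
  term≤∑ f zero    = m≤m+n (f zero) _
  term≤∑ f (suc i) = ≤-trans (term≤∑ (f ∘ suc) i) (m≤n+m _ (f zero))

  ∑-pigeonhole : ∀ {n} (f g : Fin n → ℕ) → ∑ f < ∑ g → ∃ λ i → f i < g i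
  ∑-pigeonhole {suc n} f g lt with f zero <? g zero
  ... | yes p = zero , p
  ... | no ¬p with ∑-pigeonhole (f ∘ suc) (g ∘ suc)
                    (+-cancelˡ-< (g zero) _ _ (≤-<-trans (+-monoˡ-≤ _ (≮⇒≥ ¬p)) lt))
  ...   | i , q = suc i , q

∑-zero : ∀ {n} {f : Fin n → ℕ} → (∀ i → f i ≡ 0) → ∑ f ≡ 0
∑-zero {n} h = trans (∑-cong h) (trans (∑-const n 0) (*-zeroʳ n))

∑-positive : ∀ {n} (f : Fin n → ℕ) → 0 < ∑ f → ∃ λ i → 0 < f i
∑-positive {n} f lt = ∑-pigeonhole (λ _ → 0) f (subst (_< ∑ f) (sym (∑-zero {n} (λ _ → refl))) lt)

-- Indicators and cardinalities

⟦_⟧ : Bool → ℕ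
⟦ true ⟧  = 1
⟦ false ⟧ = 0

⟦⟧≤1 : ∀ b → ⟦ b ⟧ ≤ 1
⟦⟧≤1 true  = ≤-refl
⟦⟧≤1 false = z≤n

⟦∧⟧ : ∀ b c → ⟦ b ∧ c ⟧ ≡ ⟦ b ⟧ * ⟦ c ⟧
⟦∧⟧ true  c = sym (+-identityʳ _)
⟦∧⟧ false c = refl

⟦⟧-guard : ∀ b {m n} → (b ≡ true → m ≤ n) → ⟦ b ⟧ * m ≤ ⟦ b ⟧ * n
⟦⟧-guard true  h = *-monoʳ-≤ 1 (h refl)
⟦⟧-guard false h = z≤n

⟦⟧-guard-≡ : ∀ b {m n} → (b ≡ true → m ≡ n) → ⟦ b ⟧ * m ≡ ⟦ b ⟧ * n
⟦⟧-guard-≡ true  h = cong (1 *_) (h refl)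
⟦⟧-guard-≡ false h = refl

⟦⟧*-≤ : ∀ b {m n} → (b ≡ true → m ≤ n) → ⟦ b ⟧ * m ≤ n
⟦⟧*-≤ true  h = ≤-trans (≤-reflexive (+-identityʳ _)) (h refl)
⟦⟧*-≤ false h = z≤n

⟦⟧-mono : ∀ b c → (b ≡ true → c ≡ true) → ⟦ b ⟧ ≤ ⟦ c ⟧
⟦⟧-mono true  c h = ≤-reflexive (sym (cong ⟦_⟧ (h refl)))
⟦⟧-mono false c h = z≤n

true⇒⟦⟧ : ∀ {b} → b ≡ true → ⟦ b ⟧ ≡ 1
true⇒⟦⟧ refl = refl

⟦⟧-true : ∀ b {m} → 0 < ⟦ b ⟧ * m → b ≡ true
⟦⟧-true true lt = refl

# : ∀ {n} → (Fin n → Bool) → ℕ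
# S = ∑ (λ i → ⟦ S i ⟧)

_⊆_ : ∀ {n} → (Fin n → Bool) → (Fin n → Bool) → Set
S ⊆ T = ∀ i → S i ≡ true → T i ≡ true

#-mono : ∀ {n} {S T : Fin n → Bool} → S ⊆ T → # S ≤ # T
#-mono {S = S} {T} h = ∑-mono (λ i → ⟦⟧-mono (S i) (T i) (h i))

#-cong : ∀ {n} {S T : Fin n → Bool} → (∀ i → S i ≡ T i) → # S ≡ # T
#-cong h = ∑-cong (λ i → cong ⟦_⟧ (h i))

#-nonempty : ∀ {n} {S : Fin n → Bool} → 0 < # S → ∃ λ i → S i ≡ true
#-nonempty {S = S} lt with ∑-positive (λ i → ⟦ S i ⟧) lt
... | i , p = i , ⟦⟧-true (S i) (subst (0 <_) (sym (*-identityʳ _)) p)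

∈⇒#>0 : ∀ {n} {S : Fin n → Bool} i → S i ≡ true → 0 < # S
∈⇒#>0 {S = S} i p = subst (_≤ # S) (true⇒⟦⟧ p) (term≤∑ (λ j → ⟦ S j ⟧) i)

#-∪∩ : ∀ {n} (S T : Fin n → Bool) →
       # (λ i → S i ∨ T i) + # (λ i → S i ∧ T i) ≡ # S + # T
#-∪∩ S T = trans (sym (∑-+ _ _)) (trans (∑-cong (λ i → lem (S i) (T i))) (∑-+ _ _))
  where
  lem : ∀ b c → ⟦ b ∨ c ⟧ + ⟦ b ∧ c ⟧ ≡ ⟦ b ⟧ + ⟦ c ⟧
  lem true  true  = refl
  lem true  false = refl
  lem false true  = refl
  lem false false = refl

∧-intro : ∀ {b c} → b ≡ true → c ≡ true → b ∧ c ≡ true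
∧-intro refl refl = refl

∧-fst : ∀ {b c} → b ∧ c ≡ true → b ≡ true
∧-fst {true} h = refl

∧-snd : ∀ {b c} → b ∧ c ≡ true → c ≡ true
∧-snd {true} h = h

true≢false : ∀ {b} → b ≡ true → b ≡ false → ⊥
true≢false refl ()

any : ∀ {n} → (Fin n → Bool) → Bool
any {zero}  S = false
any {suc n} S = S zero ∨ any (S ∘ suc)

any-intro : ∀ {n} {S : Fin n → Bool} i → S i ≡ true → any S ≡ true
any-intro {S = S} zero    h rewrite h = refl
any-intro {S = S} (suc i) h with S zero
... | true  = refl
... | false = any-intro i h

any-elim : ∀ {n} {S : Fin n → Bool} → any S ≡ true → ∃ λ i → S i ≡ true
any-elim {suc n} {S} h with S zero in eq
... | true  = zero , eq
... | false with any-elim {n} h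
...   | i , q = suc i , q

abstract
  ∑≤1 : ∀ {n} (S : Fin n → Bool) → (∀ i j → S i ≡ true → S j ≡ true → i ≡ j) → # S ≤ 1
  ∑≤1 {zero}  S u = z≤n
  ∑≤1 {suc n} S u with S zero in eq
  ... | false = ∑≤1 (S ∘ suc) (λ i j p q → suc-inj (u (suc i) (suc j) p q))
    where
    suc-inj : ∀ {i j : Fin n} → suc i ≡ suc j → i ≡ j
    suc-inj refl = refl
  ... | true  = s≤s (≤-reflexive (∑-zero λ i → lem i))
    where
    lem : ∀ i → ⟦ S (suc i) ⟧ ≡ 0
    lem i with S (suc i) in eq′
    ... | false = refl
    ... | true  with u zero (suc i) eq eq′
    ...   | ()

  #-lookup : ∀ {n} (v : Subset n) → # (lookup v) ≡ ∣ v ∣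
  #-lookup []          = refl
  #-lookup (true ∷ v)  = cong suc (#-lookup v)
  #-lookup (false ∷ v) = #-lookup v

-- Finite fields

-- With coefficients in ℤ, whose equality is decidable, the ring solver recognises that opposite
-- terms cancel, whatever commutative ring the variables live in.
module IntegerCoefficients (R : CommutativeRing 0ℓ 0ℓ) where
  private
    module R = CommutativeRing R
    module RP = RingProperties R.ring
    module GP = AbelianGroupProperties R.+-abelianGroup
    module ×ₚ = Multiples R.semiring
    open R using (_≈_; -_; 0#; 1#) renaming (_+_ to _⊹_; _*_ to _⋆_)
    open ×ₚ using () renaming (_×_ to _×#_)
    open import Relation.Binary.Reasoning.Setoid R.setoid

  fromℤ : ℤ.ℤ → R.Carrier
  fromℤ (ℤ.+ n)    = n ×# 1#
  fromℤ ℤ.-[1+ n ] = - (suc n ×# 1#)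

  fromℤ-neg : ∀ i → fromℤ (ℤ.- i) ≈ - fromℤ i
  fromℤ-neg (ℤ.+ zero)    = R.sym GP.ε⁻¹≈ε
  fromℤ-neg (ℤ.+ suc n)   = R.refl
  fromℤ-neg ℤ.-[1+ n ]    = R.sym (GP.⁻¹-involutive _)

  cancel : ∀ x y → (1# ⊹ x) ⊹ - (1# ⊹ y) ≈ x ⊹ - y
  cancel x y = begin
    (1# ⊹ x) ⊹ - (1# ⊹ y)     ≈⟨ R.+-cong (R.+-comm 1# x) (R.sym (GP.⁻¹-∙-comm 1# y)) ⟩
    (x ⊹ 1#) ⊹ (- 1# ⊹ - y)   ≈⟨ R.+-assoc x 1# _ ⟩
    x ⊹ (1# ⊹ (- 1# ⊹ - y))   ≈⟨ R.+-congˡ (R.sym (R.+-assoc 1# (- 1#) (- y))) ⟩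
    x ⊹ ((1# ⊹ - 1#) ⊹ - y)   ≈⟨ R.+-congˡ (R.+-congʳ (R.-‿inverseʳ 1#)) ⟩
    x ⊹ (0# ⊹ - y)            ≈⟨ R.+-congˡ (R.+-identityˡ _) ⟩
    x ⊹ - y                   ∎

  fromℤ-⊖ : ∀ m n → fromℤ (m ℤ.⊖ n) ≈ m ×# 1# ⊹ - (n ×# 1#)
  fromℤ-⊖ zero    zero    = R.sym (R.trans (R.+-identityˡ _) GP.ε⁻¹≈ε)
  fromℤ-⊖ zero    (suc n) = R.sym (R.+-identityˡ _)
  fromℤ-⊖ (suc m) zero    = R.sym (R.trans (R.+-congˡ GP.ε⁻¹≈ε) (R.+-identityʳ _))
  fromℤ-⊖ (suc m) (suc n) = begin
    fromℤ (suc m ℤ.⊖ suc n)         ≡⟨ cong fromℤ (ℤₚ.[1+m]⊖[1+n]≡m⊖n m n) ⟩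
    fromℤ (m ℤ.⊖ n)                 ≈⟨ fromℤ-⊖ m n ⟩
    m ×# 1# ⊹ - (n ×# 1#)             ≈⟨ cancel _ _ ⟨
    (suc m ×# 1#) ⊹ - (suc n ×# 1#)   ∎

  fromℤ-+ : ∀ i j → fromℤ (i ℤ.+ j) ≈ fromℤ i ⊹ fromℤ j
  fromℤ-+ (ℤ.+ m)    (ℤ.+ n)    = ×ₚ.×-homo-+ 1# m n
  fromℤ-+ (ℤ.+ m)    ℤ.-[1+ n ] = fromℤ-⊖ m (suc n)
  fromℤ-+ ℤ.-[1+ m ] (ℤ.+ n)    = R.trans (fromℤ-⊖ n (suc m)) (R.+-comm _ _)
  fromℤ-+ ℤ.-[1+ m ] ℤ.-[1+ n ] = begin
    - (suc (suc (m + n)) ×# 1#)        ≡⟨ cong (λ k → - (k ×# 1#)) (cong suc (sym (+-suc m n))) ⟩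
    - ((suc m + suc n) ×# 1#)          ≈⟨ R.-‿cong (×ₚ.×-homo-+ 1# (suc m) (suc n)) ⟩
    - (suc m ×# 1# ⊹ suc n ×# 1#)         ≈⟨ GP.⁻¹-∙-comm _ _ ⟨
    - (suc m ×# 1#) ⊹ - (suc n ×# 1#)     ∎

  fromℤ-+* : ∀ m j → fromℤ (ℤ.+ m ℤ.* j) ≈ m ×# 1# ⋆ fromℤ j
  fromℤ-+* zero    j = R.trans (R.reflexive (cong fromℤ (ℤₚ.*-zeroˡ j))) (R.sym (R.zeroˡ _))
  fromℤ-+* (suc m) j = begin
    fromℤ (ℤ.+ suc m ℤ.* j)               ≡⟨ cong fromℤ (ℤₚ.suc-* (ℤ.+ m) j) ⟩
    fromℤ (j ℤ.+ ℤ.+ m ℤ.* j)             ≈⟨ fromℤ-+ j (ℤ.+ m ℤ.* j) ⟩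
    fromℤ j ⊹ fromℤ (ℤ.+ m ℤ.* j)         ≈⟨ R.+-cong (R.sym (R.*-identityˡ _)) (fromℤ-+* m j) ⟩
    1# ⋆ fromℤ j ⊹ m ×# 1# ⋆ fromℤ j       ≈⟨ R.distribʳ _ _ _ ⟨
    suc m ×# 1# ⋆ fromℤ j                  ∎

  fromℤ-* : ∀ i j → fromℤ (i ℤ.* j) ≈ fromℤ i ⋆ fromℤ j
  fromℤ-* (ℤ.+ m)    j = fromℤ-+* m j
  fromℤ-* ℤ.-[1+ m ] j = begin
    fromℤ (ℤ.-[1+ m ] ℤ.* j)        ≡⟨ cong fromℤ (sym (ℤₚ.neg-distribˡ-* (ℤ.+ suc m) j)) ⟩
    fromℤ (ℤ.- (ℤ.+ suc m ℤ.* j))   ≈⟨ fromℤ-neg (ℤ.+ suc m ℤ.* j) ⟩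
    - fromℤ (ℤ.+ suc m ℤ.* j)       ≈⟨ R.-‿cong (fromℤ-+* (suc m) j) ⟩
    - (suc m ×# 1# ⋆ fromℤ j)        ≈⟨ RP.-‿distribˡ-* _ _ ⟩
    - (suc m ×# 1#) ⋆ fromℤ j        ∎

  morphism : CommutativeRing.rawRing ℤₚ.+-*-commutativeRing -Raw-AlmostCommutative⟶ fromCommutativeRing R
  morphism = record
    { ⟦_⟧    = fromℤ
    ; +-homo = fromℤ-+
    ; *-homo = fromℤ-*
    ; -‿homo = fromℤ-neg
    ; 0-homo = R.refl
    ; 1-homo = R.+-identityʳ 1#
    }

  coeff≟ : ∀ i j → Maybe (fromℤ i ≈ fromℤ j)
  coeff≟ i j with i ℤₚ.≟ j
  ... | yes eq = just (R.reflexive (cong fromℤ eq))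
  ... | no _   = nothing

  module Solver = RingSolver _ _ morphism coeff≟

record FiniteField (p : ℕ) : Set₁ where
  infixl 6 _⊕_
  infixl 7 _⊗_
  infix  8 ⊖_ _⁻¹
  field
    _⊕_ _⊗_ : Fin p → Fin p → Fin p
    ⊖_ _⁻¹  : Fin p → Fin p
    𝟘 𝟙     : Fin p
    isCommutativeRing : IsCommutativeRing _≡_ _⊕_ _⊗_ ⊖_ 𝟘 𝟙
    ⊗-inverseʳ : ∀ x → x ≢ 𝟘 → x ⊗ x ⁻¹ ≡ 𝟙
    𝟘⁻¹≡𝟘      : 𝟘 ⁻¹ ≡ 𝟘
    𝟙≢𝟘        : 𝟙 ≢ 𝟘
    -- F_p is prime: 1 generates its additive group.
    generated  : (P : Fin p → Set) → P 𝟘 → (∀ x → P x → P (x ⊕ 𝟙)) → ∀ x → P x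

-- Plünnecke inequalities

FinSet : ℕ → Set
FinSet p = Fin p → Bool

xy∙z≡xz∙y : ∀ x y z → x * y * z ≡ x * z * y
xy∙z≡xz∙y = solve-∀

bool-ext : ∀ {b c : Bool} → (b ≡ true → c ≡ true) → (c ≡ true → b ≡ true) → b ≡ c
bool-ext {true}  {c} f g = sym (f refl)
bool-ext {false} {true}  f g = g refl
bool-ext {false} {false} f g = refl

#-strict : ∀ {n} {S T : FinSet n} → S ⊆ T → ∀ i → T i ≡ true → S i ≡ false → # S < # T
#-strict {S = S} {T} S⊆T i Ti Si = subst (_< # T) (∑-cong λ j → cong ⟦_⟧ (S∧T≡S j)) (≤-trans (m<m+n _ pos) (≤-reflexive split))
  where
  S∧T≡S : ∀ j → T j ∧ S j ≡ S j
  S∧T≡S j with S j in eq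
  ... | true  = trans (cong (_∧ true) (S⊆T j eq)) refl
  ... | false = Boolₚ.∧-zeroʳ (T j)
  split : # (λ j → T j ∧ S j) + # (λ j → T j ∧ not (S j)) ≡ # T
  split = trans (sym (∑-+ _ _)) (∑-cong λ j → lem (T j) (S j))
    where
    lem : ∀ b c → ⟦ b ∧ c ⟧ + ⟦ b ∧ not c ⟧ ≡ ⟦ b ⟧
    lem true  true  = refl
    lem true  false = refl
    lem false _     = refl
  pos : 0 < # (λ j → T j ∧ not (S j))
  pos = ∈⇒#>0 i (∧-intro Ti (cong not Si))

#-antisym : ∀ {n} {S T : FinSet n} → S ⊆ T → # T ≤ # S → ∀ i → S i ≡ T i
#-antisym {S = S} {T} S⊆T T≤S i with S i in eqS | T i in eqT
... | true  | true  = refl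
... | false | false = refl
... | true  | false = trans (sym (S⊆T i eqS)) eqT
... | false | true  = ⊥-elim (<⇒≱ (#-strict S⊆T i eqT eqS) T≤S)

module _ {p : ℕ} where

  Extensional : (FinSet p → ℕ) → Set
  Extensional φ = ∀ {S T} → (∀ i → S i ≡ T i) → φ S ≡ φ T

  -- The ratio `φ X / |X|` is compared by cross-multiplication. Only subsets of `X` compete: the
  -- sets met in Petridis's induction are of this kind.
  Minimal : (FinSet p → ℕ) → FinSet p → Set
  Minimal φ X = ∀ Y → Y ⊆ X → φ X * # Y ≤ φ Y * # X

  -- Descent on `|X|`: a subset of strictly smaller ratio cannot be all of `X`, so passing to it
  -- lowers the cardinality, and it cannot be empty, since then the right side of the strict
  -- inequality would be 0.
  minimal-subset : (φ : FinSet p → ℕ) → Extensional φ → (X₀ : FinSet p) → 0 < # X₀ →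
    ∃ λ X → X ⊆ X₀ × 0 < # X × φ X * # X₀ ≤ φ X₀ * # X × Minimal φ X
  minimal-subset φ ext X₀ X₀>0 = go (suc (# X₀)) X₀ ≤-refl X₀>0
    where
    Better : FinSet p → Subset p → Set
    Better X s = (∀ i → lookup s i ≡ true → X i ≡ true) × φ (lookup s) * # X < φ X * # (lookup s)

    better? : ∀ X s → Dec (Better X s)
    better? X s = all? (λ i → (lookup s i Boolₚ.≟ true) →-dec (X i Boolₚ.≟ true))
                  ×-dec (φ (lookup s) * # X <? φ X * # (lookup s))

    go : ∀ fuel X → # X < fuel → 0 < # X →
         ∃ λ X′ → X′ ⊆ X × 0 < # X′ × φ X′ * # X ≤ φ X * # X′ × Minimal φ X′
    go zero       X () X>0
    go (suc fuel) X X<fuel X>0 with anySubset? (better? X)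
    ... | no none = X , (λ i h → h) , X>0 , ≤-refl , minimal
      where
      minimal : Minimal φ X
      minimal Y Y⊆X = ≮⇒≥ λ lt → none (tabulate Y ,
        (λ i h → Y⊆X i (trans (sym (lookup∘tabulate Y i)) h)) ,
        subst₂ _<_ (cong (_* # X) (sym (ext (lookup∘tabulate Y))))
                   (cong (φ X *_) (sym (#-cong (lookup∘tabulate Y)))) lt)
    ... | yes (s , Y⊆X , lt) with go fuel Y Y<fuel Y>0
      where
      Y = lookup s
      Y<X : # Y < # X
      Y<X = ≰⇒> λ X≤Y → <-irrefl
        (cong₂ _*_ (ext (#-antisym Y⊆X X≤Y)) (sym (#-cong (#-antisym Y⊆X X≤Y)))) lt
      Y<fuel : # Y < fuel
      Y<fuel = <-≤-trans Y<X (s≤s⁻¹ X<fuel)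
      Y>0 : 0 < # Y
      Y>0 = n≢0⇒n>0 λ eq → <⇒≱ lt (≤-trans (≤-reflexive (trans (cong (φ X *_) eq) (*-zeroʳ (φ X)))) z≤n)
    ...   | X′ , X′⊆Y , X′>0 , ratio , min =
            X′ , (λ i h → Y⊆X i (X′⊆Y i h)) , X′>0 , ratio′ , min
      where
      Y = lookup s
      open ≤-Reasoning
      instance
        Y≢0 : NonZero (# Y)
        Y≢0 = >-nonZero (<-≤-trans X′>0 (#-mono X′⊆Y))
      ratio′ : φ X′ * # X ≤ φ X * # X′
      ratio′ = *-cancelʳ-≤ _ _ (# Y) (begin
        φ X′ * # X * # Y   ≡⟨ xy∙z≡xz∙y (φ X′) (# X) (# Y) ⟩
        φ X′ * # Y * # X   ≤⟨ *-monoˡ-≤ (# X) ratio ⟩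
        φ Y * # X′ * # X   ≡⟨ xy∙z≡xz∙y (φ Y) (# X′) (# X) ⟩
        φ Y * # X * # X′   ≤⟨ *-monoˡ-≤ (# X′) (<⇒≤ lt) ⟩
        φ X * # Y * # X′   ≡⟨ xy∙z≡xz∙y (φ X) (# Y) (# X′) ⟩
        φ X * # X′ * # Y   ∎)

  -- Petridis's lemma and Plünnecke's inequality for an abstract action

  record Submodular (φ : FinSet p → ℕ) : Set where
    field
      ext    : Extensional φ
      empty  : φ (λ _ → false) ≡ 0
      submod : ∀ S T → φ (λ i → S i ∨ T i) + φ (λ i → S i ∧ T i) ≤ φ S + φ T

  combination-submodular : ∀ a b {φ ψ} → Submodular φ → Submodular ψ →
                           Submodular (λ X → a * φ X + b * ψ X)
  combination-submodular a b {φ} {ψ} Φ Ψ = record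
    { ext    = λ h → cong₂ _+_ (cong (a *_) (Φ.ext h)) (cong (b *_) (Ψ.ext h))
    ; empty  = trans (cong₂ _+_ (cong (a *_) Φ.empty) (cong (b *_) Ψ.empty)) (cong₂ _+_ (*-zeroʳ a) (*-zeroʳ b))
    ; submod = λ S T → begin
        (a * φ (S ∪ T) + b * ψ (S ∪ T)) + (a * φ (S ∩ T) + b * ψ (S ∩ T))
          ≡⟨ lem a b (φ (S ∪ T)) (ψ (S ∪ T)) (φ (S ∩ T)) (ψ (S ∩ T)) ⟩
        a * (φ (S ∪ T) + φ (S ∩ T)) + b * (ψ (S ∪ T) + ψ (S ∩ T))
          ≤⟨ +-mono-≤ (*-monoʳ-≤ a (Φ.submod S T)) (*-monoʳ-≤ b (Ψ.submod S T)) ⟩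
        a * (φ S + φ T) + b * (ψ S + ψ T)
          ≡⟨ lem a b (φ S) (ψ S) (φ T) (ψ T) ⟨
        (a * φ S + b * ψ S) + (a * φ T + b * ψ T)  ∎
    }
    where
    open ≤-Reasoning
    module Φ = Submodular Φ
    module Ψ = Submodular Ψ
    _∪_ _∩_ : FinSet p → FinSet p → FinSet p
    (S ∪ T) i = S i ∨ T i
    (S ∩ T) i = S i ∧ T i
    lem : ∀ a b x y z w → (a * x + b * y) + (a * z + b * w) ≡ a * (x + z) + b * (y + w)
    lem = solve-∀

  module Action (act act⁻ : Fin p → Fin p → Fin p) where

    -- act d is the inverse of the translation by d, so X · D is the union of the translates of X.
    infixl 6 _·_
    abstract
      _·_ : FinSet p → FinSet p → FinSet p
      (X · D) z = any (λ d → D d ∧ X (act d z))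

      ·-intro : ∀ {X D} d z → D d ≡ true → X (act d z) ≡ true → (X · D) z ≡ true
      ·-intro d z Dd Xz = any-intro d (∧-intro Dd Xz)

      ·-elim : ∀ {X D} z → (X · D) z ≡ true → ∃ λ d → D d ≡ true × X (act d z) ≡ true
      ·-elim {X} {D} z h with any-elim {S = λ d → D d ∧ X (act d z)} h
      ... | d , q = d , ∧-fst q , ∧-snd {D d} q

    ·-monoˡ : ∀ {X Y} D → X ⊆ Y → (X · D) ⊆ (Y · D)
    ·-monoˡ {X} D X⊆Y z h with ·-elim {X} {D} z h
    ... | d , Dd , Xz = ·-intro d z Dd (X⊆Y _ Xz)

    -- Demanded only for `d ∈ D`, because in the multiplicative instance the action of 0 is not a
    -- bijection.
    Invertible : FinSet p → Set
    Invertible D = ∀ d → D d ≡ true →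
      (∀ z → act⁻ d (act d z) ≡ z) × (∀ z → act d (act⁻ d z) ≡ z)

    Invariant : (FinSet p → ℕ) → FinSet p → Set
    Invariant φ D = ∀ d → D d ≡ true → ∀ X → φ (X ∘ act d) ≡ φ X

    #-act : ∀ {D} → Invertible D → Invariant # D
    #-act inv d Dd X = ∑-reindex (act d) (act⁻ d) (proj₂ (inv d Dd)) (proj₁ (inv d Dd)) (⟦_⟧ ∘ X)

    -- The list form of `X · D`, which lets the induction add one translate at a time.
    _·ᴸ_ : FinSet p → List (Fin p) → FinSet p
    (X ·ᴸ [])       z = false
    (X ·ᴸ (d ∷ ds)) z = X (act d z) ∨ (X ·ᴸ ds) z

    ·ᴸ-intro : ∀ {X ds d z} → d ∈ ds → X (act d z) ≡ true → (X ·ᴸ ds) z ≡ true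
    ·ᴸ-intro (here refl) h rewrite h = refl
    ·ᴸ-intro {X} {d′ ∷ ds} {d} {z} (there d∈) h =
      trans (cong (X (act d′ z) ∨_) (·ᴸ-intro {X} d∈ h)) (Boolₚ.∨-zeroʳ _)

    ·ᴸ-elim : ∀ {X} ds {z} → (X ·ᴸ ds) z ≡ true → ∃ λ d → d ∈ ds × X (act d z) ≡ true
    ·ᴸ-elim {X} (d ∷ ds) {z} h with X (act d z) in eq
    ... | true  = d , here refl , eq
    ... | false with ·ᴸ-elim {X} ds h
    ...   | d′ , d′∈ , q = d′ , there d′∈ , q

    elements : FinSet p → List (Fin p)
    elements D = filter (λ d → D d Boolₚ.≟ true) (allFin p)

    ·≡·ᴸ : ∀ X D z → (X · D) z ≡ (X ·ᴸ elements D) z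
    ·≡·ᴸ X D z = bool-ext to from
      where
      P? = λ d → D d Boolₚ.≟ true
      to : (X · D) z ≡ true → (X ·ᴸ elements D) z ≡ true
      to h with ·-elim {X} {D} z h
      ... | d , Dd , q = ·ᴸ-intro {X} (∈-filter⁺ P? (∈-allFin d) Dd) q
      from : (X ·ᴸ elements D) z ≡ true → (X · D) z ≡ true
      from h with ·ᴸ-elim {X} (elements D) h
      ... | d , d∈ , q = ·-intro d z (proj₂ (∈-filter⁻ P? {xs = allFin p} d∈)) q

    module _ {φ} (φ-sub : Submodular φ) {D} (inv : Invertible D) (φ-inv : Invariant φ D)
             {X} (min : Minimal φ X) where
      open Submodular φ-sub

      -- Petridis's induction: a new translate `V` of `X` joins the union `U` of the others. The
      -- overlap `V ∩ U` is a translate of some `Xd ⊆ X`. Minimality gives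
      -- `φ Xd ≥ (φ X / |X|) |Xd|`, so what submodularity saves in `φ` on the overlap makes up for
      -- what the overlap costs in `|V ∪ U|`.
      petridisᴸ : ∀ ds → (∀ {d} → d ∈ ds → D d ≡ true) → φ (X ·ᴸ ds) * # X ≤ φ X * # (X ·ᴸ ds)
      petridisᴸ [] h = ≤-trans (≤-reflexive (cong (_* # X) empty)) z≤n
      petridisᴸ (d ∷ ds) h = +-cancelʳ-≤ (φ X * # Xd) _ _ (begin
          φ V∪U * # X + φ X * # Xd              ≤⟨ +-monoʳ-≤ (φ V∪U * # X) (min Xd λ i → ∧-fst) ⟩
          φ V∪U * # X + φ Xd * # X              ≡⟨ *-distribʳ-+ (# X) (φ V∪U) (φ Xd) ⟨
          (φ V∪U + φ Xd) * # X                  ≡⟨ cong (λ v → (φ V∪U + v) * # X) (sym φV∩U) ⟩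
          (φ V∪U + φ V∩U) * # X                 ≤⟨ *-monoˡ-≤ (# X) (submod V U) ⟩
          (φ V + φ U) * # X                     ≡⟨ cong (λ v → (v + φ U) * # X) (φ-inv d Dd X) ⟩
          (φ X + φ U) * # X                     ≡⟨ *-distribʳ-+ (# X) (φ X) (φ U) ⟩
          φ X * # X + φ U * # X                 ≤⟨ +-monoʳ-≤ (φ X * # X) (petridisᴸ ds (λ d∈ → h (there d∈))) ⟩
          φ X * # X + φ X * # U                 ≡⟨ *-distribˡ-+ (φ X) (# X) (# U) ⟨
          φ X * (# X + # U)                     ≡⟨ cong (λ v → φ X * (v + # U)) (sym (#-act inv d Dd X)) ⟩
          φ X * (# V + # U)                     ≡⟨ cong (φ X *_) (sym (#-∪∩ V U)) ⟩
          φ X * (# V∪U + # V∩U)                 ≡⟨ cong (λ v → φ X * (# V∪U + v)) #V∩U ⟩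
          φ X * (# V∪U + # Xd)                  ≡⟨ *-distribˡ-+ (φ X) (# V∪U) (# Xd) ⟩
          φ X * # V∪U + φ X * # Xd              ∎)
        where
        open ≤-Reasoning
        Dd = h (here refl)
        U V V∪U V∩U Xd : FinSet p
        U = X ·ᴸ ds
        V = X ∘ act d
        V∪U = λ z → V z ∨ U z
        V∩U = λ z → V z ∧ U z
        Xd = λ x → X x ∧ U (act⁻ d x)
        same : ∀ z → V∩U z ≡ Xd (act d z)
        same z = cong (λ y → X (act d z) ∧ U y) (sym (proj₁ (inv d Dd) z))
        φV∩U : φ V∩U ≡ φ Xd
        φV∩U = trans (ext same) (φ-inv d Dd Xd)
        #V∩U : # V∩U ≡ # Xd
        #V∩U = trans (#-cong same) (#-act inv d Dd Xd)

      petridis : φ (X · D) * # X ≤ φ X * # (X · D)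
      petridis = subst₂ _≤_
        (cong (_* # X) (ext (λ z → sym (·≡·ᴸ X D z))))
        (cong (φ X *_) (#-cong (λ z → sym (·≡·ᴸ X D z))))
        (petridisᴸ (elements D) (λ d∈ → proj₂ (∈-filter⁻ (λ d → D d Boolₚ.≟ true) {xs = allFin p} d∈)))

    ·-cong : ∀ {X Y} D → (∀ i → X i ≡ Y i) → ∀ z → (X · D) z ≡ (Y · D) z
    ·-cong D h z = bool-ext
      (·-monoˡ D (λ i q → trans (sym (h i)) q) z) (·-monoˡ D (λ i q → trans (h i) q) z)

    #·-submodular : ∀ B → Submodular (λ X → # (X · B))
    #·-submodular B = record
      { ext    = λ h → #-cong (·-cong B h)
      ; empty  = ∑-zero λ z → lem z
      ; submod = λ S T → ≤-trans
          (+-mono-≤ (#-mono {T = λ z → (S · B) z ∨ (T · B) z} (∪-to S T))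
                    (#-mono {T = λ z → (S · B) z ∧ (T · B) z} (∩-to S T)))
          (≤-reflexive (#-∪∩ (S · B) (T · B)))
      }
      where
      lem : ∀ z → ⟦ ((λ _ → false) · B) z ⟧ ≡ 0
      lem z with ((λ _ → false) · B) z in eq
      ... | false = refl
      ... | true with ·-elim {λ _ → false} {B} z eq
      ...   | _ , _ , ()
      ∪-to : ∀ S T z → ((λ i → S i ∨ T i) · B) z ≡ true → (S · B) z ∨ (T · B) z ≡ true
      ∪-to S T z h with ·-elim {λ i → S i ∨ T i} {B} z h
      ... | b , Bb , q with S (act b z) in eq
      ...   | true  = cong (_∨ (T · B) z) (·-intro b z Bb eq)
      ...   | false = trans (cong ((S · B) z ∨_) (·-intro b z Bb q)) (Boolₚ.∨-zeroʳ _)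
      ∩-to : ∀ S T z → ((λ i → S i ∧ T i) · B) z ≡ true → (S · B) z ∧ (T · B) z ≡ true
      ∩-to S T z h with ·-elim {λ i → S i ∧ T i} {B} z h
      ... | b , Bb , q = ∧-intro (·-intro b z Bb (∧-fst q)) (·-intro b z Bb (∧-snd {S (act b z)} q))

    module _ (act-comm : ∀ b c z → act b (act c z) ≡ act c (act b z)) where

      #·-invariant : ∀ B {D} → Invertible D → Invariant (λ X → # (X · B)) D
      #·-invariant B inv d Dd X = trans
        (#-cong λ z → bool-ext (to z) (from z))
        (#-act inv d Dd (X · B))
        where
        to : ∀ z → ((X ∘ act d) · B) z ≡ true → (X · B) (act d z) ≡ true
        to z h with ·-elim {X ∘ act d} {B} z h
        ... | b , Bb , q = ·-intro b (act d z) Bb (trans (cong X (act-comm b d z)) q)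
        from : ∀ z → (X · B) (act d z) ≡ true → ((X ∘ act d) · B) z ≡ true
        from z h with ·-elim {X} {B} (act d z) h
        ... | b , Bb , q = ·-intro {X ∘ act d} b z Bb (trans (cong X (act-comm d b z)) q)

      -- `T` minimises `|Y · B| / |Y|` and is chosen before `D`, so a single `T` serves every `D`.
      plünnecke : ∀ B X₀ → 0 < # X₀ → ∃ λ T → T ⊆ X₀ × 0 < # T ×
        # (T · B) * # X₀ ≤ # (X₀ · B) * # T ×
        (∀ D → Invertible D → # (T · D · B) * # T ≤ # (T · B) * # (T · D))
      plünnecke B X₀ X₀>0 with minimal-subset _ (Submodular.ext (#·-submodular B)) X₀ X₀>0
      ... | T , T⊆ , T>0 , ratio , min = T , T⊆ , T>0 , ratio ,
        λ D inv → petridis (#·-submodular B) inv (#·-invariant B inv) min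

      -- The weights of φ balance the two summands, as both contribute P R to φ X.
      plünnecke₂ : ∀ B C X → Invertible C → 0 < # (X · B) → 0 < # (X · C) → 0 < # X →
        ∃ λ T → T ⊆ X × 0 < # T ×
        # (T · C · B) * (# X * # X) ≤ 4 * (# (X · B) * # (X · C)) * # T
      plünnecke₂ B C X inv P>0 R>0 X>0 =
        let T , T⊆ , T>0 , ratio , min = minimal-subset φ (Submodular.ext φ-sub) X X>0
        in T , T⊆ , T>0 , bound T T>0 ratio (petridis φ-sub inv φ-inv min)
        where
        P = # (X · B)
        R = # (X · C)
        φ : FinSet p → ℕ
        φ Y = R * # (Y · B) + P * # (Y · C)
        φ-sub : Submodular φ
        φ-sub = combination-submodular R P (#·-submodular B) (#·-submodular C)
        φ-inv : Invariant φ C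
        φ-inv d Dd Y = cong₂ _+_ (cong (R *_) (#·-invariant B inv d Dd Y))
                                 (cong (P *_) (#·-invariant C inv d Dd Y))
        φX : φ X ≡ 2 * (P * R)
        φX = lem P R
          where
          lem : ∀ P R → R * P + P * R ≡ 2 * (P * R)
          lem = solve-∀
        bound : ∀ T → 0 < # T → φ T * # X ≤ φ X * # T → φ (T · C) * # T ≤ φ T * # (T · C) →
                # (T · C · B) * (# X * # X) ≤ 4 * (P * R) * # T
        bound T T>0 ratio pet = *-cancelʳ-≤ _ _ (P * R * # T) {{nz}} (begin
          TCB * (x * x) * (P * R * t)            ≡⟨ solve 5 (λ u x P R t → u :* (x :* x) :* (P :* R :* t) := R :* u :* t :* (P :* (x :* x))) refl TCB x P R t ⟩
          -- `R * TCB` is one summand of `φ (T · C)`, which Petridis's lemma compares with `φ T`;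
          -- two lines below, `P * TC` is one summand of `φ T` itself. Thus `φ T ≤ 2 P R t / x` is
          -- used twice.
          R * TCB * t * (P * (x * x))            ≤⟨ *-monoˡ-≤ (P * (x * x)) (≤-trans (*-monoˡ-≤ t (m≤m+n (R * TCB) _)) pet) ⟩
          φ T * TC * (P * (x * x))               ≡⟨ solve 4 (λ f c P x → f :* c :* (P :* (x :* x)) := f :* x :* (P :* c :* x)) refl (φ T) TC P x ⟩
          φ T * x * (P * TC * x)                 ≤⟨ *-monoʳ-≤ (φ T * x) (*-monoˡ-≤ x (m≤n+m (P * TC) (R * # (T · B)))) ⟩
          φ T * x * (φ T * x)                    ≤⟨ *-mono-≤ ratio ratio ⟩
          φ X * t * (φ X * t)                    ≡⟨ cong (λ v → v * t * (v * t)) φX ⟩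
          2 * (P * R) * t * (2 * (P * R) * t)    ≡⟨ solve 3 (λ P R t → con 2 :* (P :* R) :* t :* (con 2 :* (P :* R) :* t) := con 4 :* (P :* R) :* t :* (P :* R :* t)) refl P R t ⟩
          4 * (P * R) * t * (P * R * t)          ∎)
          where
          open ≤-Reasoning
          open +-*-Solver
          x = # X
          t = # T
          TC = # (T · C)
          TCB = # (T · C · B)
          nz : NonZero (P * R * t)
          nz = m*n≢0 (P * R) t {{m*n≢0 P R {{>-nonZero P>0}} {{>-nonZero R>0}}}} {{>-nonZero T>0}}

-- Field arithmetic and changes of variable in sums

module FieldProperties {p : ℕ} (𝔽 : FiniteField p) where
  open FiniteField 𝔽 public

  F : Set
  F = Fin p

  commutativeRing : CommutativeRing 0ℓ 0ℓ
  commutativeRing = record { isCommutativeRing = isCommutativeRing }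

  open CommutativeRing commutativeRing public
    using () renaming (*-comm to ⊗-comm; *-assoc to ⊗-assoc; *-identityʳ to ⊗-identityʳ;
      *-identityˡ to ⊗-identityˡ; zeroʳ to ⊗-zeroʳ; zeroˡ to ⊗-zeroˡ; +-comm to ⊕-comm; +-assoc to ⊕-assoc;
      distribʳ to ⊗-distribʳ-⊕)
  module 𝔽-Solver = IntegerCoefficients.Solver commutativeRing
  open 𝔽-Solver using (solve; _:+_; _:*_; :-_; _:=_)

  infixl 6 _⊝_
  infixl 7 _⊘_
  _⊝_ _⊘_ : F → F → F
  x ⊝ y = x ⊕ ⊖ y
  x ⊘ y = x ⊗ y ⁻¹

  ⊗-inverseˡ : ∀ x → x ≢ 𝟘 → x ⁻¹ ⊗ x ≡ 𝟙
  ⊗-inverseˡ x x≢0 = trans (⊗-comm _ x) (⊗-inverseʳ x x≢0)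

  ⊗-⊘ : ∀ x c → c ≢ 𝟘 → x ⊗ c ⊘ c ≡ x
  ⊗-⊘ x c c≢0 = trans (⊗-assoc x c _) (trans (cong (x ⊗_) (⊗-inverseʳ c c≢0)) (⊗-identityʳ x))

  ⊘-⊗ : ∀ x c → c ≢ 𝟘 → x ⊘ c ⊗ c ≡ x
  ⊘-⊗ x c c≢0 = trans (⊗-assoc x _ c) (trans (cong (x ⊗_) (⊗-inverseˡ c c≢0)) (⊗-identityʳ x))

  ⊗-cancelʳ : ∀ {x y} c → c ≢ 𝟘 → x ⊗ c ≡ y ⊗ c → x ≡ y
  ⊗-cancelʳ {x} {y} c c≢0 eq = trans (sym (⊗-⊘ x c c≢0)) (trans (cong (_⊘ c) eq) (⊗-⊘ y c c≢0))

  ⊗-nonzero : ∀ {x y} → x ≢ 𝟘 → y ≢ 𝟘 → x ⊗ y ≢ 𝟘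
  ⊗-nonzero {x} {y} x≢0 y≢0 eq = x≢0 (⊗-cancelʳ y y≢0 (trans eq (sym (⊗-zeroˡ y))))

  ⁻¹-nonzero : ∀ {x} → x ≢ 𝟘 → x ⁻¹ ≢ 𝟘
  ⁻¹-nonzero {x} x≢0 eq = 𝟙≢𝟘 (trans (sym (⊗-inverseʳ x x≢0)) (trans (cong (x ⊗_) eq) (⊗-zeroʳ x)))

  ⁻¹-involutive : ∀ x → (x ⁻¹) ⁻¹ ≡ x
  ⁻¹-involutive x with x ≟ᶠ 𝟘
  ... | yes refl = trans (cong _⁻¹ 𝟘⁻¹≡𝟘) 𝟘⁻¹≡𝟘
  ... | no x≢0   = ⊗-cancelʳ (x ⁻¹) (⁻¹-nonzero x≢0)
        (trans (⊗-inverseˡ (x ⁻¹) (⁻¹-nonzero x≢0)) (sym (⊗-inverseʳ x x≢0)))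

  -- The convention `𝟘 ⁻¹ ≡ 𝟘` covers `x = 0`, so `x ↦ t / x` is an involution of the whole field
  -- and sums can be reindexed by it without removing 0.
  ⊘-⊘ : ∀ t x → t ≢ 𝟘 → t ⊘ (t ⊘ x) ≡ x
  ⊘-⊘ t x t≢0 with x ≟ᶠ 𝟘
  ... | yes refl = trans (cong (λ y → t ⊘ (t ⊗ y)) 𝟘⁻¹≡𝟘)
          (trans (cong (t ⊘_) (⊗-zeroʳ t)) (trans (cong (t ⊗_) 𝟘⁻¹≡𝟘) (⊗-zeroʳ t)))
  ... | no x≢0 = ⊗-cancelʳ (t ⊘ x) t/x≢0
          (trans (⊘-⊗ t (t ⊘ x) t/x≢0) (trans (sym (⊘-⊗ t x x≢0)) (⊗-comm (t ⊘ x) x)))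
    where
    t/x≢0 : t ⊘ x ≢ 𝟘
    t/x≢0 = ⊗-nonzero t≢0 (⁻¹-nonzero x≢0)

  ⊝≢𝟘 : ∀ {x y} → x ≢ y → x ⊝ y ≢ 𝟘
  ⊝≢𝟘 {x} {y} x≢y eq = x≢y (trans (solve 2 (λ x y → x := (x :+ (:- y)) :+ y) refl x y)
    (trans (cong (_⊕ y) eq) (trans (⊕-comm 𝟘 y) (CommutativeRing.+-identityʳ commutativeRing y))))

  ⊕-⊝ : ∀ x c → x ⊕ c ⊝ c ≡ x
  ⊕-⊝ = solve 2 (λ x c → x :+ c :+ (:- c) := x) refl

  ⊝-⊕ : ∀ x c → x ⊝ c ⊕ c ≡ x
  ⊝-⊕ = solve 2 (λ x c → x :+ (:- c) :+ c := x) refl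

  ∑-shift : ∀ c (g : F → ℕ) → ∑ (λ x → g (x ⊕ c)) ≡ ∑ g
  ∑-shift c = ∑-reindex (_⊕ c) (_⊝ c) (λ x → ⊝-⊕ x c) (λ x → ⊕-⊝ x c)

  ∑-reflect : ∀ c (g : F → ℕ) → ∑ (λ x → g (c ⊝ x)) ≡ ∑ g
  ∑-reflect c = ∑-reindex (c ⊝_) (c ⊝_) lem lem
    where
    lem : ∀ x → c ⊝ (c ⊝ x) ≡ x
    lem = solve 2 (λ c x → c :+ (:- (c :+ (:- x))) := x) refl c

  ∑-scale : ∀ c → c ≢ 𝟘 → (g : F → ℕ) → ∑ (λ x → g (x ⊗ c)) ≡ ∑ g
  ∑-scale c c≢0 = ∑-reindex (_⊗ c) (_⊘ c) (λ x → ⊘-⊗ x c c≢0) (λ x → ⊗-⊘ x c c≢0)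

  ∑-unscale : ∀ c → c ≢ 𝟘 → (g : F → ℕ) → ∑ (λ x → g (x ⊘ c)) ≡ ∑ g
  ∑-unscale c c≢0 = ∑-reindex (_⊘ c) (_⊗ c) (λ x → ⊗-⊘ x c c≢0) (λ x → ⊘-⊗ x c c≢0)

  ∑-⁻¹ : (g : F → ℕ) → ∑ (λ x → g (x ⁻¹)) ≡ ∑ g
  ∑-⁻¹ = ∑-reindex _⁻¹ _⁻¹ ⁻¹-involutive ⁻¹-involutive

  ∑-quotient : ∀ t → t ≢ 𝟘 → (g : F → ℕ) → ∑ (λ x → g (t ⊘ x)) ≡ ∑ g
  ∑-quotient t t≢0 = ∑-reindex (t ⊘_) (t ⊘_) (λ x → ⊘-⊘ t x t≢0) (λ x → ⊘-⊘ t x t≢0)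

-- Dependent random choice

∑₂ : ∀ {m n} → (Fin m → Fin n → ℕ) → ℕ
∑₂ Φ = ∑ λ i → ∑ λ j → Φ i j

∑₂-cong : ∀ {m n} {Φ Ψ : Fin m → Fin n → ℕ} → (∀ i j → Φ i j ≡ Ψ i j) → ∑₂ Φ ≡ ∑₂ Ψ
∑₂-cong h = ∑-cong λ i → ∑-cong λ j → h i j

∑₂-mono : ∀ {m n} {Φ Ψ : Fin m → Fin n → ℕ} → (∀ i j → Φ i j ≤ Ψ i j) → ∑₂ Φ ≤ ∑₂ Ψ
∑₂-mono h = ∑-mono λ i → ∑-mono λ j → h i j

∑₂-∑ : ∀ {l m n} (Φ : Fin m → Fin n → Fin l → ℕ) →
       ∑₂ (λ i j → ∑ λ a → Φ i j a) ≡ ∑ λ a → ∑₂ λ i j → Φ i j a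
∑₂-∑ Φ = trans (∑-cong λ i → ∑-swap (Φ i)) (∑-swap λ i a → ∑ λ j → Φ i j a)

∑₂-*ˡ : ∀ {m n} c (Φ : Fin m → Fin n → ℕ) → ∑₂ (λ i j → c * Φ i j) ≡ c * ∑₂ Φ
∑₂-*ˡ c Φ = trans (∑-cong λ i → ∑-*ˡ c (Φ i)) (∑-*ˡ c λ i → ∑ (Φ i))

∑₂-+ : ∀ {m n} (Φ Ψ : Fin m → Fin n → ℕ) → ∑₂ (λ i j → Φ i j + Ψ i j) ≡ ∑₂ Φ + ∑₂ Ψ
∑₂-+ Φ Ψ = trans (∑-cong λ i → ∑-+ (Φ i) (Ψ i)) (∑-+ _ _)

∑₂-product : ∀ {m n} (f : Fin m → ℕ) (g : Fin n → ℕ) → ∑₂ (λ i j → f i * g j) ≡ ∑ f * ∑ g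
∑₂-product f g = trans (∑-cong λ i → ∑-*ˡ (f i) g) (∑-*ʳ (∑ g) f)

∑₂-pigeonhole : ∀ {m n} (Φ Ψ : Fin m → Fin n → ℕ) → ∑₂ Φ < ∑₂ Ψ → ∃ λ i → ∃ λ j → Φ i j < Ψ i j
∑₂-pigeonhole Φ Ψ lt with ∑-pigeonhole (λ i → ∑ (Φ i)) (λ i → ∑ (Ψ i)) lt
... | i , lt′ = i , ∑-pigeonhole (Φ i) (Ψ i) lt′

≤-true : ∀ {m n} → (m ≤ᵇ n) ≡ true → m ≤ n
≤-true {m} {n} eq = ≤ᵇ⇒≤ m n (subst T (sym eq) tt)

true-≤ : ∀ {m n} → m ≤ n → (m ≤ᵇ n) ≡ true
true-≤ {m} {n} le with m ≤ᵇ n | ≤⇒≤ᵇ le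
... | true | _ = refl

≤-false : ∀ {m n} → (m ≤ᵇ n) ≡ false → n < m
≤-false {m} {n} eq = ≰⇒> λ le → true≢false (true-≤ le) eq

module Selection {p : ℕ} (𝔽 : FiniteField p) (A : FinSet p)
                 (A∌0 : ∀ x → A x ≡ true → x ≢ FiniteField.𝟘 𝔽) where
  open FieldProperties 𝔽

  α : F → ℕ
  α x = ⟦ A x ⟧

  n : ℕ
  n = # A

  w : F → ℕ
  w s = ∑ λ x → α x * α (s ⊘ x)

  AA : FinSet p
  AA s = 1 ≤ᵇ w s

  k : ℕ
  k = # AA

  -- Popular products. The mean of `w` over `AA` is `n²/k`; with half of it as threshold, the
  -- unpopular products carry at most half of the total mass `n²`.
  S : FinSet p
  S s = n * n ≤ᵇ 2 * k * w s

  G : F → ℕ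
  G s = ⟦ S s ⟧ * w s

  h : F → F → ℕ
  h a b = ∑ λ u → α (u ⊘ a) * α (u ⊘ b)

  -- f a x v counts paths from a/x to 1/v, and h a b paths from a/t to b/t.
  f : F → F → F → ℕ
  f a x v = ∑₂ λ y c → α y * α c * (α (y ⊗ a ⊘ x) * α (y ⊗ c ⊘ v))

  w≤n : ∀ s → w s ≤ n
  w≤n s = ∑-mono λ x → ≤-trans (*-monoʳ-≤ (α x) (⟦⟧≤1 (A (s ⊘ x)))) (≤-reflexive (*-identityʳ _))

  G≤n : ∀ s → G s ≤ n
  G≤n s = ≤-trans (⟦⟧*-≤ (S s) λ _ → ≤-refl) (w≤n s)

  ∑-w : ∀ (g : F → ℕ) → ∑ (λ s → g s * w s) ≡ ∑ λ x → α x * ∑ λ b → α b * g (b ⊗ x)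
  ∑-w g = begin
    ∑ (λ s → g s * w s)                          ≡⟨ (∑-cong λ s → sym (∑-*ˡ (g s) λ x → α x * α (s ⊘ x))) ⟩
    ∑₂ (λ s x → g s * (α x * α (s ⊘ x)))         ≡⟨ ∑-swap (λ s x → g s * (α x * α (s ⊘ x))) ⟩
    ∑₂ (λ x s → g s * (α x * α (s ⊘ x)))         ≡⟨ (∑₂-cong λ x s → x∙yz≡y∙zx (g s) (α x) (α (s ⊘ x))) ⟩
    ∑₂ (λ x s → α x * (α (s ⊘ x) * g s))         ≡⟨ (∑-cong λ x → trans (∑-*ˡ (α x) λ s → α (s ⊘ x) * g s) (⟦⟧-guard-≡ (A x) (reindex x))) ⟩
    ∑ (λ x → α x * ∑ λ b → α b * g (b ⊗ x))      ∎
    where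
    open ≡-Reasoning
    x∙yz≡y∙zx : ∀ x y z → x * (y * z) ≡ y * (z * x)
    x∙yz≡y∙zx = solve-∀
    reindex : ∀ x → A x ≡ true → ∑ (λ s → α (s ⊘ x) * g s) ≡ ∑ λ b → α b * g (b ⊗ x)
    reindex x Ax = trans (sym (∑-scale x x≢0 λ s → α (s ⊘ x) * g s))
      (∑-cong λ b → cong (λ y → α y * g (b ⊗ x)) (⊗-⊘ b x x≢0))
      where x≢0 = A∌0 x Ax

  ∑w≡n² : ∑ w ≡ n * n
  ∑w≡n² = begin
    ∑ w                                 ≡⟨ (∑-cong λ s → sym (*-identityˡ (w s))) ⟩
    ∑ (λ s → 1 * w s)                   ≡⟨ ∑-w (λ _ → 1) ⟩
    ∑ (λ x → α x * ∑ λ b → α b * 1)     ≡⟨ (∑-cong λ x → cong (α x *_) (∑-cong λ b → *-identityʳ (α b))) ⟩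
    ∑ (λ x → α x * n)                   ≡⟨ ∑-*ʳ n α ⟩
    n * n                               ∎
    where open ≡-Reasoning

  ∑G≤n² : ∑ G ≤ n * n
  ∑G≤n² = subst (∑ G ≤_) ∑w≡n² (∑-mono λ s → ⟦⟧*-≤ (S s) λ _ → ≤-refl)

  popular-mass : n * n * k ≤ 2 * k * ∑ G
  popular-mass = +-cancelʳ-≤ (n * n * k) _ _ (begin
    n * n * k + n * n * k                       ≡⟨ lem (n * n) k ⟩
    2 * k * (n * n)                             ≡⟨ cong (2 * k *_) ∑w≡n² ⟨
    2 * k * ∑ w                                 ≡⟨ ∑-*ˡ (2 * k) w ⟨
    ∑ (λ s → 2 * k * w s)                       ≤⟨ ∑-mono pointwise ⟩
    ∑ (λ s → 2 * k * G s + n * n * ⟦ AA s ⟧)    ≡⟨ ∑-+ _ _ ⟩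
    ∑ (λ s → 2 * k * G s) + ∑ (λ s → n * n * ⟦ AA s ⟧)  ≡⟨ cong₂ _+_ (∑-*ˡ (2 * k) G) (∑-*ˡ (n * n) (⟦_⟧ ∘ AA)) ⟩
    2 * k * ∑ G + n * n * k                     ∎)
    where
    open ≤-Reasoning
    lem : ∀ x k → x * k + x * k ≡ 2 * k * x
    lem = solve-∀
    pointwise : ∀ s → 2 * k * w s ≤ 2 * k * G s + n * n * ⟦ AA s ⟧
    pointwise s with n * n ≤ᵇ 2 * k * w s in eq
    ... | true  = ≤-trans (≤-reflexive (cong (2 * k *_) (sym (*-identityˡ (w s))))) (m≤m+n _ _)
    ... | false with w s
    ...   | zero  = ≤-trans (≤-reflexive (*-zeroʳ (2 * k))) z≤n
    ...   | suc v = ≤-trans (<⇒≤ (≤-false eq)) (≤-trans (≤-reflexive (sym (*-identityʳ (n * n)))) (m≤n+m _ (2 * k * 0)))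

  -- On popular products `w ≥ n²/(2k)`, and by `popular-mass` their total weight is at least `n²/2`;
  -- the two bounds multiply.
  popular-energy : 0 < k → n * n * (n * n) ≤ 4 * k * ∑ (λ s → G s * w s)
  popular-energy k>0 = *-cancelʳ-≤ _ _ k {{>-nonZero k>0}} (begin
    n * n * (n * n) * k                  ≡⟨ *-assoc (n * n) (n * n) k ⟩
    n * n * (n * n * k)                  ≤⟨ *-monoʳ-≤ (n * n) popular-mass ⟩
    n * n * (2 * k * ∑ G)                ≡⟨ lem₁ (n * n) k (∑ G) ⟩
    2 * k * (n * n * ∑ G)                ≡⟨ cong (2 * k *_) (∑-*ˡ (n * n) G) ⟨
    2 * k * ∑ (λ s → n * n * G s)        ≤⟨ *-monoʳ-≤ (2 * k) (∑-mono pointwise) ⟩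
    2 * k * ∑ (λ s → 2 * k * (G s * w s)) ≡⟨ cong (2 * k *_) (∑-*ˡ (2 * k) λ s → G s * w s) ⟩
    2 * k * (2 * k * ∑ (λ s → G s * w s)) ≡⟨ lem₂ k (∑ (λ s → G s * w s)) ⟩
    4 * k * ∑ (λ s → G s * w s) * k      ∎)
    where
    open ≤-Reasoning
    lem₁ : ∀ x k g → x * (2 * k * g) ≡ 2 * k * (x * g)
    lem₁ = solve-∀
    lem₂ : ∀ k g → 2 * k * (2 * k * g) ≡ 4 * k * g * k
    lem₂ = solve-∀
    lem₃ : ∀ x b v → x * (b * v) ≡ b * (x * v)
    lem₃ = solve-∀
    lem₄ : ∀ b k v → b * (2 * k * v * v) ≡ 2 * k * (b * v * v)
    lem₄ = solve-∀
    pointwise : ∀ s → n * n * G s ≤ 2 * k * (G s * w s)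
    pointwise s = begin
      n * n * (⟦ S s ⟧ * w s)         ≡⟨ lem₃ (n * n) ⟦ S s ⟧ (w s) ⟩
      ⟦ S s ⟧ * (n * n * w s)         ≤⟨ ⟦⟧-guard (S s) (λ Ss → *-monoˡ-≤ (w s) (≤-true {n * n} {2 * k * w s} Ss)) ⟩
      ⟦ S s ⟧ * (2 * k * w s * w s)   ≡⟨ lem₄ ⟦ S s ⟧ k (w s) ⟩
      2 * k * (⟦ S s ⟧ * w s * w s)   ∎

  Z : F → F → FinSet p
  Z t τ a = A a ∧ (A (t ⊘ a) ∧ A (τ ⊗ a))

  W : F → FinSet p
  W s v = A v ∧ A (s ⊘ v)

  ⟦Z⟧ : ∀ t τ a → ⟦ Z t τ a ⟧ ≡ α a * (α (t ⊘ a) * α (τ ⊗ a))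
  ⟦Z⟧ t τ a = trans (⟦∧⟧ (A a) _) (cong (α a *_) (⟦∧⟧ (A (t ⊘ a)) (A (τ ⊗ a))))

  Z⇒A : ∀ t τ a → Z t τ a ≡ true → A a ≡ true
  Z⇒A t τ a = ∧-fst

  Z⇒A/ : ∀ t τ a → Z t τ a ≡ true → A (t ⊘ a) ≡ true
  Z⇒A/ t τ a Za = ∧-fst (∧-snd {A a} Za)

  #W≡w : ∀ s → # (W s) ≡ w s
  #W≡w s = ∑-cong λ v → ⟦∧⟧ (A v) (A (s ⊘ v))

  -- The substitution `t = y a`, `τ = c / a` turns `t / a` and `τ a` into the independent variables
  -- `y` and `c`, and gives `t τ = y c`. Both `∑ζG` and `∑bad₃` are evaluated by it.
  ∑₂-reparametrise : ∀ a → a ≢ 𝟘 → (Φ : F → F → ℕ) → ∑₂ Φ ≡ ∑₂ λ y c → Φ (y ⊗ a) (c ⊘ a)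
  ∑₂-reparametrise a a≢0 Φ = trans
    (∑-cong λ t → sym (∑-unscale a a≢0 (Φ t)))
    (sym (∑-scale a a≢0 λ t → ∑ λ c → Φ t (c ⊘ a)))

  cancel-middle : ∀ y a c → a ≢ 𝟘 → y ⊗ a ⊗ (c ⊘ a) ≡ y ⊗ c
  cancel-middle y a c a≢0 = trans (⊗-assoc y a _) (cong (y ⊗_) (trans (⊗-comm a _) (⊘-⊗ c a a≢0)))

  ∑ζG : ∑₂ (λ t τ → # (Z t τ) * G (t ⊗ τ)) ≡ n * ∑ λ s → G s * w s
  ∑ζG = begin
    ∑₂ (λ t τ → # (Z t τ) * G (t ⊗ τ))
      ≡⟨ (∑₂-cong λ t τ → sym (∑-*ʳ (G (t ⊗ τ)) λ a → ⟦ Z t τ a ⟧)) ⟩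
    ∑₂ (λ t τ → ∑ λ a → ⟦ Z t τ a ⟧ * G (t ⊗ τ))
      ≡⟨ ∑₂-∑ (λ t τ a → ⟦ Z t τ a ⟧ * G (t ⊗ τ)) ⟩
    ∑ (λ a → ∑₂ λ t τ → ⟦ Z t τ a ⟧ * G (t ⊗ τ))
      ≡⟨ (∑-cong λ a → ∑₂-cong λ t τ → trans (cong (_* G (t ⊗ τ)) (⟦Z⟧ t τ a)) (*-assoc (α a) _ _)) ⟩
    ∑ (λ a → ∑₂ λ t τ → α a * (α (t ⊘ a) * α (τ ⊗ a) * G (t ⊗ τ)))
      ≡⟨ (∑-cong λ a → trans (∑₂-*ˡ (α a) (Φ a)) (⟦⟧-guard-≡ (A a) (inner a))) ⟩
    ∑ (λ a → α a * ∑ λ s → G s * w s)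
      ≡⟨ ∑-*ʳ (∑ λ s → G s * w s) α ⟩
    n * ∑ (λ s → G s * w s) ∎
    where
    open ≡-Reasoning
    Φ : F → F → F → ℕ
    Φ a t τ = α (t ⊘ a) * α (τ ⊗ a) * G (t ⊗ τ)
    inner : ∀ a → A a ≡ true → ∑₂ (Φ a) ≡ ∑ λ s → G s * w s
    inner a Aa = begin
      ∑₂ (Φ a)                                          ≡⟨ ∑₂-reparametrise a a≢0 (Φ a) ⟩
      ∑₂ (λ y c → Φ a (y ⊗ a) (c ⊘ a))                  ≡⟨ (∑₂-cong λ y c → trans (cong₂ _*_ (cong₂ (λ u v → α u * α v) (⊗-⊘ y a a≢0) (⊘-⊗ c a a≢0)) (cong G (trans (cancel-middle y a c a≢0) (⊗-comm y c)))) (*-assoc (α y) (α c) _)) ⟩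
      ∑₂ (λ y c → α y * (α c * G (c ⊗ y)))              ≡⟨ (∑-cong λ y → ∑-*ˡ (α y) λ c → α c * G (c ⊗ y)) ⟩
      ∑ (λ y → α y * ∑ λ c → α c * G (c ⊗ y))           ≡⟨ ∑-w G ⟨
      ∑ (λ s → G s * w s)                               ∎
      where a≢0 = A∌0 a Aa

  -- Substitute `u = τ a b`: then `u / b = τ a` and `u / a = τ b`. So the condition on `τ` has as
  -- many solutions as the condition on `t`.
  h-dual : ∀ a b → A a ≡ true → A b ≡ true → ∑ (λ τ → α (τ ⊗ a) * α (τ ⊗ b)) ≡ h a b
  h-dual a b Aa Ab = sym (trans
    (sym (∑-scale (a ⊗ b) (⊗-nonzero a≢0 b≢0) λ u → α (u ⊘ a) * α (u ⊘ b)))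
    (∑-cong λ τ → trans (*-comm _ (α (τ ⊗ (a ⊗ b) ⊘ b))) (cong₂ (λ u v → α u * α v)
      (trans (cong (_⊘ b) (sym (⊗-assoc τ a b))) (⊗-⊘ (τ ⊗ a) b b≢0))
      (trans (cong (_⊘ a) (trans (cong (τ ⊗_) (⊗-comm a b)) (sym (⊗-assoc τ b a)))) (⊗-⊘ (τ ⊗ b) a a≢0)))))
    where
    a≢0 = A∌0 a Aa
    b≢0 = A∌0 b Ab

  AA∌0 : ∀ t → AA t ≡ true → t ≢ 𝟘
  AA∌0 t AAt refl with ∑-positive (λ x → α x * α (𝟘 ⊘ x)) (≤-true AAt)
  ... | x , pos = A∌0 (𝟘 ⊘ x) (⟦⟧-true (A (𝟘 ⊘ x)) {α x} (subst (0 <_) (*-comm (α x) _) pos)) (⊗-zeroˡ _)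

  Z⇒AA : ∀ t τ a → Z t τ a ≡ true → AA t ≡ true
  Z⇒AA t τ a Za = true-≤ (≤-trans
    (≤-reflexive (sym (cong₂ _*_ (true⇒⟦⟧ (Z⇒A t τ a Za)) (true⇒⟦⟧ (Z⇒A/ t τ a Za)))))
    (term≤∑ (λ x → α x * α (t ⊘ x)) a))

  module Thresholds (m m₂ : ℕ) where

    good₂ : F → F → Bool
    good₂ a b = m ≤ᵇ h a b

    good₃ : F → F → F → Bool
    good₃ a x v = m₂ ≤ᵇ f a x v

    -- In `bad₃` the point `x` runs over `A ∩ t/A`, which contains `t / Z`. Asking no condition on
    -- `τ` from `x` makes the number of choices `(t , τ)` that select a triple exactly `f a x v`.
    bad₂ bad₃ : F → F → ℕ
    bad₂ t τ = ∑₂ λ a b → ⟦ Z t τ a ⟧ * ⟦ Z t τ b ⟧ * ⟦ not (good₂ a b) ⟧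
    bad₃ t τ = ∑ λ a → ∑ λ x → ∑ λ v →
      ⟦ Z t τ a ⟧ * (α x * α (t ⊘ x)) * ⟦ W (t ⊗ τ) v ⟧ * ⟦ not (good₃ a x v) ⟧

    -- For a fixed pair the conditions on `t` and on `τ` separate, and each has `h a b` solutions. A
    -- pair is therefore selected `(h a b)²` times, and bad pairs are precisely those selected
    -- rarely.
    ∑bad₂ : ∀ c N → (∀ i → i < m → c * (i * i) ≤ N) → c * ∑₂ bad₂ ≤ n * n * N
    ∑bad₂ c N small = begin
      c * ∑₂ bad₂
        ≡⟨ cong (c *_) (trans (∑₂-∑ _) (∑-cong λ a → ∑₂-∑ _)) ⟩
      c * ∑₂ (λ a b → ∑₂ λ t τ → ⟦ Z t τ a ⟧ * ⟦ Z t τ b ⟧ * ⟦ not (good₂ a b) ⟧)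
        ≡⟨ cong (c *_) (∑₂-cong λ a b → factor a b) ⟩
      c * ∑₂ (λ a b → α a * (α b * (⟦ not (good₂ a b) ⟧ * (h a b * h a b))))
        ≡⟨ ∑₂-*ˡ c _ ⟨
      ∑₂ (λ a b → c * (α a * (α b * (⟦ not (good₂ a b) ⟧ * (h a b * h a b)))))
        ≤⟨ ∑₂-mono bound ⟩
      ∑₂ (λ a b → α a * (α b * N))
        ≡⟨ trans (∑₂-product α (λ b → α b * N)) (cong (n *_) (∑-*ʳ N α)) ⟩
      n * (n * N)
        ≡⟨ *-assoc n n N ⟨
      n * n * N ∎
      where
      open ≤-Reasoning
      shuffle : ∀ a b t τ t′ τ′ g → a * (t * τ) * (b * (t′ * τ′)) * g ≡ a * (b * g) * ((t * t′) * (τ * τ′))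
      shuffle = solve-∀
      regroup : ∀ a b g x → a * (b * g) * x ≡ a * (b * (g * x))
      regroup = solve-∀
      factor : ∀ a b → ∑₂ (λ t τ → ⟦ Z t τ a ⟧ * ⟦ Z t τ b ⟧ * ⟦ not (good₂ a b) ⟧)
             ≡ α a * (α b * (⟦ not (good₂ a b) ⟧ * (h a b * h a b)))
      factor a b = trans
        (∑₂-cong λ t τ → trans (cong₂ (λ x y → x * y * ⟦ not (good₂ a b) ⟧) (⟦Z⟧ t τ a) (⟦Z⟧ t τ b))
          (shuffle (α a) (α b) (α (t ⊘ a)) (α (τ ⊗ a)) (α (t ⊘ b)) (α (τ ⊗ b)) ⟦ not (good₂ a b) ⟧))
        (trans (∑₂-*ˡ (α a * (α b * ⟦ not (good₂ a b) ⟧)) λ t τ → (α (t ⊘ a) * α (t ⊘ b)) * (α (τ ⊗ a) * α (τ ⊗ b)))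
        (trans (cong (α a * (α b * ⟦ not (good₂ a b) ⟧) *_)
                 (∑₂-product (λ t → α (t ⊘ a) * α (t ⊘ b)) (λ τ → α (τ ⊗ a) * α (τ ⊗ b))))
        (trans (regroup (α a) (α b) ⟦ not (good₂ a b) ⟧ _)
          (⟦⟧-guard-≡ (A a) λ Aa → ⟦⟧-guard-≡ (A b) λ Ab → cong (⟦ not (good₂ a b) ⟧ *_)
            (cong (h a b *_) (h-dual a b Aa Ab))))))
      pull : ∀ c a b g x → c * (a * (b * (g * x))) ≡ a * (b * (g * (c * x)))
      pull = solve-∀
      bad-small : ∀ a b → ⟦ not (good₂ a b) ⟧ * (c * (h a b * h a b)) ≤ N
      bad-small a b with good₂ a b in eq
      ... | true  = z≤n
      ... | false = ≤-trans (≤-reflexive (+-identityʳ _)) (small (h a b) (≤-false eq))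
      bound : ∀ a b → c * (α a * (α b * (⟦ not (good₂ a b) ⟧ * (h a b * h a b)))) ≤ α a * (α b * N)
      bound a b = ≤-trans (≤-reflexive (pull c (α a) (α b) ⟦ not (good₂ a b) ⟧ (h a b * h a b)))
        (*-monoʳ-≤ (α a) (*-monoʳ-≤ (α b) (bad-small a b)))

    -- A triple of elements of `A` is selected by `f a x v` choices of `(t , τ)`, which is small
    -- when the triple is bad.
    ∑bad₃ : ∀ c N → (∀ i → i < m₂ → c * i ≤ N) → c * ∑₂ bad₃ ≤ n * (n * (n * N))
    ∑bad₃ c N small = begin
      c * ∑₂ bad₃
        ≡⟨ cong (c *_) (trans (∑₂-∑ _) (∑-cong λ a → trans (∑₂-∑ _) (∑-cong λ x → ∑₂-∑ _))) ⟩
      c * ∑ (λ a → ∑ λ x → ∑ λ v → ∑₂ λ t τ → ⟦ Z t τ a ⟧ * (α x * α (t ⊘ x)) * ⟦ W (t ⊗ τ) v ⟧ * ⟦ not (good₃ a x v) ⟧)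
        ≡⟨ cong (c *_) (∑-cong λ a → ∑-cong λ x → ∑-cong λ v → factor a x v) ⟩
      c * ∑ (λ a → ∑ λ x → ∑ λ v → α a * (α x * (α v * (⟦ not (good₃ a x v) ⟧ * f a x v))))
        ≡⟨ trans (sym (∑-*ˡ c _)) (∑-cong λ a → trans (sym (∑-*ˡ c _)) (∑-cong λ x → sym (∑-*ˡ c _))) ⟩
      ∑ (λ a → ∑ λ x → ∑ λ v → c * (α a * (α x * (α v * (⟦ not (good₃ a x v) ⟧ * f a x v)))))
        ≤⟨ (∑-mono λ a → ∑-mono λ x → ∑-mono λ v → bound a x v) ⟩
      ∑ (λ a → ∑ λ x → ∑ λ v → α a * (α x * (α v * N)))
        ≡⟨ (∑-cong λ a → trans (∑-cong λ x → trans (∑-*ˡ (α a) _) (cong (α a *_) (trans (∑-*ˡ (α x) _) (cong (α x *_) (∑-*ʳ N α)))))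
             (trans (∑-*ˡ (α a) _) (cong (α a *_) (∑-*ʳ (n * N) α)))) ⟩
      ∑ (λ a → α a * (n * (n * N)))
        ≡⟨ ∑-*ʳ (n * (n * N)) α ⟩
      n * (n * (n * N)) ∎
      where
      open ≤-Reasoning
      shuffle : ∀ a t τ x t′ v s g → a * (t * τ) * (x * t′) * (v * s) * g ≡ a * (x * (v * g)) * (t * τ * (t′ * s))
      shuffle = solve-∀
      regroup : ∀ a b v g x → a * (b * (v * g)) * x ≡ a * (b * (v * (g * x)))
      regroup = solve-∀
      Φ : F → F → F → F → F → ℕ
      Φ a x v t τ = α (t ⊘ a) * α (τ ⊗ a) * (α (t ⊘ x) * α (t ⊗ τ ⊘ v))
      Φ≡f : ∀ a x v → A a ≡ true → ∑₂ (Φ a x v) ≡ f a x v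
      Φ≡f a x v Aa = trans (∑₂-reparametrise a a≢0 (Φ a x v)) (∑₂-cong λ y c →
        cong₂ _*_ (cong₂ (λ u v → α u * α v) (⊗-⊘ y a a≢0) (⊘-⊗ c a a≢0))
          (cong (λ u → α (y ⊗ a ⊘ x) * α (u ⊘ v)) (cancel-middle y a c a≢0)))
        where a≢0 = A∌0 a Aa
      factor : ∀ a x v → ∑₂ (λ t τ → ⟦ Z t τ a ⟧ * (α x * α (t ⊘ x)) * ⟦ W (t ⊗ τ) v ⟧ * ⟦ not (good₃ a x v) ⟧)
             ≡ α a * (α x * (α v * (⟦ not (good₃ a x v) ⟧ * f a x v)))
      factor a x v = trans
        (∑₂-cong λ t τ → trans (cong₂ (λ z u → z * (α x * α (t ⊘ x)) * u * ⟦ not (good₃ a x v) ⟧) (⟦Z⟧ t τ a) (⟦∧⟧ (A v) (A (t ⊗ τ ⊘ v))))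
          (shuffle (α a) (α (t ⊘ a)) (α (τ ⊗ a)) (α x) (α (t ⊘ x)) (α v) (α (t ⊗ τ ⊘ v)) ⟦ not (good₃ a x v) ⟧))
        (trans (∑₂-*ˡ (α a * (α x * (α v * ⟦ not (good₃ a x v) ⟧))) (Φ a x v))
        (trans (regroup (α a) (α x) (α v) ⟦ not (good₃ a x v) ⟧ _)
          (⟦⟧-guard-≡ (A a) λ Aa → cong (λ u → α x * (α v * (⟦ not (good₃ a x v) ⟧ * u))) (Φ≡f a x v Aa))))
      pull : ∀ c a b v g x → c * (a * (b * (v * (g * x)))) ≡ a * (b * (v * (g * (c * x))))
      pull = solve-∀
      bad-small : ∀ a x v → ⟦ not (good₃ a x v) ⟧ * (c * f a x v) ≤ N
      bad-small a x v with good₃ a x v in eq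
      ... | true  = z≤n
      ... | false = ≤-trans (≤-reflexive (+-identityʳ _)) (small (f a x v) (≤-false eq))
      bound : ∀ a x v → c * (α a * (α x * (α v * (⟦ not (good₃ a x v) ⟧ * f a x v)))) ≤ α a * (α x * (α v * N))
      bound a x v = ≤-trans (≤-reflexive (pull c (α a) (α x) (α v) ⟦ not (good₃ a x v) ⟧ (f a x v)))
        (*-monoʳ-≤ (α a) (*-monoʳ-≤ (α x) (*-monoʳ-≤ (α v) (bad-small a x v))))

    record Selected (e : ℕ) (t τ : F) : Set where
      field
        t≢0     : t ≢ 𝟘
        W-large : n * n ≤ 2 * k * # (W (t ⊗ τ))
        Z-large : n * (n * n) ≤ 16 * (k * k) * # (Z t τ)
        Z>0     : 0 < # (Z t τ)
        W>0     : 0 < # (W (t ⊗ τ))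
        few-bad₂ : e * bad₂ t τ ≤ # (Z t τ) * # (Z t τ)
        few-bad₃ : e * bad₃ t τ ≤ # (Z t τ) * # (Z t τ) * # (W (t ⊗ τ))

    -- Pigeonhole on one inequality `L < R` yields every property at once: `R > 0` makes `Z`
    -- non-empty and `t τ` popular, the first summand of `L` bounds `|Z|` from below, and the second
    -- bounds both bad counts. The proportion of bad configurations tolerated is `1/e`.
    select : ∀ e → 0 < n → 0 < k →
      (∀ i → i < m  → 256 * e * (k * (k * k)) * (i * i) ≤ n * (n * (n * (n * n)))) →
      (∀ i → i < m₂ → 256 * e * (k * (k * k)) * i ≤ n * (n * (n * (n * n)))) →
      ∃ λ t → ∃ λ τ → Selected e t τ
    select e n>0 k>0 small₂ small₃ =
      let t , τ , lt = ∑₂-pigeonhole L R ∑L<∑R in t , τ , conclude t τ lt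
      where
      -- N / D is the lower bound for |Z|, and C is chosen so that both kinds of bad
      -- configurations contribute at most k N X, against a main term of 4 k N X.
      N D X C : ℕ
      N = n * (n * n)
      D = 16 * (k * k)
      X = n * (n * (n * (n * n)))
      C = 256 * e * (k * (k * k))
      E = ∑ λ s → G s * w s
      instance
        n≢0 : NonZero n
        n≢0 = >-nonZero n>0
        k≢0 : NonZero k
        k≢0 = >-nonZero k>0
        N≢0 : NonZero N
        N≢0 = m*n≢0 n (n * n) {{n≢0}} {{m*n≢0 n n}}
        D≢0 : NonZero D
        D≢0 = m*n≢0 16 (k * k) {{_}} {{m*n≢0 k k}}
        DD≢0 : NonZero (D * D)
        DD≢0 = m*n≢0 D D
      L R : F → F → ℕ
      -- The factor `⟦ AA t ⟧` confines `t` to `k` values, so that the first summand totals at most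
      -- `k N² n² = k N X`. It equals 1 at the pair found, since a non-empty `Z t τ` forces
      -- `t ∈ AA`.
      L t τ = ⟦ AA t ⟧ * (N * N * G (t ⊗ τ)) + e * (D * D) * (bad₃ t τ + G (t ⊗ τ) * bad₂ t τ)
      R t τ = N * D * (# (Z t τ) * G (t ⊗ τ))
      open ≤-Reasoning

      row : ∀ t → ∑ (λ τ → ⟦ AA t ⟧ * (N * N * G (t ⊗ τ))) ≤ ⟦ AA t ⟧ * (N * N * (n * n))
      row t = begin
        ∑ (λ τ → ⟦ AA t ⟧ * (N * N * G (t ⊗ τ)))     ≡⟨ ∑-*ˡ ⟦ AA t ⟧ _ ⟩
        ⟦ AA t ⟧ * ∑ (λ τ → N * N * G (t ⊗ τ))       ≡⟨ cong (⟦ AA t ⟧ *_) (∑-*ˡ (N * N) _) ⟩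
        ⟦ AA t ⟧ * (N * N * ∑ (λ τ → G (t ⊗ τ)))     ≤⟨ ⟦⟧-guard (AA t) (λ AAt → *-monoʳ-≤ (N * N) (≤-trans (≤-reflexive
             (trans (∑-cong λ τ → cong G (⊗-comm t τ)) (∑-scale t (AA∌0 t AAt) G))) ∑G≤n²)) ⟩
        ⟦ AA t ⟧ * (N * N * (n * n))                 ∎

      first : ∑₂ (λ t τ → ⟦ AA t ⟧ * (N * N * G (t ⊗ τ))) ≤ k * (N * N * (n * n))
      first = ≤-trans (∑-mono row) (≤-reflexive (∑-*ʳ (N * N * (n * n)) (⟦_⟧ ∘ AA)))

      second : e * (D * D) * ∑₂ bad₃ ≤ k * (N * X)
      second = begin
        e * (D * D) * ∑₂ bad₃             ≡⟨ lem e k (∑₂ bad₃) ⟩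
        k * (C * ∑₂ bad₃)                 ≤⟨ *-monoʳ-≤ k (∑bad₃ C X small₃) ⟩
        k * (n * (n * (n * X)))           ≡⟨ lem′ k n X ⟩
        k * (N * X)                       ∎
        where
        lem : ∀ e k b → e * (16 * (k * k) * (16 * (k * k))) * b ≡ k * (256 * e * (k * (k * k)) * b)
        lem = solve-∀
        lem′ : ∀ k n x → k * (n * (n * (n * x))) ≡ k * (n * (n * n) * x)
        lem′ = solve-∀

      -- `bad₃` already sums over `v ∈ W`, whereas `bad₂` does not; the factor `G` supplies the
      -- missing `|W|` and is bounded by `n` here.
      third : e * (D * D) * ∑₂ (λ t τ → G (t ⊗ τ) * bad₂ t τ) ≤ k * (N * X)
      third = begin
        e * (D * D) * ∑₂ (λ t τ → G (t ⊗ τ) * bad₂ t τ)   ≤⟨ *-monoʳ-≤ (e * (D * D)) (≤-trans (∑₂-mono λ t τ → *-monoˡ-≤ (bad₂ t τ) (G≤n (t ⊗ τ))) (≤-reflexive (∑₂-*ˡ n bad₂))) ⟩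
        e * (D * D) * (n * ∑₂ bad₂)       ≡⟨ lem e k n (∑₂ bad₂) ⟩
        k * (n * (C * ∑₂ bad₂))           ≤⟨ *-monoʳ-≤ k (*-monoʳ-≤ n (∑bad₂ C X small₂)) ⟩
        k * (n * (n * n * X))             ≡⟨ lem′ k n X ⟩
        k * (N * X)                       ∎
        where
        lem : ∀ e k n b → e * (16 * (k * k) * (16 * (k * k))) * (n * b) ≡ k * (n * (256 * e * (k * (k * k)) * b))
        lem = solve-∀
        lem′ : ∀ k n x → k * (n * (n * n * x)) ≡ k * (n * (n * n) * x)
        lem′ = solve-∀

      ∑L : ∑₂ L ≤ 3 * (k * (N * X))
      ∑L = begin
        ∑₂ L
          ≡⟨ ∑₂-+ _ _ ⟩
        ∑₂ (λ t τ → ⟦ AA t ⟧ * (N * N * G (t ⊗ τ))) + ∑₂ (λ t τ → e * (D * D) * (bad₃ t τ + G (t ⊗ τ) * bad₂ t τ))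
          ≡⟨ cong (∑₂ (λ t τ → ⟦ AA t ⟧ * (N * N * G (t ⊗ τ))) +_)
               (trans (∑₂-*ˡ (e * (D * D)) _) (trans (cong (e * (D * D) *_) (∑₂-+ bad₃ _)) (*-distribˡ-+ (e * (D * D)) (∑₂ bad₃) _))) ⟩
        ∑₂ (λ t τ → ⟦ AA t ⟧ * (N * N * G (t ⊗ τ))) + (e * (D * D) * ∑₂ bad₃ + e * (D * D) * ∑₂ (λ t τ → G (t ⊗ τ) * bad₂ t τ))
          ≤⟨ +-mono-≤ first (+-mono-≤ second third) ⟩
        k * (N * N * (n * n)) + (k * (N * X) + k * (N * X))
          ≡⟨ lem k n ⟩
        3 * (k * (N * X)) ∎
        where
        lem : ∀ k n → k * (n * (n * n) * (n * (n * n)) * (n * n)) + (k * (n * (n * n) * (n * (n * (n * (n * n))))) + k * (n * (n * n) * (n * (n * (n * (n * n))))))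
            ≡ 3 * (k * (n * (n * n) * (n * (n * (n * (n * n))))))
        lem = solve-∀

      ∑R : 4 * (k * (N * X)) ≤ ∑₂ R
      ∑R = begin
        4 * (k * (N * X))                           ≡⟨ lem k n ⟩
        4 * k * (N * n) * (n * n * (n * n))         ≤⟨ *-monoʳ-≤ (4 * k * (N * n)) (popular-energy k>0) ⟩
        4 * k * (N * n) * (4 * k * E)               ≡⟨ lem′ k N n E ⟩
        N * D * (n * E)                             ≡⟨ cong (N * D *_) (sym ∑ζG) ⟩
        N * D * ∑₂ (λ t τ → # (Z t τ) * G (t ⊗ τ))  ≡⟨ ∑₂-*ˡ (N * D) _ ⟨
        ∑₂ R                                        ∎
        where
        lem : ∀ k n → 4 * (k * (n * (n * n) * (n * (n * (n * (n * n)))))) ≡ 4 * k * (n * (n * n) * n) * (n * n * (n * n))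
        lem = solve-∀
        lem′ : ∀ k N n E → 4 * k * (N * n) * (4 * k * E) ≡ N * (16 * (k * k)) * (n * E)
        lem′ = solve-∀

      ∑L<∑R : ∑₂ L < ∑₂ R
      ∑L<∑R = <-≤-trans (≤-<-trans ∑L (*-monoˡ-< (k * (N * X)) {{kNX≢0}} {3} {4} ≤-refl)) ∑R
        where
        kNX≢0 : NonZero (k * (N * X))
        kNX≢0 = m*n≢0 k (N * X) {{k≢0}} {{m*n≢0 N X {{N≢0}} {{m*n≢0 n (n * (n * (n * n))) {{n≢0}} {{m*n≢0 n (n * (n * n)) {{n≢0}} {{N≢0}}}}}}}}

      conclude : ∀ t τ → L t τ < R t τ → Selected e t τ
      conclude t τ lt = record
        { t≢0 = AA∌0 t AAt
        ; W-large = subst (λ v → n * n ≤ 2 * k * v) (sym (#W≡w (t ⊗ τ))) (≤-true Ss)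
        ; Z-large = N≤Dζ
        ; Z>0 = ζ>0
        ; W>0 = subst (0 <_) (trans G≡w (sym (#W≡w (t ⊗ τ)))) g>0
        ; few-bad₂ = *-cancelʳ-≤ _ _ (D * D * g) {{m*n≢0 (D * D) g}} (begin
            e * bad₂ t τ * (D * D * g)             ≡⟨ lem₂ e (bad₂ t τ) (D * D) g ⟩
            e * (D * D) * (g * bad₂ t τ)           ≤⟨ ≤-trans (*-monoʳ-≤ (e * (D * D)) (m≤n+m _ (bad₃ t τ))) rest ⟩
            N * D * (ζ * g)                        ≤⟨ *-monoˡ-≤ (ζ * g) (*-monoˡ-≤ D N≤Dζ) ⟩
            D * ζ * D * (ζ * g)                    ≡⟨ lem₃ D ζ g ⟩
            ζ * ζ * (D * D * g)                    ∎)
        ; few-bad₃ = subst (λ v → e * bad₃ t τ ≤ ζ * ζ * v) (trans G≡w (sym (#W≡w (t ⊗ τ))))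
            (*-cancelʳ-≤ _ _ (D * D) (begin
            e * bad₃ t τ * (D * D)                 ≡⟨ xy∙z≡xz∙y e (bad₃ t τ) (D * D) ⟩
            e * (D * D) * bad₃ t τ                 ≤⟨ ≤-trans (*-monoʳ-≤ (e * (D * D)) (m≤m+n (bad₃ t τ) _)) rest ⟩
            N * D * (ζ * g)                        ≤⟨ *-monoˡ-≤ (ζ * g) (*-monoˡ-≤ D N≤Dζ) ⟩
            D * ζ * D * (ζ * g)                    ≡⟨ lem₄ D ζ g ⟩
            ζ * ζ * g * (D * D)                    ∎))
        }
        where
        ζ = # (Z t τ)
        g = G (t ⊗ τ)
        ζg>0 : 0 < ζ * g
        ζg>0 = n≢0⇒n>0 λ eq → <⇒≱ lt (≤-trans (≤-reflexive (trans (cong (N * D *_) eq) (*-zeroʳ (N * D)))) z≤n)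
        ζ>0 : 0 < ζ
        ζ>0 = n≢0⇒n>0 λ eq → <⇒≢ ζg>0 (sym (cong (_* g) eq))
        g>0 : 0 < g
        g>0 = n≢0⇒n>0 λ eq → <⇒≢ ζg>0 (sym (trans (cong (ζ *_) eq) (*-zeroʳ ζ)))
        instance
          g≢0 : NonZero g
          g≢0 = >-nonZero g>0
        Ss : S (t ⊗ τ) ≡ true
        Ss = ⟦⟧-true (S (t ⊗ τ)) g>0
        G≡w : g ≡ w (t ⊗ τ)
        G≡w = trans (cong (_* w (t ⊗ τ)) (true⇒⟦⟧ Ss)) (*-identityˡ _)
        AAt : AA t ≡ true
        AAt = let a , Za = #-nonempty {S = Z t τ} ζ>0 in Z⇒AA t τ a Za
        rest : e * (D * D) * (bad₃ t τ + g * bad₂ t τ) ≤ N * D * (ζ * g)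
        rest = ≤-trans (m≤n+m _ (⟦ AA t ⟧ * (N * N * g))) (<⇒≤ lt)
        lem₁ : ∀ N D ζ g → N * D * (ζ * g) ≡ D * ζ * (N * g)
        lem₁ = solve-∀
        lem₂ : ∀ e b d g → e * b * (d * g) ≡ e * d * (g * b)
        lem₂ = solve-∀
        lem₃ : ∀ D ζ g → D * ζ * D * (ζ * g) ≡ ζ * ζ * (D * D * g)
        lem₃ = solve-∀
        lem₄ : ∀ D ζ g → D * ζ * D * (ζ * g) ≡ ζ * ζ * g * (D * D)
        lem₄ = solve-∀
        N≤Dζ : N ≤ D * ζ
        N≤Dζ = *-cancelʳ-≤ _ _ (N * g) {{m*n≢0 N g}} (begin
          N * (N * g)                     ≡⟨ trans (sym (*-assoc N N g)) (sym (*-identityˡ _)) ⟩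
          1 * (N * N * g)                 ≡⟨ cong (_* (N * N * g)) (sym (true⇒⟦⟧ AAt)) ⟩
          ⟦ AA t ⟧ * (N * N * g)          ≤⟨ ≤-trans (m≤m+n _ (e * (D * D) * (bad₃ t τ + g * bad₂ t τ))) (<⇒≤ lt) ⟩
          N * D * (ζ * g)                 ≡⟨ lem₁ N D ζ g ⟩
          D * ζ * (N * g)                 ∎)

-- Counting paths

markov : ∀ {n} (S : Fin n → Bool) (g : Fin n → ℕ) c T →
  # (λ i → S i ∧ not (c * g i ≤ᵇ T)) * T ≤ c * ∑ (λ i → ⟦ S i ⟧ * g i)
markov S g c T = begin
  # (λ i → S i ∧ not (c * g i ≤ᵇ T)) * T           ≡⟨ ∑-*ʳ T _ ⟨
  ∑ (λ i → ⟦ S i ∧ not (c * g i ≤ᵇ T) ⟧ * T)       ≤⟨ ∑-mono pointwise ⟩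
  ∑ (λ i → c * (⟦ S i ⟧ * g i))                    ≡⟨ ∑-*ˡ c _ ⟩
  c * ∑ (λ i → ⟦ S i ⟧ * g i)                      ∎
  where
  open ≤-Reasoning
  pointwise : ∀ i → ⟦ S i ∧ not (c * g i ≤ᵇ T) ⟧ * T ≤ c * (⟦ S i ⟧ * g i)
  pointwise i with S i
  ... | false = z≤n
  ... | true with c * g i ≤ᵇ T in eq
  ...   | true  = z≤n
  ...   | false = ≤-trans (≤-reflexive (+-identityʳ T))
                  (≤-trans (<⇒≤ (≤-false eq)) (≤-reflexive (cong (c *_) (sym (+-identityʳ (g i))))))

halve : ∀ x y → 4 * x ≤ 4 * y + (x + x) → x ≤ 2 * y
halve x y le = *-cancelˡ-≤ 2 (+-cancelʳ-≤ (x + x) _ _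
  (subst₂ _≤_ (lem x) (cong (_+ (x + x)) (*-assoc 2 2 y)) le))
  where
  lem : ∀ x → 4 * x ≡ 2 * x + (x + x)
  lem = solve-∀

module Paths {p : ℕ} (𝔽 : FiniteField p) (A Q : FinSet p)
             (A∌0 : ∀ x → A x ≡ true → x ≢ FiniteField.𝟘 𝔽)
             (Q-intro : ∀ x a b → A a ≡ true → A b ≡ true →
               FiniteField._⊗_ 𝔽 x b ≡ FiniteField._⊕_ 𝔽 a (FiniteField.𝟙 𝔽) → Q x ≡ true) where
  open FieldProperties 𝔽
  open 𝔽-Solver using (solve; _:+_; _:*_; :-_; _:=_)
  open Selection 𝔽 A A∌0

  q : ℕ
  q = # Q

  κ : F → ℕ
  κ x = ⟦ Q x ⟧

  -- Convolution with the first variable passed through `c`: `id` counts sums `d + e`, and `a ⊗_`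
  -- counts sums `a d + e`. The total mass does not depend on `c`, so the dilation by `a` is free.
  conv : (F → F) → (F → ℕ) → (F → ℕ) → F → ℕ
  conv c g g′ σ = ∑ λ d → g d * g′ (σ ⊝ c d)

  ∑-conv : ∀ c g g′ → ∑ (conv c g g′) ≡ ∑ g * ∑ g′
  ∑-conv c g g′ = begin
    ∑₂ (λ σ d → g d * g′ (σ ⊝ c d))         ≡⟨ ∑-swap (λ σ d → g d * g′ (σ ⊝ c d)) ⟩
    ∑₂ (λ d σ → g d * g′ (σ ⊝ c d))         ≡⟨ (∑-cong λ d → trans (∑-*ˡ (g d) _) (cong (g d *_) (∑-shift (⊖ c d) g′))) ⟩
    ∑ (λ d → g d * ∑ g′)                    ≡⟨ ∑-*ʳ (∑ g′) g ⟩
    ∑ g * ∑ g′                              ∎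
    where open ≡-Reasoning

  -- Numbers of representations over `Q` as `x − y`, as `x + y − z` and as `x − y + z − w`; below,
  -- `ρ₅ a` counts `a (x − y) + (z + w − u)`. Their masses are powers of `q`, so a set of values
  -- with many representations is small.
  ρ₂ ρ₃ ρ₄ : F → ℕ
  ρ₂ d = ∑ λ x → κ x * κ (x ⊝ d)
  ρ₃ = conv id κ ρ₂
  ρ₄ = conv id ρ₂ ρ₂

  ρ₅ : F → F → ℕ
  ρ₅ a = conv (a ⊗_) ρ₂ ρ₃

  ∑ρ₂ : ∑ ρ₂ ≡ q * q
  ∑ρ₂ = begin
    ∑₂ (λ d x → κ x * κ (x ⊝ d))      ≡⟨ ∑-swap (λ d x → κ x * κ (x ⊝ d)) ⟩
    ∑₂ (λ x d → κ x * κ (x ⊝ d))      ≡⟨ (∑-cong λ x → trans (∑-*ˡ (κ x) _) (cong (κ x *_) (∑-reflect x κ))) ⟩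
    ∑ (λ x → κ x * q)                 ≡⟨ ∑-*ʳ q κ ⟩
    q * q                             ∎
    where open ≡-Reasoning

  ∑ρ₄ : ∑ ρ₄ ≡ q * q * (q * q)
  ∑ρ₄ = trans (∑-conv id ρ₂ ρ₂) (cong₂ _*_ ∑ρ₂ ∑ρ₂)

  ∑ρ₅ : ∀ a → ∑ (ρ₅ a) ≡ q * q * (q * (q * q))
  ∑ρ₅ a = trans (∑-conv (a ⊗_) ρ₂ ρ₃) (cong₂ _*_ ∑ρ₂ (trans (∑-conv id κ ρ₂) (cong (q *_) ∑ρ₂)))

  ρ₂-difference : ∀ g g′ → ρ₂ (g ⊝ g′) ≡ ∑ λ u → κ (u ⊕ g) * κ (u ⊕ g′)
  ρ₂-difference g g′ = trans (sym (∑-shift g λ x → κ x * κ (x ⊝ (g ⊝ g′))))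
    (∑-cong λ u → cong (λ y → κ (u ⊕ g) * κ y)
      (solve 3 (λ u g g′ → u :+ g :+ (:- (g :+ (:- g′))) := u :+ g′) refl u g g′))

  -- Because `(u y + 1) / y = u + 1/y`, the shift by 1 in `A + 1` becomes an additive relation. The
  -- inverse is any `y′` with `y′ y = 1`, so that it can be given as `a / t` for `y = t / a`.
  Q-sum : ∀ {u y y′} → A y ≡ true → A (u ⊗ y) ≡ true → y′ ⊗ y ≡ 𝟙 → Q (u ⊕ y′) ≡ true
  Q-sum {u} {y} {y′} Ay Auy eq = Q-intro (u ⊕ y′) (u ⊗ y) y Auy Ay
    (trans (⊗-distribʳ-⊕ y u y′) (cong (u ⊗ y ⊕_) eq))

  indicator-≤ : ∀ b c b′ c′ → (b ≡ true → b′ ≡ true) → (c ≡ true → c′ ≡ true) → ⟦ b ⟧ * ⟦ c ⟧ ≤ ⟦ b′ ⟧ * ⟦ c′ ⟧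
  indicator-≤ b c b′ c′ f g = *-mono-≤ (⟦⟧-mono b b′ f) (⟦⟧-mono c c′ g)

  ⊘-⊘-inverse : ∀ {t b} → t ≢ 𝟘 → b ≢ 𝟘 → b ⊘ t ⊗ (t ⊘ b) ≡ 𝟙
  ⊘-⊘-inverse {t} {b} t≢0 b≢0 = trans (sym (⊗-assoc (b ⊘ t) t _)) (trans (cong (_⊘ b) (⊘-⊗ b t t≢0)) (⊗-inverseʳ b b≢0))

  -- After `u ↦ u t`, each `u` counted by `h` puts `u + a/t` and `u + b/t` into `Q`, and their
  -- difference does not involve `u`.
  h≤ρ₂ : ∀ t a b → t ≢ 𝟘 → a ≢ 𝟘 → b ≢ 𝟘 → A (t ⊘ a) ≡ true → A (t ⊘ b) ≡ true →
         h a b ≤ ρ₂ (a ⊘ t ⊝ b ⊘ t)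
  h≤ρ₂ t a b t≢0 a≢0 b≢0 Aa Ab = begin
    h a b                                              ≡⟨ ∑-scale t t≢0 (λ u → α (u ⊘ a) * α (u ⊘ b)) ⟨
    ∑ (λ u → α (u ⊗ t ⊘ a) * α (u ⊗ t ⊘ b))            ≤⟨ (∑-mono λ u → indicator-≤ _ _ _ _ (to u a a≢0 Aa) (to u b b≢0 Ab)) ⟩
    ∑ (λ u → κ (u ⊕ a ⊘ t) * κ (u ⊕ b ⊘ t))            ≡⟨ ρ₂-difference (a ⊘ t) (b ⊘ t) ⟨
    ρ₂ (a ⊘ t ⊝ b ⊘ t)                                 ∎
    where
    open ≤-Reasoning
    to : ∀ u a → a ≢ 𝟘 → A (t ⊘ a) ≡ true → A (u ⊗ t ⊘ a) ≡ true → Q (u ⊕ a ⊘ t) ≡ true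
    to u a a≢0 Aa Au = Q-sum Aa (trans (cong A (sym (⊗-assoc u t _))) Au) (⊘-⊘-inverse t≢0 a≢0)

  -- z = q₁ − q₂ + q₃ with q₁ = 1/y + a/x, q₂ = 1/y + c/v, q₃ = (c + 1)/v.
  f≤ρ₃ : ∀ a x v → A v ≡ true → f a x v ≤ ρ₃ (a ⊘ x ⊕ v ⁻¹)
  f≤ρ₃ a x v Av = begin
    ∑₂ (λ y c → α y * α c * (α (y ⊗ a ⊘ x) * α (y ⊗ c ⊘ v)))
      ≡⟨ ∑-swap (λ y c → α y * α c * (α (y ⊗ a ⊘ x) * α (y ⊗ c ⊘ v))) ⟩
    ∑₂ (λ c y → α y * α c * (α (y ⊗ a ⊘ x) * α (y ⊗ c ⊘ v)))
      ≤⟨ ∑₂-mono pointwise ⟩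
    ∑₂ (λ c y → κ ((c ⊕ 𝟙) ⊘ v) * (κ (y ⁻¹ ⊕ a ⊘ x) * κ (y ⁻¹ ⊕ c ⊘ v)))
      ≡⟨ (∑-cong λ c → trans (∑-*ˡ (κ ((c ⊕ 𝟙) ⊘ v)) _) (cong (κ ((c ⊕ 𝟙) ⊘ v) *_)
           (trans (∑-⁻¹ λ u → κ (u ⊕ a ⊘ x) * κ (u ⊕ c ⊘ v)) (sym (ρ₂-difference (a ⊘ x) (c ⊘ v)))))) ⟩
    ∑ (λ c → κ ((c ⊕ 𝟙) ⊘ v) * ρ₂ (a ⊘ x ⊝ c ⊘ v))
      ≡⟨ (∑-cong λ c → cong (λ e → κ ((c ⊕ 𝟙) ⊘ v) * ρ₂ e) (rearrange c)) ⟩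
    ∑ (λ c → κ ((c ⊕ 𝟙) ⊘ v) * ρ₂ (a ⊘ x ⊕ v ⁻¹ ⊝ (c ⊕ 𝟙) ⊘ v))
      ≡⟨ ∑-shift 𝟙 (λ c → κ (c ⊘ v) * ρ₂ (a ⊘ x ⊕ v ⁻¹ ⊝ c ⊘ v)) ⟩
    ∑ (λ c → κ (c ⊘ v) * ρ₂ (a ⊘ x ⊕ v ⁻¹ ⊝ c ⊘ v))
      ≡⟨ ∑-unscale v v≢0 (λ z → κ z * ρ₂ (a ⊘ x ⊕ v ⁻¹ ⊝ z)) ⟩
    ρ₃ (a ⊘ x ⊕ v ⁻¹) ∎
    where
    open ≤-Reasoning
    v≢0 = A∌0 v Av
    rearrange : ∀ c → a ⊘ x ⊝ c ⊘ v ≡ a ⊘ x ⊕ v ⁻¹ ⊝ (c ⊕ 𝟙) ⊘ v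
    rearrange c = trans
      (solve 3 (λ e c i → e :+ (:- (c :* i)) := e :+ i :+ (:- (c :* i :+ i))) refl (a ⊘ x) c (v ⁻¹))
      (cong (λ y → a ⊘ x ⊕ v ⁻¹ ⊝ y) (trans (cong (c ⊘ v ⊕_) (sym (⊗-identityˡ (v ⁻¹)))) (sym (⊗-distribʳ-⊕ (v ⁻¹) c 𝟙))))
    Q-inverse : ∀ y g → A y ≡ true → A (y ⊗ g) ≡ true → Q (y ⁻¹ ⊕ g) ≡ true
    Q-inverse y g Ay Ayg = trans (cong Q (⊕-comm _ g))
      (Q-sum Ay (trans (cong A (⊗-comm g y)) Ayg) (⊗-inverseˡ y (A∌0 y Ay)))
    pointwise : ∀ c y → α y * α c * (α (y ⊗ a ⊘ x) * α (y ⊗ c ⊘ v)) ≤ κ ((c ⊕ 𝟙) ⊘ v) * (κ (y ⁻¹ ⊕ a ⊘ x) * κ (y ⁻¹ ⊕ c ⊘ v))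
    pointwise c y with A y in Ay | A c in Ac
    ... | false | _     = z≤n
    ... | true  | false = z≤n
    ... | true  | true  = *-mono-≤
      (≤-reflexive (sym (true⇒⟦⟧ (Q-intro _ c v Ac Av (⊘-⊗ (c ⊕ 𝟙) v v≢0)))))
      (indicator-≤ _ _ _ _
        (λ h → Q-inverse y (a ⊘ x) Ay (trans (cong A (sym (⊗-assoc y a _))) h))
        (λ h → Q-inverse y (c ⊘ v) Ay (trans (cong A (sym (⊗-assoc y c _))) h)))

  module Refinement (m m₂ : ℕ) (t τ : F) (sel : Thresholds.Selected m m₂ 128 t τ) where
    open Thresholds m m₂
    open Selected sel public

    Z₀ W₀ : FinSet p
    Z₀ = Z t τ
    W₀ = W (t ⊗ τ)

    ζ ω : ℕ
    ζ = # Z₀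
    ω = # W₀

    degree₂ : F → ℕ
    degree₂ a = ∑ λ b → ⟦ Z₀ b ⟧ * ⟦ not (good₂ a b) ⟧

    degree₃ : F → F → ℕ
    degree₃ a v = ∑ λ b → ⟦ Z₀ b ⟧ * ⟦ not (good₃ a (t ⊘ b) v) ⟧

    total₃ : F → ℕ
    total₃ a = ∑ λ v → ⟦ W₀ v ⟧ * degree₃ a v

    ∑degree₂ : ∑ (λ a → ⟦ Z₀ a ⟧ * degree₂ a) ≡ bad₂ t τ
    ∑degree₂ = ∑-cong λ a → trans (sym (∑-*ˡ ⟦ Z₀ a ⟧ _))
      (∑-cong λ b → sym (*-assoc ⟦ Z₀ a ⟧ ⟦ Z₀ b ⟧ _))

    -- For `b ∈ Z₀` the point `x = t / b` is among those counted by `bad₃`, as `x ∈ A` and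
    -- `t / x = b ∈ A`; distinct `b` give distinct `x`.
    ∑total₃ : ∑ (λ a → ⟦ Z₀ a ⟧ * total₃ a) ≤ bad₃ t τ
    ∑total₃ = ∑-mono λ a → begin
      ⟦ Z₀ a ⟧ * ∑ (λ v → ⟦ W₀ v ⟧ * degree₃ a v)
        ≡⟨ cong (⟦ Z₀ a ⟧ *_) (trans (∑-cong λ v → sym (∑-*ˡ ⟦ W₀ v ⟧ _)) (∑-swap _)) ⟩
      ⟦ Z₀ a ⟧ * ∑₂ (λ b v → ⟦ W₀ v ⟧ * (⟦ Z₀ b ⟧ * ⟦ not (good₃ a (t ⊘ b) v) ⟧))
        ≡⟨ ∑₂-*ˡ ⟦ Z₀ a ⟧ (λ b v → ⟦ W₀ v ⟧ * (⟦ Z₀ b ⟧ * ⟦ not (good₃ a (t ⊘ b) v) ⟧)) ⟨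
      ∑₂ (λ b v → ⟦ Z₀ a ⟧ * (⟦ W₀ v ⟧ * (⟦ Z₀ b ⟧ * ⟦ not (good₃ a (t ⊘ b) v) ⟧)))
        ≤⟨ (∑₂-mono λ b v → ≤-trans (≤-reflexive (lem ⟦ Z₀ a ⟧ ⟦ W₀ v ⟧ ⟦ Z₀ b ⟧ _))
             (*-monoˡ-≤ _ (*-monoˡ-≤ ⟦ W₀ v ⟧ (*-monoʳ-≤ ⟦ Z₀ a ⟧ (Z≤ b))))) ⟩
      ∑₂ (λ b v → ⟦ Z₀ a ⟧ * (α (t ⊘ b) * α (t ⊘ (t ⊘ b))) * ⟦ W₀ v ⟧ * ⟦ not (good₃ a (t ⊘ b) v) ⟧)
        ≡⟨ ∑-quotient t t≢0 (λ x → ∑ λ v → ⟦ Z₀ a ⟧ * (α x * α (t ⊘ x)) * ⟦ W₀ v ⟧ * ⟦ not (good₃ a x v) ⟧) ⟩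
      ∑₂ (λ x v → ⟦ Z₀ a ⟧ * (α x * α (t ⊘ x)) * ⟦ W₀ v ⟧ * ⟦ not (good₃ a x v) ⟧) ∎
      where
      open ≤-Reasoning
      lem : ∀ a v b g → a * (v * (b * g)) ≡ a * b * v * g
      lem = solve-∀
      Z≤ : ∀ b → ⟦ Z₀ b ⟧ ≤ α (t ⊘ b) * α (t ⊘ (t ⊘ b))
      Z≤ b = ≤-trans (⟦⟧-mono (Z₀ b) (A (t ⊘ b) ∧ A (t ⊘ (t ⊘ b)))
        λ Zb → ∧-intro (Z⇒A/ t τ b Zb) (trans (cong A (⊘-⊘ t b t≢0)) (Z⇒A t τ b Zb)))
        (≤-reflexive (⟦∧⟧ (A (t ⊘ b)) _))

    -- The constants: two properties, each failing on at most a quarter of `Z₀`, hold together on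
    -- half of it. With 32 in `typical₃`, Markov leaves each `a ∈ Y` unlinked to at most `ω/8`
    -- points, so four elements of `Y` keep half of `W₀`. The allowance 128 = 4 · 32 then makes
    -- `typical₃` fail on at most a quarter of `Z₀`, and `typical₂` on at most a 32nd.
    typical₂ typical₃ Y : F → Bool
    typical₂ a = 4 * degree₂ a ≤ᵇ ζ
    typical₃ a = 32 * total₃ a ≤ᵇ ζ * ω
    Y a = Z₀ a ∧ (typical₂ a ∧ typical₃ a)

    Y⇒Z : ∀ {a} → Y a ≡ true → Z₀ a ≡ true
    Y⇒Z = ∧-fst

    Y⇒A : ∀ {a} → Y a ≡ true → A a ≡ true
    Y⇒A {a} Ya = Z⇒A t τ a (Y⇒Z Ya)

    Y⇒degree₂ : ∀ {a} → Y a ≡ true → 4 * degree₂ a ≤ ζ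
    Y⇒degree₂ {a} Ya = ≤-true (∧-fst (∧-snd {Z₀ a} Ya))

    Y⇒total₃ : ∀ {a} → Y a ≡ true → 32 * total₃ a ≤ ζ * ω
    Y⇒total₃ {a} Ya = ≤-true (∧-snd {typical₂ a} (∧-snd {Z₀ a} Ya))

    instance
      ζ≢0 : NonZero ζ
      ζ≢0 = >-nonZero Z>0
      ω≢0 : NonZero ω
      ω≢0 = >-nonZero W>0

    Y-large : ζ ≤ 2 * # Y
    Y-large = halve ζ (# Y) (begin
      4 * ζ                                      ≡⟨ ∑-*ˡ 4 _ ⟨
      ∑ (λ a → 4 * ⟦ Z₀ a ⟧)                     ≤⟨ ∑-mono (λ a → *-monoʳ-≤ 4 (cover (Z₀ a) (typical₂ a) (typical₃ a))) ⟩
      ∑ (λ a → 4 * (⟦ Y a ⟧ + (⟦ Z₀ a ∧ not (typical₂ a) ⟧ + ⟦ Z₀ a ∧ not (typical₃ a) ⟧)))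
        ≡⟨ trans (∑-*ˡ 4 _) (cong (4 *_) (trans (∑-+ _ _) (cong (# Y +_) (∑-+ _ _)))) ⟩
      4 * (# Y + (u + v))                        ≡⟨ lem (# Y) u v ⟩
      4 * # Y + (4 * u + 4 * v)                  ≤⟨ +-monoʳ-≤ (4 * # Y) (+-mono-≤ (≤-trans (*-monoˡ-≤ u (m≤m+n 4 28)) u-small) v-small) ⟩
      4 * # Y + (ζ + ζ)                          ∎)
      where
      open ≤-Reasoning
      u = # (λ a → Z₀ a ∧ not (typical₂ a))
      v = # (λ a → Z₀ a ∧ not (typical₃ a))
      lem : ∀ y u v → 4 * (y + (u + v)) ≡ 4 * y + (4 * u + 4 * v)
      lem = solve-∀
      lem₂ : ∀ x → 32 * (4 * x) ≡ 128 * x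
      lem₂ = solve-∀
      lem₃ : ∀ x → 4 * (32 * x) ≡ 128 * x
      lem₃ = solve-∀
      cover : ∀ z b c → ⟦ z ⟧ ≤ ⟦ z ∧ (b ∧ c) ⟧ + (⟦ z ∧ not b ⟧ + ⟦ z ∧ not c ⟧)
      cover false _     _     = z≤n
      cover true  true  true  = ≤-refl
      cover true  true  false = ≤-refl
      cover true  false true  = ≤-refl
      cover true  false false = s≤s z≤n
      u-small : 32 * u ≤ ζ
      u-small = *-cancelʳ-≤ _ _ ζ (begin
        32 * u * ζ               ≡⟨ *-assoc 32 u ζ ⟩
        32 * (u * ζ)             ≤⟨ *-monoʳ-≤ 32 (markov Z₀ degree₂ 4 ζ) ⟩
        32 * (4 * ∑ (λ a → ⟦ Z₀ a ⟧ * degree₂ a))  ≡⟨ trans (lem₂ (∑ λ a → ⟦ Z₀ a ⟧ * degree₂ a)) (cong (128 *_) ∑degree₂) ⟩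
        128 * bad₂ t τ           ≤⟨ few-bad₂ ⟩
        ζ * ζ                    ∎)
      v-small : 4 * v ≤ ζ
      v-small = *-cancelʳ-≤ _ _ (ζ * ω) {{m*n≢0 ζ ω}} (begin
        4 * v * (ζ * ω)          ≡⟨ *-assoc 4 v (ζ * ω) ⟩
        4 * (v * (ζ * ω))        ≤⟨ *-monoʳ-≤ 4 (markov Z₀ total₃ 32 (ζ * ω)) ⟩
        4 * (32 * ∑ (λ a → ⟦ Z₀ a ⟧ * total₃ a))   ≡⟨ lem₃ (∑ λ a → ⟦ Z₀ a ⟧ * total₃ a) ⟩
        128 * ∑ (λ a → ⟦ Z₀ a ⟧ * total₃ a)        ≤⟨ *-monoʳ-≤ 128 ∑total₃ ⟩
        128 * bad₃ t τ           ≤⟨ few-bad₃ ⟩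
        ζ * ζ * ω                ≡⟨ *-assoc ζ ζ ω ⟩
        ζ * (ζ * ω)              ∎)

    linked : F → F → Bool
    linked a v = 4 * degree₃ a v ≤ᵇ ζ

    few-unlinked : ∀ {a} → Y a ≡ true → 8 * # (λ v → W₀ v ∧ not (linked a v)) ≤ ω
    few-unlinked {a} Ya = *-cancelʳ-≤ _ _ ζ (begin
      8 * u * ζ              ≡⟨ *-assoc 8 u ζ ⟩
      8 * (u * ζ)            ≤⟨ *-monoʳ-≤ 8 (markov W₀ (degree₃ a) 4 ζ) ⟩
      8 * (4 * total₃ a)     ≡⟨ lem (total₃ a) ⟩
      32 * total₃ a          ≤⟨ Y⇒total₃ Ya ⟩
      ζ * ω                  ≡⟨ *-comm ζ ω ⟩
      ω * ζ                  ∎)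
      where
      open ≤-Reasoning
      u = # (λ v → W₀ v ∧ not (linked a v))
      lem : ∀ x → 8 * (4 * x) ≡ 32 * x
      lem = solve-∀

    module _ (a b c d : F) where
      W₄ : FinSet p
      W₄ v = W₀ v ∧ (linked a v ∧ (linked b v ∧ (linked c v ∧ linked d v)))

      W₄-large : Y a ≡ true → Y b ≡ true → Y c ≡ true → Y d ≡ true → ω ≤ 2 * # W₄
      W₄-large Ya Yb Yc Yd = *-cancelˡ-≤ 4 (+-cancelʳ-≤ (4 * ω) _ _ (begin
        4 * ω + 4 * ω                  ≡⟨ lem₁ ω ⟩
        8 * ω                          ≤⟨ *-monoʳ-≤ 8 (∑-mono λ v → cover (W₀ v) (linked a v) (linked b v) (linked c v) (linked d v)) ⟩
        8 * ∑ (λ v → ⟦ W₄ v ⟧ + (⟦ W₀ v ∧ not (linked a v) ⟧ + (⟦ W₀ v ∧ not (linked b v) ⟧ + (⟦ W₀ v ∧ not (linked c v) ⟧ + ⟦ W₀ v ∧ not (linked d v) ⟧))))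
          ≡⟨ cong (8 *_) (trans (∑-+ _ _) (cong (# W₄ +_) (trans (∑-+ _ _) (cong (u a +_) (trans (∑-+ _ _) (cong (u b +_) (∑-+ _ _))))))) ⟩
        8 * (# W₄ + (u a + (u b + (u c + u d))))   ≡⟨ lem₂ (# W₄) (u a) (u b) (u c) (u d) ⟩
        4 * (2 * # W₄) + (8 * u a + (8 * u b + (8 * u c + 8 * u d)))
          ≤⟨ +-monoʳ-≤ (4 * (2 * # W₄)) (+-mono-≤ (few-unlinked Ya) (+-mono-≤ (few-unlinked Yb) (+-mono-≤ (few-unlinked Yc) (few-unlinked Yd)))) ⟩
        4 * (2 * # W₄) + (ω + (ω + (ω + ω)))       ≡⟨ cong (4 * (2 * # W₄) +_) (lem₃ ω) ⟩
        4 * (2 * # W₄) + 4 * ω         ∎))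
        where
        open ≤-Reasoning
        u : F → ℕ
        u a = # (λ v → W₀ v ∧ not (linked a v))
        lem₁ : ∀ x → 4 * x + 4 * x ≡ 8 * x
        lem₁ = solve-∀
        lem₂ : ∀ w a b c d → 8 * (w + (a + (b + (c + d)))) ≡ 4 * (2 * w) + (8 * a + (8 * b + (8 * c + 8 * d)))
        lem₂ = solve-∀
        lem₃ : ∀ x → x + (x + (x + x)) ≡ 4 * x
        lem₃ = solve-∀
        cover : ∀ w a b c d → ⟦ w ⟧ ≤ ⟦ w ∧ (a ∧ (b ∧ (c ∧ d))) ⟧
              + (⟦ w ∧ not a ⟧ + (⟦ w ∧ not b ⟧ + (⟦ w ∧ not c ⟧ + ⟦ w ∧ not d ⟧)))
        cover false _     _     _     _     = z≤n
        cover true  false _     _     _     = s≤s z≤n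
        cover true  true  false _     _     = s≤s z≤n
        cover true  true  true  false _     = s≤s z≤n
        cover true  true  true  true  false = s≤s z≤n
        cover true  true  true  true  true  = s≤s z≤n

    -- Supplies the intermediate points `b` of two-step paths.
    many-common : (g g′ : F → Bool) → 4 * ∑ (λ b → ⟦ Z₀ b ⟧ * ⟦ not (g b) ⟧) ≤ ζ →
      4 * ∑ (λ b → ⟦ Z₀ b ⟧ * ⟦ not (g′ b) ⟧) ≤ ζ → ζ ≤ 2 * # (λ b → Z₀ b ∧ (g b ∧ g′ b))
    many-common g g′ few few′ = halve ζ N (begin
      4 * ζ
        ≤⟨ *-monoʳ-≤ 4 (∑-mono λ b → cover (Z₀ b) (g b) (g′ b)) ⟩
      4 * ∑ (λ b → ⟦ Z₀ b ∧ (g b ∧ g′ b) ⟧ + (⟦ Z₀ b ⟧ * ⟦ not (g b) ⟧ + ⟦ Z₀ b ⟧ * ⟦ not (g′ b) ⟧))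
        ≡⟨ trans (cong (4 *_) (trans (∑-+ _ _) (cong (N +_) (∑-+ _ _)))) (lem N (∑ λ b → ⟦ Z₀ b ⟧ * ⟦ not (g b) ⟧) (∑ λ b → ⟦ Z₀ b ⟧ * ⟦ not (g′ b) ⟧)) ⟩
      4 * N + (4 * ∑ (λ b → ⟦ Z₀ b ⟧ * ⟦ not (g b) ⟧) + 4 * ∑ (λ b → ⟦ Z₀ b ⟧ * ⟦ not (g′ b) ⟧))
        ≤⟨ +-monoʳ-≤ (4 * N) (+-mono-≤ few few′) ⟩
      4 * N + (ζ + ζ) ∎)
      where
      open ≤-Reasoning
      N = # (λ b → Z₀ b ∧ (g b ∧ g′ b))
      lem : ∀ y u v → 4 * (y + (u + v)) ≡ 4 * y + (4 * u + 4 * v)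
      lem = solve-∀
      cover : ∀ z b c → ⟦ z ⟧ ≤ ⟦ z ∧ (b ∧ c) ⟧ + (⟦ z ⟧ * ⟦ not b ⟧ + ⟦ z ⟧ * ⟦ not c ⟧)
      cover false _     _     = z≤n
      cover true  true  true  = ≤-refl
      cover true  true  false = ≤-refl
      cover true  false true  = ≤-refl
      cover true  false false = s≤s z≤n

    ∑-affine : ∀ e (g : F → ℕ) → ∑ (λ b → g (e ⊝ b ⊘ t)) ≡ ∑ g
    ∑-affine e g = trans (∑-unscale t t≢0 λ b → g (e ⊝ b)) (∑-reflect e g)

    h-sym : ∀ a b → h a b ≡ h b a
    h-sym a b = ∑-cong λ u → *-comm (α (u ⊘ a)) _

    good₂⇒ρ₂ : ∀ {a b} → Z₀ a ≡ true → Z₀ b ≡ true → good₂ a b ≡ true → m ≤ ρ₂ (a ⊘ t ⊝ b ⊘ t)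
    good₂⇒ρ₂ {a} {b} Za Zb good = ≤-trans (≤-true good)
      (h≤ρ₂ t a b t≢0 (A∌0 a (Z⇒A t τ a Za)) (A∌0 b (Z⇒A t τ b Zb)) (Z⇒A/ t τ a Za) (Z⇒A/ t τ b Zb))

    good₃⇒ρ₃ : ∀ {a b v} → Z₀ b ≡ true → W₀ v ≡ true → good₃ a (t ⊘ b) v ≡ true →
               m₂ ≤ ρ₃ (a ⊗ (b ⊘ t) ⊕ v ⁻¹)
    good₃⇒ρ₃ {a} {b} {v} Zb Wv good = ≤-trans (≤-true good) (subst (λ y → f a (t ⊘ b) v ≤ ρ₃ (a ⊗ y ⊕ v ⁻¹))
      (⊗-cancelʳ (t ⊘ b) t/b≢0 (trans (⊗-inverseˡ (t ⊘ b) t/b≢0) (sym (⊘-⊘-inverse t≢0 b≢0))))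
      (f≤ρ₃ a (t ⊘ b) v (∧-fst Wv)))
      where
      b≢0 = A∌0 b (Z⇒A t τ b Zb)
      t/b≢0 = A∌0 (t ⊘ b) (Z⇒A/ t τ b Zb)

    -- Each common good neighbour `b` splits `a/t − c/t` as `(a/t − b/t) + (b/t − c/t)`, with at
    -- least `m` representations of either part; distinct `b` contribute distinct terms of `ρ₄`.
    difference-popular : ∀ {a c} → Y a ≡ true → Y c ≡ true → ζ * (m * m) ≤ 2 * ρ₄ (a ⊘ t ⊝ c ⊘ t)
    difference-popular {a} {c} Ya Yc = begin
      ζ * (m * m)           ≤⟨ *-monoˡ-≤ (m * m) (many-common (good₂ a) (good₂ c) (Y⇒degree₂ Ya) (Y⇒degree₂ Yc)) ⟩
      2 * N * (m * m)       ≡⟨ *-assoc 2 N (m * m) ⟩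
      2 * (N * (m * m))     ≡⟨ cong (2 *_) (∑-*ʳ (m * m) _) ⟨
      2 * ∑ (λ b → ⟦ Z₀ b ∧ (good₂ a b ∧ good₂ c b) ⟧ * (m * m))
        ≤⟨ *-monoʳ-≤ 2 (∑-mono pointwise) ⟩
      2 * ∑ (λ b → ρ₂ (e ⊝ b ⊘ t) * ρ₂ (e ⊝ c ⊘ t ⊝ (e ⊝ b ⊘ t)))
        ≡⟨ cong (2 *_) (∑-affine e λ x → ρ₂ x * ρ₂ (e ⊝ c ⊘ t ⊝ x)) ⟩
      2 * ρ₄ (e ⊝ c ⊘ t)  ∎
      where
      open ≤-Reasoning
      e = a ⊘ t
      N = # (λ b → Z₀ b ∧ (good₂ a b ∧ good₂ c b))
      pointwise : ∀ b → ⟦ Z₀ b ∧ (good₂ a b ∧ good₂ c b) ⟧ * (m * m) ≤ ρ₂ (e ⊝ b ⊘ t) * ρ₂ (e ⊝ c ⊘ t ⊝ (e ⊝ b ⊘ t))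
      pointwise b = ⟦⟧*-≤ (Z₀ b ∧ (good₂ a b ∧ good₂ c b)) λ ok →
        let Zb = ∧-fst ok; ga = ∧-fst (∧-snd {Z₀ b} ok); gc = ∧-snd {good₂ a b} (∧-snd {Z₀ b} ok) in
        *-mono-≤ (good₂⇒ρ₂ (Y⇒Z Ya) Zb ga)
          (subst (λ y → m ≤ ρ₂ y) (solve 3 (λ e b c → b :+ (:- c) := e :+ (:- c) :+ (:- (e :+ (:- b)))) refl e (b ⊘ t) (c ⊘ t))
            (good₂⇒ρ₂ Zb (Y⇒Z Yc) (trans (cong (m ≤ᵇ_) (h-sym b c)) gc)))

    -- Here `a c/t + 1/v = a (c/t − b/t) + (a b/t + 1/v)`: the good pair `(c , b)` serves the first
    -- bracket and the good triple `(a , t/b , v)` the second. The dilation by `a` of a difference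
    -- of `Q` is what `ρ₅ a` allows for.
    sum-popular : ∀ {a c v} → Y c ≡ true → W₀ v ≡ true → linked a v ≡ true →
                  ζ * (m * m₂) ≤ 2 * ρ₅ a (a ⊗ (c ⊘ t) ⊕ v ⁻¹)
    sum-popular {a} {c} {v} Yc Wv link = begin
      ζ * (m * m₂)           ≤⟨ *-monoˡ-≤ (m * m₂) (many-common (good₂ c) g₃ (Y⇒degree₂ Yc) (≤-true link)) ⟩
      2 * N * (m * m₂)       ≡⟨ *-assoc 2 N (m * m₂) ⟩
      2 * (N * (m * m₂))     ≡⟨ cong (2 *_) (∑-*ʳ (m * m₂) _) ⟨
      2 * ∑ (λ b → ⟦ Z₀ b ∧ (good₂ c b ∧ g₃ b) ⟧ * (m * m₂))
        ≤⟨ *-monoʳ-≤ 2 (∑-mono pointwise) ⟩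
      2 * ∑ (λ b → ρ₂ (e ⊝ b ⊘ t) * ρ₃ (a ⊗ e ⊕ v ⁻¹ ⊝ a ⊗ (e ⊝ b ⊘ t)))
        ≡⟨ cong (2 *_) (∑-affine e λ x → ρ₂ x * ρ₃ (a ⊗ e ⊕ v ⁻¹ ⊝ a ⊗ x)) ⟩
      2 * ρ₅ a (a ⊗ e ⊕ v ⁻¹)  ∎
      where
      open ≤-Reasoning
      e = c ⊘ t
      g₃ : F → Bool
      g₃ b = good₃ a (t ⊘ b) v
      N = # (λ b → Z₀ b ∧ (good₂ c b ∧ g₃ b))
      pointwise : ∀ b → ⟦ Z₀ b ∧ (good₂ c b ∧ g₃ b) ⟧ * (m * m₂) ≤ ρ₂ (e ⊝ b ⊘ t) * ρ₃ (a ⊗ e ⊕ v ⁻¹ ⊝ a ⊗ (e ⊝ b ⊘ t))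
      pointwise b = ⟦⟧*-≤ (Z₀ b ∧ (good₂ c b ∧ g₃ b)) λ ok →
        let Zb = ∧-fst ok; gc = ∧-fst (∧-snd {Z₀ b} ok); ga = ∧-snd {good₂ c b} (∧-snd {Z₀ b} ok) in
        *-mono-≤ (good₂⇒ρ₂ (Y⇒Z Yc) Zb gc)
          (subst (λ y → m₂ ≤ ρ₃ y) (solve 4 (λ a e b i → a :* b :+ i := a :* e :+ i :+ (:- (a :* (e :+ (:- b))))) refl a e (b ⊘ t) (v ⁻¹))
            (good₃⇒ρ₃ Zb Wv ga))

-- Ratio sets

module Additive {p : ℕ} (𝔽 : FiniteField p) where
  open FieldProperties 𝔽
  open 𝔽-Solver using (solve; _:+_; _:*_; :-_; _:=_)
  open Action {p} (λ d z → z ⊝ d) (λ d z → z ⊕ d) public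

  invertible : ∀ D → Invertible D
  invertible D d _ = (λ z → ⊝-⊕ z d) , (λ z → ⊕-⊝ z d)

  act-comm : ∀ b c z → z ⊝ c ⊝ b ≡ z ⊝ b ⊝ c
  act-comm = solve 3 (λ b c z → z :+ (:- c) :+ (:- b) := z :+ (:- b) :+ (:- c)) refl

  abstract
    image : (F → F) → FinSet p → FinSet p
    image g Y d = any λ y → Y y ∧ does (d ≟ᶠ g y)

    image-intro : ∀ g {Y} y → Y y ≡ true → image g Y (g y) ≡ true
    image-intro g y Yy = any-intro y (∧-intro Yy (dec-true (g y ≟ᶠ g y) refl))

    image-elim : ∀ g {Y} d → image g Y d ≡ true → ∃ λ y → Y y ≡ true × d ≡ g y
    image-elim g {Y} d h with any-elim {S = λ y → Y y ∧ does (d ≟ᶠ g y)} h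
    ... | y , q with d ≟ᶠ g y
    ...   | yes eq = y , ∧-fst q , eq
    ...   | no _   = ⊥-elim (true≢false (∧-snd {Y y} q) refl)

  infixl 6 _−_
  -- `X − g(Y)`, written as the sum of `X` with an image set so that the Plünnecke inequalities
  -- apply to it.
  _−_ : FinSet p → (F → F) → FinSet p → FinSet p
  (X − g) Y = X · image (λ y → ⊖ g y) Y

  −-intro : ∀ {X Y} g y z → Y y ≡ true → X (z ⊕ g y) ≡ true → (X − g) Y z ≡ true
  −-intro {X} g y z Yy Xz = ·-intro (⊖ g y) z (image-intro (λ y → ⊖ g y) y Yy)
    (trans (cong X (solve 2 (λ z d → z :+ (:- (:- d)) := z :+ d) refl z (g y))) Xz)

  −-elim : ∀ {X Y} g z → (X − g) Y z ≡ true → ∃ λ y → Y y ≡ true × X (z ⊕ g y) ≡ true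
  −-elim {X} {Y} g z h with ·-elim z h
  ... | d , Dd , Xz with image-elim (λ y → ⊖ g y) d Dd
  ...   | y , Yy , refl = y , Yy ,
          trans (cong X (solve 2 (λ z d → z :+ d := z :+ (:- (:- d))) refl z (g y))) Xz

  #≤#− : ∀ {X Y} g y → Y y ≡ true → # X ≤ # ((X − g) Y)
  #≤#− {X} {Y} g y Yy = ≤-trans (≤-reflexive (sym (∑-shift (g y) (⟦_⟧ ∘ X))))
    (#-mono {T = (X − g) Y} λ z → −-intro g y z Yy)

  Ratio : FinSet p → F → Set
  Ratio Y r = ∃ λ a → ∃ λ b → ∃ λ c → ∃ λ d →
    Y a ≡ true × Y b ≡ true × Y c ≡ true × Y d ≡ true × c ≢ d × r ⊗ (c ⊝ d) ≡ a ⊝ b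

  ratio? : ∀ Y r → Dec (Ratio Y r)
  ratio? Y r = any? λ a → any? λ b → any? λ c → any? λ d →
    (Y a Boolₚ.≟ true) ×-dec (Y b Boolₚ.≟ true) ×-dec (Y c Boolₚ.≟ true) ×-dec
    (Y d Boolₚ.≟ true) ×-dec ¬? (c ≟ᶠ d) ×-dec (r ⊗ (c ⊝ d) ≟ᶠ a ⊝ b)

  module _ {Y : FinSet p} where

    -- Ruzsa's triangle inequality, for (c − d)(y − r y′) = (c y + b y′) − (d y + a y′).
    ratio-sumset : ∀ {T a b c d r} {S : FinSet p} → c ≢ d → r ⊗ (c ⊝ d) ≡ a ⊝ b →
      (∀ y → Y y ≡ true → S (a ⊗ y) ≡ true × S (b ⊗ y) ≡ true × S (c ⊗ y) ≡ true × S (d ⊗ y) ≡ true) →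
      # ((Y − (r ⊗_)) Y) * # T ≤ # (T · S · S) * # (T · S · S)
    ratio-sumset {T} {a} {b} {c} {d} {r} {S} c≢d r-eq S∋ = begin
      # D * # T                                   ≡⟨ ∑-*ʳ (# T) _ ⟨
      ∑ (λ z → ⟦ D z ⟧ * # T)                     ≤⟨ (∑-mono λ z → ⟦⟧*-≤ (D z) (row z)) ⟩
      ∑₂ (λ z x → ⟦ U x ⟧ * ⟦ U (x ⊝ z ⊗ e) ⟧)    ≡⟨ ∑-swap _ ⟩
      ∑₂ (λ x z → ⟦ U x ⟧ * ⟦ U (x ⊝ z ⊗ e) ⟧)    ≡⟨ (∑-cong λ x → trans (∑-*ˡ ⟦ U x ⟧ _) (cong (⟦ U x ⟧ *_)
           (trans (∑-scale e e≢0 λ z → ⟦ U (x ⊝ z) ⟧) (∑-reflect x λ z → ⟦ U z ⟧)))) ⟩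
      ∑ (λ x → ⟦ U x ⟧ * # U)                     ≡⟨ ∑-*ʳ (# U) _ ⟩
      # U * # U                                   ∎
      where
      open ≤-Reasoning
      D U : FinSet p
      D = (Y − (r ⊗_)) Y
      U = T · S · S
      e = c ⊝ d
      e≢0 = ⊝≢𝟘 c≢d
      U-intro : ∀ {τ s s′} → T τ ≡ true → S s ≡ true → S s′ ≡ true → U (τ ⊕ (s ⊕ s′)) ≡ true
      U-intro {τ} {s} {s′} Tτ Ss Ss′ = ·-intro s′ _ Ss′ (·-intro s _ Ss
        (trans (cong T (solve 3 (λ τ s s′ → τ :+ (s :+ s′) :+ (:- s′) :+ (:- s) := τ) refl τ s s′)) Tτ))
      row : ∀ z → D z ≡ true → # T ≤ ∑ λ x → ⟦ U x ⟧ * ⟦ U (x ⊝ z ⊗ e) ⟧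
      row z Dz with −-elim (r ⊗_) z Dz
      ... | y′ , Yy′ , Yy = begin
        # T
          ≤⟨ ∑-mono (λ τ → ⟦⟧-mono (T τ) _ (λ Tτ → ∧-intro (U-intro Tτ (c∋ y Yy) (b∋ y′ Yy′)) (trans (cong U (shifted τ)) (U-intro Tτ (d∋ y Yy) (a∋ y′ Yy′))))) ⟩
        ∑ (λ τ → ⟦ U (τ ⊕ g) ∧ U (τ ⊕ g ⊝ z ⊗ e) ⟧)
          ≡⟨ (∑-cong λ τ → ⟦∧⟧ (U (τ ⊕ g)) _) ⟩
        ∑ (λ τ → ⟦ U (τ ⊕ g) ⟧ * ⟦ U (τ ⊕ g ⊝ z ⊗ e) ⟧)
          ≡⟨ ∑-shift g (λ x → ⟦ U x ⟧ * ⟦ U (x ⊝ z ⊗ e) ⟧) ⟩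
        ∑ (λ x → ⟦ U x ⟧ * ⟦ U (x ⊝ z ⊗ e) ⟧) ∎
        where
        y g : F
        y = z ⊕ r ⊗ y′
        g = c ⊗ y ⊕ b ⊗ y′
        a∋ = λ y Yy → proj₁ (S∋ y Yy)
        b∋ = λ y Yy → proj₁ (proj₂ (S∋ y Yy))
        c∋ = λ y Yy → proj₁ (proj₂ (proj₂ (S∋ y Yy)))
        d∋ = λ y Yy → proj₂ (proj₂ (proj₂ (S∋ y Yy)))
        -- With `z = y − r y′`, subtracting `z (c − d)` exchanges `c y + b y′` for `d y + a y′`;
        -- here `r (c − d) = a − b` enters. So `T + g` and its shift both lie in `U`, and every `z`
        -- has at least `|T|` representations.
        shifted : ∀ τ → τ ⊕ g ⊝ z ⊗ e ≡ τ ⊕ (d ⊗ y ⊕ a ⊗ y′)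
        shifted τ = trans
          (solve 7 (λ τ z r y′ b c d → τ :+ (c :* (z :+ r :* y′) :+ b :* y′) :+ (:- (z :* (c :+ (:- d))))
             := τ :+ (d :* (z :+ r :* y′) :+ (r :* (c :+ (:- d)) :+ b) :* y′)) refl τ z r y′ b c d)
          (cong (λ v → τ ⊕ (d ⊗ y ⊕ v ⊗ y′)) (trans (cong (_⊕ b) r-eq) (⊝-⊕ a b)))

    -- Put `K = |T₀ + S| / |T₀|`. Plünnecke gives `|T + S + S| ≤ K² |T|` for some `T ⊆ T₀`, and the
    -- triangle inequality then gives `|Y − rY| ≤ K⁴ |T| ≤ K⁴ |T₀|`.
    ratio-bound : ∀ {a b c d r} {S T₀ : FinSet p} → 0 < # T₀ → c ≢ d → r ⊗ (c ⊝ d) ≡ a ⊝ b →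
      (∀ y → Y y ≡ true → S (a ⊗ y) ≡ true × S (b ⊗ y) ≡ true × S (c ⊗ y) ≡ true × S (d ⊗ y) ≡ true) →
      # ((Y − (r ⊗_)) Y) * (# T₀ * # T₀ * # T₀) ≤ # (T₀ · S) * # (T₀ · S) * (# (T₀ · S) * # (T₀ · S))
    ratio-bound {r = r} {S} {T₀} T₀>0 c≢d r-eq S∋ with plünnecke act-comm S T₀ T₀>0
    ... | T , T⊆T₀ , T>0 , ratio , pet =
      arithmetic (# ((Y − (r ⊗_)) Y)) (# T) (# T₀) (# (T · S · S)) (# (T · S)) (# (T₀ · S))
        T>0 T₀>0 (#-mono T⊆T₀) (ratio-sumset c≢d r-eq S∋) (pet S (invertible S)) ratio
      where
      arithmetic : ∀ R t t₀ U V₁ V → 0 < t → 0 < t₀ → t ≤ t₀ →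
        R * t ≤ U * U → U * t ≤ V₁ * V₁ → V₁ * t₀ ≤ V * t → R * (t₀ * t₀ * t₀) ≤ (V * V * (V * V))
      arithmetic R t t₀ U V₁ V t>0 t₀>0 t≤t₀ h₁ h₂ h₃ =
        *-cancelʳ-≤ _ _ t₀ {{>-nonZero t₀>0}} (*-cancelʳ-≤ _ _ (t * t * t) {{m*n≢0 (t * t) t {{m*n≢0 t t}}}} (begin
          R * (t₀ * t₀ * t₀) * t₀ * (t * t * t)                 ≡⟨ l₁ R t t₀ ⟩
          R * t * (t * t) * (t₀ * t₀ * (t₀ * t₀))       ≤⟨ *-monoˡ-≤ _ (*-monoˡ-≤ (t * t) h₁) ⟩
          U * U * (t * t) * (t₀ * t₀ * (t₀ * t₀))       ≡⟨ l₂ U t t₀ ⟩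
          (U * t) * (U * t) * (t₀ * t₀ * (t₀ * t₀))     ≤⟨ *-monoˡ-≤ _ (*-mono-≤ h₂ h₂) ⟩
          (V₁ * V₁) * (V₁ * V₁) * (t₀ * t₀ * (t₀ * t₀)) ≡⟨ l₃ V₁ t₀ ⟩
          (V₁ * t₀) * (V₁ * t₀) * ((V₁ * t₀) * (V₁ * t₀)) ≤⟨ *-mono-≤ (*-mono-≤ h₃ h₃) (*-mono-≤ h₃ h₃) ⟩
          (V * t) * (V * t) * ((V * t) * (V * t))       ≡⟨ l₄ V t ⟩
          (V * V * (V * V)) * t * (t * t * t)                       ≤⟨ *-monoˡ-≤ (t * t * t) (*-monoʳ-≤ ((V * V * (V * V))) t≤t₀) ⟩
          (V * V * (V * V)) * t₀ * (t * t * t)                      ∎))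
        where
        open ≤-Reasoning
        instance
          t≢0 : NonZero t
          t≢0 = >-nonZero t>0
        l₁ : ∀ R t t₀ → R * (t₀ * t₀ * t₀) * t₀ * (t * t * t) ≡ R * t * (t * t) * (t₀ * t₀ * (t₀ * t₀))
        l₁ = solve-∀
        l₂ : ∀ U t t₀ → U * U * (t * t) * (t₀ * t₀ * (t₀ * t₀)) ≡ (U * t) * (U * t) * (t₀ * t₀ * (t₀ * t₀))
        l₂ = solve-∀
        l₃ : ∀ V t → (V * V) * (V * V) * (t * t * (t * t)) ≡ (V * t) * (V * t) * ((V * t) * (V * t))
        l₃ = solve-∀
        l₄ : ∀ V t → (V * t) * (V * t) * ((V * t) * (V * t)) ≡ (V * V * (V * V)) * t * (t * t * t)
        l₄ = solve-∀

    -- If r + 1 is not a ratio then (x , y) ↦ x − (r + 1) y is injective on Y × Y.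
    difference-injective : ∀ {r} {T : FinSet p} → T ⊆ Y → ¬ Ratio Y (r ⊕ 𝟙) →
      # T * # Y ≤ # (((T − (r ⊗_)) Y − id) Y)
    difference-injective {r} {T} T⊆Y ¬ratio = injective
      where
      open ≤-Reasoning
      U : FinSet p
      U = ((T − (r ⊗_)) Y − id) Y
      s = r ⊕ 𝟙
      pairs : F → FinSet p
      pairs z y = Y y ∧ T (z ⊕ s ⊗ y)
      unique : ∀ z y y′ → pairs z y ≡ true → pairs z y′ ≡ true → y ≡ y′
      unique z y y′ h h′ with y ≟ᶠ y′
      ... | yes eq = eq
      ... | no y≢y′ = ⊥-elim (¬ratio (_ , _ , y , y′ , T⊆Y _ (∧-snd {Y y} h) , T⊆Y _ (∧-snd {Y y′} h′) ,
              ∧-fst h , ∧-fst h′ , y≢y′ ,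
              solve 4 (λ s z y y′ → s :* (y :+ (:- y′)) := z :+ s :* y :+ (:- (z :+ s :* y′))) refl s z y y′))
      member : ∀ z y → pairs z y ≡ true → U z ≡ true
      member z y h = −-intro id y z (∧-fst h) (−-intro (r ⊗_) y (z ⊕ y) (∧-fst h)
        (trans (cong T eq) (∧-snd {Y y} h)))
        where
        eq : z ⊕ y ⊕ r ⊗ y ≡ z ⊕ s ⊗ y
        eq = trans (solve 3 (λ z y w → z :+ y :+ w := z :+ (w :+ y)) refl z y (r ⊗ y))
          (cong (z ⊕_) (trans (cong (r ⊗ y ⊕_) (sym (⊗-identityˡ y))) (sym (⊗-distribʳ-⊕ y r 𝟙))))
      row : ∀ z → # (pairs z) ≤ ⟦ U z ⟧
      row z with U z in eq
      ... | true  = ∑≤1 (pairs z) (unique z)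
      ... | false = ≤-reflexive (∑-zero λ y → none y)
        where
        none : ∀ y → ⟦ pairs z y ⟧ ≡ 0
        none y with pairs z y in eq′
        ... | false = refl
        ... | true  = ⊥-elim (true≢false (member z y eq′) eq)
      injective : # T * # Y ≤ # U
      injective = begin
        # T * # Y                                      ≡⟨ trans (*-comm (# T) (# Y)) (sym (∑-*ʳ (# T) _)) ⟩
        ∑ (λ y → ⟦ Y y ⟧ * # T)                        ≡⟨ (∑-cong λ y → cong (⟦ Y y ⟧ *_) (∑-shift (s ⊗ y) (⟦_⟧ ∘ T))) ⟨
        ∑ (λ y → ⟦ Y y ⟧ * ∑ λ z → ⟦ T (z ⊕ s ⊗ y) ⟧)  ≡⟨ (∑-cong λ y → trans (sym (∑-*ˡ ⟦ Y y ⟧ _)) (∑-cong λ z → sym (⟦∧⟧ (Y y) _))) ⟩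
        ∑₂ (λ y z → ⟦ pairs z y ⟧)                     ≡⟨ ∑-swap _ ⟩
        ∑ (λ z → # (pairs z))                          ≤⟨ ∑-mono row ⟩
        # U                                            ∎

    -- `plünnecke₂` controls `T − rY − Y` only for some `T ⊆ Y`. Injectivity on `T × Y` bounds that
    -- set below by `|T||Y|`, and `|T|` cancels.
    injective-bound : ∀ {r} → 0 < # Y → ¬ Ratio Y (r ⊕ 𝟙) →
      # Y * (# Y * # Y) ≤ 4 * (# ((Y − id) Y) * # ((Y − (r ⊗_)) Y))
    injective-bound {r} Y>0 ¬ratio =
      let T , T⊆Y , T>0 , bound = plünnecke₂ act-comm (image (λ y → ⊖ y) Y) (image (λ y → ⊖ (r ⊗ y)) Y) Y
            (invertible _) (<-≤-trans Y>0 (#≤#− id y₀ Yy₀)) (<-≤-trans Y>0 (#≤#− (r ⊗_) y₀ Yy₀)) Y>0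
      in *-cancelʳ-≤ _ _ (# T) {{>-nonZero T>0}} (begin
        # Y * (# Y * # Y) * # T        ≡⟨ lem (# Y) (# T) ⟩
        # T * # Y * (# Y * # Y)        ≤⟨ *-monoˡ-≤ (# Y * # Y) (difference-injective T⊆Y ¬ratio) ⟩
        # (((T − (r ⊗_)) Y − id) Y) * (# Y * # Y)   ≤⟨ bound ⟩
        4 * (# ((Y − id) Y) * # ((Y − (r ⊗_)) Y)) * # T ∎)
      where
      open ≤-Reasoning
      y₀ = proj₁ (#-nonempty Y>0)
      Yy₀ = proj₂ (#-nonempty Y>0)
      lem : ∀ y t → y * (y * y) * t ≡ t * y * (y * y)
      lem = solve-∀

    -- Averaging the energy over all dilates

    ν : F → F → ℕ
    ν r z = ∑ λ y → ⟦ Y y ⟧ * ⟦ Y (z ⊕ r ⊗ y) ⟧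

    energy : F → ℕ
    energy r = ∑ λ z → ν r z * ν r z

    correlation : F → F → ℕ
    correlation a b = ∑₂ λ r z → ⟦ Y (z ⊕ r ⊗ a) ⟧ * ⟦ Y (z ⊕ r ⊗ b) ⟧

    -- For `a ≠ b` the map `(r , z) ↦ (z + r a , z + r b)` is a bijection of the plane, which gives
    -- exactly `|Y|²`; for `a = b` the slope `r` is free, whence `p |Y|`.
    correlation-≤ : ∀ a b → correlation a b ≤ # Y * # Y + ⟦ does (a ≟ᶠ b) ⟧ * (p * # Y)
    correlation-≤ a b with a ≟ᶠ b
    ... | yes refl = begin
      correlation a a                      ≤⟨ ∑₂-mono (λ r z → *-monoʳ-≤ ⟦ Y (z ⊕ r ⊗ a) ⟧ (⟦⟧≤1 (Y (z ⊕ r ⊗ a)))) ⟩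
      ∑₂ (λ r z → ⟦ Y (z ⊕ r ⊗ a) ⟧ * 1)   ≡⟨ (∑-cong λ r → trans (∑-cong λ z → *-identityʳ _) (∑-shift (r ⊗ a) (⟦_⟧ ∘ Y))) ⟩
      ∑ (λ r → # Y)                        ≡⟨ ∑-const p (# Y) ⟩
      p * # Y                              ≡⟨ +-identityʳ (p * # Y) ⟨
      1 * (p * # Y)                        ≤⟨ m≤n+m _ (# Y * # Y) ⟩
      # Y * # Y + 1 * (p * # Y)            ∎
      where open ≤-Reasoning
    ... | no a≢b = ≤-trans (≤-reflexive (begin
      correlation a b
        ≡⟨ (∑-cong λ r → trans (sym (∑-shift (⊖ (r ⊗ a)) _)) (∑-cong λ z → cong₂ (λ u v → ⟦ Y u ⟧ * ⟦ Y v ⟧)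
             (⊝-⊕ z (r ⊗ a)) (solve 4 (λ z r a b → z :+ (:- (r :* a)) :+ r :* b := r :* (b :+ (:- a)) :+ z) refl z r a b))) ⟩
      ∑₂ (λ r z → ⟦ Y z ⟧ * ⟦ Y (r ⊗ (b ⊝ a) ⊕ z) ⟧)
        ≡⟨ ∑-swap _ ⟩
      ∑₂ (λ z r → ⟦ Y z ⟧ * ⟦ Y (r ⊗ (b ⊝ a) ⊕ z) ⟧)
        ≡⟨ (∑-cong λ z → trans (∑-*ˡ ⟦ Y z ⟧ _) (cong (⟦ Y z ⟧ *_)
             (trans (∑-scale (b ⊝ a) (⊝≢𝟘 (a≢b ∘ sym)) λ u → ⟦ Y (u ⊕ z) ⟧) (∑-shift z (⟦_⟧ ∘ Y))))) ⟩
      ∑ (λ z → ⟦ Y z ⟧ * # Y)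
        ≡⟨ ∑-*ʳ (# Y) _ ⟩
      # Y * # Y ∎)) (m≤m+n _ _)
      where open ≡-Reasoning

    ∑-energy : ∑ energy ≤ # Y * # Y * (# Y * # Y) + p * (# Y * # Y)
    ∑-energy = begin
      ∑ energy
        ≡⟨ (∑₂-cong λ r z → sym (∑₂-product (λ a → ⟦ Y a ⟧ * ⟦ Y (z ⊕ r ⊗ a) ⟧) λ b → ⟦ Y b ⟧ * ⟦ Y (z ⊕ r ⊗ b) ⟧)) ⟩
      ∑₂ (λ r z → ∑₂ λ a b → ⟦ Y a ⟧ * ⟦ Y (z ⊕ r ⊗ a) ⟧ * (⟦ Y b ⟧ * ⟦ Y (z ⊕ r ⊗ b) ⟧))
        ≡⟨ trans (∑₂-∑ _) (∑-cong λ a → ∑₂-∑ _) ⟩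
      ∑₂ (λ a b → ∑₂ λ r z → ⟦ Y a ⟧ * ⟦ Y (z ⊕ r ⊗ a) ⟧ * (⟦ Y b ⟧ * ⟦ Y (z ⊕ r ⊗ b) ⟧))
        ≡⟨ (∑₂-cong λ a b → trans (∑₂-cong λ r z → lem₁ ⟦ Y a ⟧ ⟦ Y (z ⊕ r ⊗ a) ⟧ ⟦ Y b ⟧ ⟦ Y (z ⊕ r ⊗ b) ⟧)
             (∑₂-*ˡ (⟦ Y a ⟧ * ⟦ Y b ⟧) λ r z → ⟦ Y (z ⊕ r ⊗ a) ⟧ * ⟦ Y (z ⊕ r ⊗ b) ⟧)) ⟩
      ∑₂ (λ a b → ⟦ Y a ⟧ * ⟦ Y b ⟧ * correlation a b)
        ≤⟨ ∑₂-mono (λ a b → *-monoʳ-≤ (⟦ Y a ⟧ * ⟦ Y b ⟧) (correlation-≤ a b)) ⟩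
      ∑₂ (λ a b → ⟦ Y a ⟧ * ⟦ Y b ⟧ * (# Y * # Y + ⟦ does (a ≟ᶠ b) ⟧ * (p * # Y)))
        ≤⟨ ∑₂-mono (λ a b → split a b) ⟩
      ∑₂ (λ a b → # Y * # Y * (⟦ Y a ⟧ * ⟦ Y b ⟧) + p * # Y * (⟦ Y a ⟧ * ⟦ does (a ≟ᶠ b) ⟧))
        ≡⟨ trans (∑₂-+ _ _) (cong₂ _+_
             (trans (∑₂-*ˡ (# Y * # Y) _) (cong (# Y * # Y *_) (∑₂-product (⟦_⟧ ∘ Y) (⟦_⟧ ∘ Y))))
             (trans (∑₂-*ˡ (p * # Y) λ a b → ⟦ Y a ⟧ * ⟦ does (a ≟ᶠ b) ⟧) (cong (p * # Y *_) (∑-cong λ a → ∑-*ˡ ⟦ Y a ⟧ λ b → ⟦ does (a ≟ᶠ b) ⟧)))) ⟩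
      # Y * # Y * (# Y * # Y) + p * # Y * ∑ (λ a → ⟦ Y a ⟧ * # (λ b → does (a ≟ᶠ b)))
        ≤⟨ +-monoʳ-≤ (# Y * # Y * (# Y * # Y)) (*-monoʳ-≤ (p * # Y) (∑-mono λ a →
             ≤-trans (*-monoʳ-≤ ⟦ Y a ⟧ (∑≤1 (λ b → does (a ≟ᶠ b)) (unique a))) (≤-reflexive (*-identityʳ _)))) ⟩
      # Y * # Y * (# Y * # Y) + p * # Y * # Y
        ≡⟨ cong (# Y * # Y * (# Y * # Y) +_) (*-assoc p (# Y) (# Y)) ⟩
      # Y * # Y * (# Y * # Y) + p * (# Y * # Y) ∎
      where
      open ≤-Reasoning
      lem₁ : ∀ a u b v → a * u * (b * v) ≡ a * b * (u * v)
      lem₁ = solve-∀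
      lem₂ : ∀ a b y d w → a * b * (y + d * w) ≡ y * (a * b) + w * (a * d) * b
      lem₂ = solve-∀
      unique : ∀ a i j → does (a ≟ᶠ i) ≡ true → does (a ≟ᶠ j) ≡ true → i ≡ j
      unique a i j h h′ with a ≟ᶠ i | a ≟ᶠ j
      ... | yes p | yes q = trans (sym p) q
      split : ∀ a b → ⟦ Y a ⟧ * ⟦ Y b ⟧ * (# Y * # Y + ⟦ does (a ≟ᶠ b) ⟧ * (p * # Y))
            ≤ # Y * # Y * (⟦ Y a ⟧ * ⟦ Y b ⟧) + p * # Y * (⟦ Y a ⟧ * ⟦ does (a ≟ᶠ b) ⟧)
      split a b = ≤-trans (≤-reflexive (lem₂ ⟦ Y a ⟧ ⟦ Y b ⟧ (# Y * # Y) ⟦ does (a ≟ᶠ b) ⟧ (p * # Y)))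
        (+-monoʳ-≤ (# Y * # Y * (⟦ Y a ⟧ * ⟦ Y b ⟧)) (≤-trans (*-monoʳ-≤ (p * # Y * (⟦ Y a ⟧ * ⟦ does (a ≟ᶠ b) ⟧)) (⟦⟧≤1 (Y b))) (≤-reflexive (*-identityʳ _))))

    -- The mean of the energy over `r` is at most `|Y|⁴/p + |Y|²`; the hypothesis `|A| ≤ p^{1/2}`
    -- enters here to bound it by `2 |Y|²`. The successor in the comparison makes the pigeonhole
    -- strict.
    low-energy : # Y * # Y ≤ p → ∃ λ r → energy r ≤ 2 * (# Y * # Y)
    low-energy Y²≤p = let r , lt = ∑-pigeonhole energy (λ _ → suc (2 * y²)) total in r , s≤s⁻¹ lt
      where
      open ≤-Reasoning
      y² = # Y * # Y
      lem : ∀ p y → p * y + p * y ≡ p * (2 * y)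
      lem = solve-∀
      p>0 : 0 < p
      p>0 = inhabited 𝟘
        where
        inhabited : ∀ {k} → Fin k → 0 < k
        inhabited {suc k} _ = s≤s z≤n
      total : ∑ energy < ∑ {p} (λ _ → suc (2 * y²))
      total = begin-strict
        ∑ energy                   ≤⟨ ∑-energy ⟩
        y² * y² + p * y²           ≤⟨ +-monoˡ-≤ (p * y²) (*-monoˡ-≤ y² Y²≤p) ⟩
        p * y² + p * y²            ≡⟨ lem p y² ⟩
        p * (2 * y²)               <⟨ *-monoʳ-< p {{>-nonZero p>0}} ≤-refl ⟩
        p * suc (2 * y²)           ≡⟨ ∑-const p (suc (2 * y²)) ⟨
        ∑ {p} (λ _ → suc (2 * y²)) ∎

    ∑ν : ∀ r → ∑ (ν r) ≡ # Y * # Y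
    ∑ν r = trans (∑-swap (λ z y → ⟦ Y y ⟧ * ⟦ Y (z ⊕ r ⊗ y) ⟧)) (trans
      (∑-cong λ y → trans (∑-*ˡ ⟦ Y y ⟧ _) (cong (⟦ Y y ⟧ *_) (∑-shift (r ⊗ y) (⟦_⟧ ∘ Y)))) (∑-*ʳ (# Y) _))

    -- In place of Cauchy-Schwarz, the linear bound `4 ν ≤ 4 + ν²`, which is `(ν − 2)² ≥ 0`, is
    -- summed over the support `D` of `ν`.
    energy-bound : ∀ r → energy r ≤ 2 * (# Y * # Y) → # Y * # Y ≤ 2 * # ((Y − (r ⊗_)) Y)
    energy-bound r low = *-cancelˡ-≤ 2 (+-cancelʳ-≤ (2 * y²) _ _ (begin
      2 * y² + 2 * y²                            ≡⟨ lem y² ⟩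
      4 * y²                                     ≡⟨ cong (4 *_) (∑ν r) ⟨
      4 * ∑ (ν r)                                ≡⟨ ∑-*ˡ 4 (ν r) ⟨
      ∑ (λ z → 4 * ν r z)                        ≤⟨ ∑-mono pointwise ⟩
      ∑ (λ z → 4 * ⟦ D z ⟧ + ν r z * ν r z)      ≡⟨ trans (∑-+ _ _) (cong (_+ energy r) (∑-*ˡ 4 (⟦_⟧ ∘ D))) ⟩
      4 * # D + energy r                         ≤⟨ +-monoʳ-≤ (4 * # D) low ⟩
      4 * # D + 2 * y²                           ≡⟨ cong (_+ 2 * y²) (*-assoc 2 2 (# D)) ⟩
      2 * (2 * # D) + 2 * y²                     ∎))
      where
      open ≤-Reasoning
      y² = # Y * # Y
      D : FinSet p
      D = (Y − (r ⊗_)) Y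
      lem : ∀ y → 2 * y + 2 * y ≡ 4 * y
      lem = solve-∀
      square : ∀ x → 4 * x ≤ 4 + x * x
      square 0 = z≤n
      square 1 = n≤1+n 4
      square (suc (suc x)) = ≤-trans (m≤m+n (4 * suc (suc x)) (x * x)) (≤-reflexive (expand x))
        where
        expand : ∀ x → 4 * suc (suc x) + x * x ≡ 4 + suc (suc x) * suc (suc x)
        expand = solve-∀
      pointwise : ∀ z → 4 * ν r z ≤ 4 * ⟦ D z ⟧ + ν r z * ν r z
      pointwise z with D z in eq
      ... | true  = square (ν r z)
      ... | false = ≤-trans (≤-reflexive (cong (4 *_) (∑-zero none))) z≤n
        where
        none : ∀ y → ⟦ Y y ⟧ * ⟦ Y (z ⊕ r ⊗ y) ⟧ ≡ 0
        none y with Y y in Yy | Y (z ⊕ r ⊗ y) in Yz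
        ... | false | _     = refl
        ... | true  | false = refl
        ... | true  | true  = ⊥-elim (true≢false (−-intro (r ⊗_) y z Yy Yz) eq)

    pivot : ∀ {y₀ y₁} → Y y₀ ≡ true → Y y₁ ≡ true → y₀ ≢ y₁ → # Y * # Y ≤ p →
      ∃ λ r → Ratio Y r × # Y * (# Y * # Y) ≤ 4 * (# ((Y − id) Y) * # ((Y − (r ⊗_)) Y))
    pivot {y₀} {y₁} Yy₀ Yy₁ y₀≢y₁ Y²≤p with any? (λ r → ratio? Y r ×-dec ¬? (ratio? Y (r ⊕ 𝟙)))
    ... | yes (r , ratio , ¬ratio) = r , ratio , injective-bound (∈⇒#>0 y₀ Yy₀) ¬ratio
    ... | no none with low-energy Y²≤p
    ...   | r , low = r , ratio , (begin
      -- The trivial `|Y| ≤ |Y − Y|` brings the case where every residue is a ratio into the same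
      -- cubic shape as the other case.
      # Y * (# Y * # Y)              ≤⟨ *-mono-≤ (#≤#− id y₀ Yy₀) (energy-bound r low) ⟩
      P * (2 * R)                    ≡⟨ lem P R ⟩
      2 * (P * R)                    ≤⟨ *-monoˡ-≤ (P * R) (m≤m+n 2 2) ⟩
      4 * (P * R)                    ∎)
      where
      open ≤-Reasoning
      P = # ((Y − id) Y)
      R = # ((Y − (r ⊗_)) Y)
      lem : ∀ P R → P * (2 * R) ≡ 2 * (P * R)
      lem = solve-∀
      base : Ratio Y 𝟘
      base = y₀ , y₀ , y₀ , y₁ , Yy₀ , Yy₀ , Yy₀ , Yy₁ , y₀≢y₁ ,
        trans (⊗-zeroˡ _) (sym (CommutativeRing.-‿inverseʳ commutativeRing y₀))
      step : ∀ x → Ratio Y x → Ratio Y (x ⊕ 𝟙)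
      step x rx = decidable-stable (ratio? Y (x ⊕ 𝟙)) λ ¬r → none (x , rx , ¬r)
      ratio : Ratio Y r
      ratio = generated (Ratio Y) base step r

-- Collecting the exponents

-- Eight uses of the bound for `ζ`, three of that for `ω`, three for `m²`, four for `m₂` and forty
-- of `k n ≲ q²`: 24 + 6 + 15 + 20 + 40 = 105. Forty is the power of `k` brought by the others, 16 +
-- 3 + 21.
monomial₁ : ∀ n → (n * (n * n)) ^ 8 * (n * n) ^ 3 * ((n * (n * (n * (n * n)))) ^ 3 * (n * (n * (n * (n * n)))) ^ 4) * n ^ 40 ≡ n ^ 105
monomial₁ n = solve 1 (λ n → (n :* (n :* n)) :^ 8 :* (n :* n) :^ 3 :* ((n :* (n :* (n :* (n :* n)))) :^ 3 :* (n :* (n :* (n :* (n :* n)))) :^ 4) :* n :^ 40 := n :^ 105) refl n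
  where open +-*-Solver

monomial₂ : ∀ c₁ c₂ c₃ k ζ ω m m₂ n →
  (c₁ * (k * k) * ζ) ^ 8 * (c₂ * k * ω) ^ 3 * ((c₃ * (k * (k * k)) * (m * m)) ^ 3 * (c₃ * (k * (k * k)) * m₂) ^ 4) * n ^ 40
  ≡ c₁ ^ 8 * c₂ ^ 3 * c₃ ^ 7 * (k * n) ^ 40 * (ζ * (ζ * ζ) * (ω * (ω * ω)) * (ζ * (m * m) * (ζ * (m * m₂)) ^ 4))
monomial₂ = solve 9 (λ c₁ c₂ c₃ k ζ ω m m₂ n →
  (c₁ :* (k :* k) :* ζ) :^ 8 :* (c₂ :* k :* ω) :^ 3 :* ((c₃ :* (k :* (k :* k)) :* (m :* m)) :^ 3 :* (c₃ :* (k :* (k :* k)) :* m₂) :^ 4) :* n :^ 40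
  := c₁ :^ 8 :* c₂ :^ 3 :* c₃ :^ 7 :* (k :* n) :^ 40 :* (ζ :* (ζ :* ζ) :* (ω :* (ω :* ω)) :* (ζ :* (m :* m) :* (ζ :* (m :* m₂)) :^ 4))) refl
  where open +-*-Solver

-- To be read with `y = |Y|`, `P = |Y − Y|`, `R = |Y − rY|`, `V = |T₀ + S₄|`, `w = |T₀|`, and with
-- `E₁`, `E₂` the path counts. The fourth power comes from `ratio-bound`, and 256 is `2⁶` from the
-- six halvings times 4 from the cubic bound.
product-bound : ∀ {y P R V w ζ ω E₁ E₂ d₁ d₂ q} →
  y * (y * y) ≤ 4 * (P * R) → R * (w * w * w) ≤ V * V * (V * V) → ζ ≤ 2 * y → ω ≤ 2 * w →
  P * E₁ ≤ d₁ * (q * q * (q * q)) → V * E₂ ≤ d₂ * (q * q * (q * (q * q))) →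
  ζ * (ζ * ζ) * (ω * (ω * ω)) * (E₁ * E₂ ^ 4) ≤ 256 * (d₁ * d₂ ^ 4) * q ^ 24
product-bound {y} {P} {R} {V} {w} {ζ} {ω} {E₁} {E₂} {d₁} {d₂} {q} h₁ h₂ hζ hω hP hV = begin
  ζ * (ζ * ζ) * (ω * (ω * ω)) * (E₁ * E₂ ^ 4)
    ≤⟨ *-monoˡ-≤ (E₁ * E₂ ^ 4) (*-mono-≤ (*-mono-≤ hζ (*-mono-≤ hζ hζ)) (*-mono-≤ hω (*-mono-≤ hω hω))) ⟩
  2 * y * (2 * y * (2 * y)) * (2 * w * (2 * w * (2 * w))) * (E₁ * E₂ ^ 4)
    ≡⟨ solve 4 (λ y w e f → con 2 :* y :* (con 2 :* y :* (con 2 :* y)) :* (con 2 :* w :* (con 2 :* w :* (con 2 :* w))) :* (e :* f)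
         := con 64 :* (y :* (y :* y)) :* (w :* w :* w) :* (e :* f)) refl y w E₁ (E₂ ^ 4) ⟩
  64 * (y * (y * y)) * (w * w * w) * (E₁ * E₂ ^ 4)
    ≤⟨ *-monoˡ-≤ (E₁ * E₂ ^ 4) (*-monoˡ-≤ (w * w * w) (*-monoʳ-≤ 64 h₁)) ⟩
  64 * (4 * (P * R)) * (w * w * w) * (E₁ * E₂ ^ 4)
    ≡⟨ solve 5 (λ P R w e f → con 64 :* (con 4 :* (P :* R)) :* w :* (e :* f) := con 256 :* (P :* (R :* w)) :* (e :* f)) refl P R (w * w * w) E₁ (E₂ ^ 4) ⟩
  256 * (P * (R * (w * w * w))) * (E₁ * E₂ ^ 4)
    ≤⟨ *-monoˡ-≤ (E₁ * E₂ ^ 4) (*-monoʳ-≤ 256 (*-monoʳ-≤ P h₂)) ⟩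
  256 * (P * (V * V * (V * V))) * (E₁ * E₂ ^ 4)
    ≡⟨ solve 4 (λ P V e f → con 256 :* (P :* (V :* V :* (V :* V))) :* (e :* f :^ 4) := con 256 :* (P :* e :* (V :* f) :^ 4)) refl P V E₁ E₂ ⟩
  256 * (P * E₁ * (V * E₂) ^ 4)
    ≤⟨ *-monoʳ-≤ 256 (*-mono-≤ hP (^-monoˡ-≤ 4 hV)) ⟩
  256 * (d₁ * (q * q * (q * q)) * (d₂ * (q * q * (q * (q * q)))) ^ 4)
    ≡⟨ solve 3 (λ d₁ d₂ q → con 256 :* (d₁ :* (q :* q :* (q :* q)) :* (d₂ :* (q :* q :* (q :* (q :* q)))) :^ 4)
         := con 256 :* (d₁ :* d₂ :^ 4) :* q :^ 24) refl d₁ d₂ q ⟩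
  256 * (d₁ * d₂ ^ 4) * q ^ 24 ∎
  where
  open ≤-Reasoning
  open +-*-Solver

power-bound : ∀ {c₁ c₂ c₃ c₄ d n q k ζ ω m m₂} →
  n * (n * n) ≤ c₁ * (k * k) * ζ → n * n ≤ c₂ * k * ω →
  n * (n * (n * (n * n))) ≤ c₃ * (k * (k * k)) * (m * m) → n * (n * (n * (n * n))) ≤ c₃ * (k * (k * k)) * m₂ →
  k * n ≤ c₄ * (q * q) →
  ζ * (ζ * ζ) * (ω * (ω * ω)) * (ζ * (m * m) * (ζ * (m * m₂)) ^ 4) ≤ d * q ^ 24 →
  n ^ 105 ≤ c₁ ^ 8 * c₂ ^ 3 * c₃ ^ 7 * c₄ ^ 40 * d * q ^ 104
power-bound {c₁} {c₂} {c₃} {c₄} {d} {n} {q} {k} {ζ} {ω} {m} {m₂} h₁ h₂ h₃ h₄ h₅ h₆ = begin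
  n ^ 105
    ≡⟨ monomial₁ n ⟨
  (n * (n * n)) ^ 8 * (n * n) ^ 3 * ((n * (n * (n * (n * n)))) ^ 3 * (n * (n * (n * (n * n)))) ^ 4) * n ^ 40
    ≤⟨ *-monoˡ-≤ (n ^ 40) (*-mono-≤ (*-mono-≤ (^-monoˡ-≤ 8 h₁) (^-monoˡ-≤ 3 h₂)) (*-mono-≤ (^-monoˡ-≤ 3 h₃) (^-monoˡ-≤ 4 h₄))) ⟩
  (c₁ * (k * k) * ζ) ^ 8 * (c₂ * k * ω) ^ 3 * ((c₃ * (k * (k * k)) * (m * m)) ^ 3 * (c₃ * (k * (k * k)) * m₂) ^ 4) * n ^ 40
    ≡⟨ monomial₂ c₁ c₂ c₃ k ζ ω m m₂ n ⟩
  C * (k * n) ^ 40 * (ζ * (ζ * ζ) * (ω * (ω * ω)) * (ζ * (m * m) * (ζ * (m * m₂)) ^ 4))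
    ≤⟨ *-mono-≤ (*-monoʳ-≤ C (^-monoˡ-≤ 40 h₅)) h₆ ⟩
  C * (c₄ * (q * q)) ^ 40 * (d * q ^ 24)
    ≡⟨ solve 4 (λ C c₄ d q → C :* (c₄ :* (q :* q)) :^ 40 :* (d :* q :^ 24) := C :* c₄ :^ 40 :* d :* q :^ 104) refl C c₄ d q ⟩
  C * c₄ ^ 40 * d * q ^ 104 ∎
  where
  open ≤-Reasoning
  open +-*-Solver
  C = c₁ ^ 8 * c₂ ^ 3 * c₃ ^ 7

-- For the case `|Y| ≤ 1`, in which no ratio can be formed. Then `n³ ≲ k²`, so `n⁵ ≲ (k n)² ≲ q⁴`,
-- and `n¹⁰⁰ ≤ q¹⁰⁰` fills up the exponents.
small-bound : ∀ {c₁ c₄ n q k ζ} → n * (n * n) ≤ c₁ * (k * k) * ζ → ζ ≤ 2 → k * n ≤ c₄ * (q * q) → n ≤ q →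
  n ^ 105 ≤ c₁ * (c₄ * c₄) * 2 * q ^ 104
small-bound {c₁} {c₄} {n} {q} {k} {ζ} h₁ h₂ h₃ n≤q = begin
  n ^ 105
    ≡⟨ solve 1 (λ n → n :^ 105 := n :* (n :* n) :* (n :* n) :* n :^ 100) refl n ⟩
  n * (n * n) * (n * n) * n ^ 100
    ≤⟨ *-mono-≤ (*-monoˡ-≤ (n * n) (≤-trans h₁ (*-monoʳ-≤ (c₁ * (k * k)) h₂))) (^-monoˡ-≤ 100 n≤q) ⟩
  c₁ * (k * k) * 2 * (n * n) * q ^ 100
    ≡⟨ solve 4 (λ c₁ k n x → c₁ :* (k :* k) :* con 2 :* (n :* n) :* x := c₁ :* (k :* n :* (k :* n)) :* con 2 :* x) refl c₁ k n (q ^ 100) ⟩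
  c₁ * (k * n * (k * n)) * 2 * q ^ 100
    ≤⟨ *-monoˡ-≤ (q ^ 100) (*-monoˡ-≤ 2 (*-monoʳ-≤ c₁ (*-mono-≤ h₃ h₃))) ⟩
  c₁ * (c₄ * (q * q) * (c₄ * (q * q))) * 2 * q ^ 100
    ≡⟨ solve 3 (λ c₁ c₄ q → c₁ :* (c₄ :* (q :* q) :* (c₄ :* (q :* q))) :* con 2 :* q :^ 100 := c₁ :* (c₄ :* c₄) :* con 2 :* q :^ 104) refl c₁ c₄ q ⟩
  c₁ * (c₄ * c₄) * 2 * q ^ 104 ∎
  where
  open ≤-Reasoning
  open +-*-Solver

least : ∀ {P : ℕ → Set} → (∀ i → Dec (P i)) → ∀ N → P N → ∃ λ m → P m × (∀ i → i < m → ¬ P i)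
least P? zero    PN = 0 , PN , λ i ()
least {P} P? (suc N) PN with P? 0
... | yes P0 = 0 , P0 , λ i ()
... | no ¬P0 with least {P ∘ suc} (P? ∘ suc) N PN
...   | m , Pm , min = suc m , Pm , λ { zero _ → ¬P0 ; (suc i) (s≤s i<m) → min i i<m }

two-elements : ∀ {p} {Y : FinSet p} → 1 < # Y → ∃ λ y → ∃ λ y′ → Y y ≡ true × Y y′ ≡ true × y ≢ y′
two-elements {Y = Y} Y>1 with #-nonempty {S = Y} (<⇒≤ Y>1)
... | y , Yy with any? (λ y′ → (Y y′ Boolₚ.≟ true) ×-dec ¬? (y ≟ᶠ y′))
...   | yes (y′ , Yy′ , y≢y′) = y , y′ , Yy , Yy′ , y≢y′
...   | no none = ⊥-elim (<⇒≱ Y>1 (∑≤1 Y λ i j Yi Yj → trans (sym (same i Yi)) (same j Yj)))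
  where
  same : ∀ i → Y i ≡ true → y ≡ i
  same i Yi with y ≟ᶠ i
  ... | yes eq = eq
  ... | no ≢   = ⊥-elim (none (i , Yi , ≢))

-- 16 and 2 come from the sizes of `Z` and `W`, `256 * 128` from the thresholds at `e = 128`, and
-- `2 ^ 40` from `k n ≤ 2 q²`. In the last factor of `C₁`, 2 and 8 belong to the bounds for `Y − Y`
-- and `T₀ + S₄`.
C₁ C₂ : ℕ
C₁ = 16 ^ 8 * 2 ^ 3 * (256 * 128) ^ 7 * 2 ^ 40 * (256 * (2 * 8 ^ 4))
C₂ = 16 * (2 * 2) * 2

abstract
  constant : ℕ
  constant = C₁ + C₂

  C₁≤constant : C₁ ≤ constant
  C₁≤constant = m≤m+n C₁ C₂

  C₂≤constant : C₂ ≤ constant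
  C₂≤constant = m≤n+m C₂ C₁

-- Assembling the bounds for a set in a finite field

module Main {p : ℕ} (𝔽 : FiniteField p) (A Q : FinSet p)
            (A∌0 : ∀ x → A x ≡ true → x ≢ FiniteField.𝟘 𝔽)
            (Q-intro : ∀ x a b → A a ≡ true → A b ≡ true →
              FiniteField._⊗_ 𝔽 x b ≡ FiniteField._⊕_ 𝔽 a (FiniteField.𝟙 𝔽) → Q x ≡ true) where
  open FieldProperties 𝔽
  open 𝔽-Solver using (solve; _:+_; _:*_; :-_; _:=_)
  open Selection 𝔽 A A∌0
  open Paths 𝔽 A Q A∌0 Q-intro

  n≤q : n ≤ q
  n≤q with # A in eq
  ... | zero  = z≤n
  ... | suc _ = let b , Ab = #-nonempty {S = A} (subst (0 <_) (sym eq) (s≤s z≤n)) in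
    ≤-trans (≤-reflexive (sym eq)) (bound b Ab)
    where
    bound : ∀ b → A b ≡ true → # A ≤ q
    bound b Ab = begin
      # A                             ≤⟨ #-mono {T = λ x → Q ((x ⊕ 𝟙) ⊘ b)} (λ x Ax → Q-intro _ x b Ax Ab (⊘-⊗ (x ⊕ 𝟙) b b≢0)) ⟩
      # (λ x → Q ((x ⊕ 𝟙) ⊘ b))       ≡⟨ ∑-shift 𝟙 (λ x → ⟦ Q (x ⊘ b) ⟧) ⟩
      # (λ x → Q (x ⊘ b))             ≡⟨ ∑-unscale b b≢0 (⟦_⟧ ∘ Q) ⟩
      q                               ∎
      where
      open ≤-Reasoning
      b≢0 = A∌0 b Ab

  -- Translation by `b` is division by `b`, so `X · D` is the quotient set `X / D`.
  module Multiplicative = Action {p} (λ b z → z ⊗ b) (λ b z → z ⊘ b)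

  -- 0 is removed because the bound for `k` below divides a fixed element of this set by all of
  -- `AA`.
  A+1 : FinSet p
  A+1 x = A (x ⊝ 𝟙) ∧ not (does (x ≟ᶠ 𝟘))

  n≤1+#A+1 : n ≤ # A+1 + 1
  n≤1+#A+1 = begin
    n                                                    ≡⟨ ∑-shift (⊖ 𝟙) α ⟨
    ∑ (λ x → ⟦ A (x ⊝ 𝟙) ⟧)                              ≤⟨ ∑-mono (λ x → cover (A (x ⊝ 𝟙)) (does (x ≟ᶠ 𝟘))) ⟩
    ∑ (λ x → ⟦ A+1 x ⟧ + ⟦ does (x ≟ᶠ 𝟘) ⟧)              ≡⟨ ∑-+ _ _ ⟩
    # A+1 + # (λ x → does (x ≟ᶠ 𝟘))                      ≤⟨ +-monoʳ-≤ (# A+1) (∑≤1 (λ x → does (x ≟ᶠ 𝟘)) unique) ⟩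
    # A+1 + 1                                            ∎
    where
    open ≤-Reasoning
    cover : ∀ b c → ⟦ b ⟧ ≤ ⟦ b ∧ not c ⟧ + ⟦ c ⟧
    cover false _     = z≤n
    cover true  true  = ≤-refl
    cover true  false = ≤-refl
    unique : ∀ i j → does (i ≟ᶠ 𝟘) ≡ true → does (j ≟ᶠ 𝟘) ≡ true → i ≡ j
    unique i j h h′ with i ≟ᶠ 𝟘 | j ≟ᶠ 𝟘
    ... | yes e | yes e′ = trans e (sym e′)

  A+1∌0 : ∀ x → A+1 x ≡ true → x ≢ 𝟘
  A+1∌0 x h with x ≟ᶠ 𝟘
  ... | no x≢0 = x≢0
  ... | yes _  = ⊥-elim (true≢false (∧-snd {A (x ⊝ 𝟙)} h) refl)

  -- For `τ ∈ T` the set `(T / A) / A` contains `τ / (x y)` for all `x , y ∈ A`, so it has at least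
  -- `k` elements. Plünnecke bounds it by `|T / A|² / |T|`, and the ratio `|T / A| / |T|` by
  -- `q / |A+1|`.
  k#A+1≤q² : 0 < # A+1 → k * # A+1 ≤ q * q
  k#A+1≤q² B>0 =
    let T , T⊆ , T>0 , ratio , pet = M.plünnecke comm A A+1 B>0
    in arithmetic k (# T) (# A+1) (# (T M.· A)) (# (T M.· A M.· A)) (# (A+1 M.· A)) q T>0 B>0
         (#-mono T⊆) (k≤ T T⊆ T>0) (pet A invertible) ratio (#-mono {T = Q} A+1·A⊆Q)
    where
    module M = Multiplicative
    comm : ∀ b c z → z ⊗ c ⊗ b ≡ z ⊗ b ⊗ c
    comm = solve 3 (λ b c z → z :* c :* b := z :* b :* c) refl
    invertible : M.Invertible A
    invertible b Ab = (λ z → ⊗-⊘ z b (A∌0 b Ab)) , (λ z → ⊘-⊗ z b (A∌0 b Ab))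
    A+1·A⊆Q : (A+1 M.· A) ⊆ Q
    A+1·A⊆Q z h = let b , Ab , q = M.·-elim z h in
      Q-intro z (z ⊗ b ⊝ 𝟙) b (∧-fst q) Ab (sym (⊝-⊕ (z ⊗ b) 𝟙))
    k≤ : ∀ T → T ⊆ A+1 → 0 < # T → k ≤ # (T M.· A M.· A)
    k≤ T T⊆ T>0 = begin
      k                                      ≤⟨ #-mono {T = λ x → (T M.· A M.· A) (τ ⊘ x)} member ⟩
      # (λ x → (T M.· A M.· A) (τ ⊘ x))      ≡⟨ ∑-quotient τ (A+1∌0 τ (T⊆ τ Tτ)) (⟦_⟧ ∘ (T M.· A M.· A)) ⟩
      # (T M.· A M.· A)                      ∎
      where
      open ≤-Reasoning
      τ = proj₁ (#-nonempty {S = T} T>0)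
      Tτ = proj₂ (#-nonempty {S = T} T>0)
      member : ∀ x → AA x ≡ true → (T M.· A M.· A) (τ ⊘ x) ≡ true
      member x AAx =
        let y , pos = ∑-positive (λ y → α y * α (x ⊘ y)) (≤-true AAx)
            Ay = ⟦⟧-true (A y) pos
            Ax/y = ⟦⟧-true (A (x ⊘ y)) {α y} (subst (0 <_) (*-comm (α y) _) pos)
        in M.·-intro y _ Ay (M.·-intro (x ⊘ y) _ Ax/y (trans (cong T
             (trans (⊗-assoc (τ ⊘ x) y _) (trans (cong (τ ⊘ x ⊗_) (trans (⊗-comm y _) (⊘-⊗ x y (A∌0 y Ay))))
               (⊘-⊗ τ x (AA∌0 x AAx))))) Tτ))
    arithmetic : ∀ k t b V U V₀ q → 0 < t → 0 < b → t ≤ b → k ≤ U → U * t ≤ V * V → V * b ≤ V₀ * t → V₀ ≤ q → k * b ≤ q * q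
    arithmetic k t b V U V₀ q t>0 b>0 t≤b k≤U h₁ h₂ V₀≤q =
      *-cancelʳ-≤ _ _ b {{>-nonZero b>0}} (*-cancelʳ-≤ _ _ t {{>-nonZero t>0}} (begin
        k * b * b * t              ≤⟨ *-monoˡ-≤ t (*-monoˡ-≤ b (*-monoˡ-≤ b k≤U)) ⟩
        U * b * b * t              ≡⟨ l₁ U b t ⟩
        U * t * (b * b)            ≤⟨ *-monoˡ-≤ (b * b) h₁ ⟩
        V * V * (b * b)            ≡⟨ l₂ V b ⟩
        V * b * (V * b)            ≤⟨ *-mono-≤ h₂′ h₂′ ⟩
        q * t * (q * t)            ≡⟨ l₃ q t ⟩
        q * q * t * t              ≤⟨ *-monoˡ-≤ t (*-monoʳ-≤ (q * q) t≤b) ⟩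
        q * q * b * t              ∎))
      where
      open ≤-Reasoning
      h₂′ : V * b ≤ q * t
      h₂′ = ≤-trans h₂ (*-monoˡ-≤ t V₀≤q)
      l₁ : ∀ U b t → U * b * b * t ≡ U * t * (b * b)
      l₁ = solve-∀
      l₂ : ∀ V b → V * V * (b * b) ≡ V * b * (V * b)
      l₂ = solve-∀
      l₃ : ∀ q t → q * t * (q * t) ≡ q * q * t * t
      l₃ = solve-∀

  -- Deleting 0 costs at most one element; as `n > 1`, the set stays non-empty and keeps at least
  -- `n/2` elements.
  kn≤2q² : 1 < n → k * n ≤ 2 * (q * q)
  kn≤2q² n>1 = begin
    k * n              ≤⟨ *-monoʳ-≤ k n≤2b ⟩
    k * (2 * b)        ≡⟨ lem k b ⟩
    2 * (k * b)        ≤⟨ *-monoʳ-≤ 2 (k#A+1≤q² b>0) ⟩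
    2 * (q * q)        ∎
    where
    open ≤-Reasoning
    b = # A+1
    b>0 : 0 < b
    b>0 = +-cancelʳ-≤ 1 1 b (≤-trans n>1 n≤1+#A+1)
    n≤2b : n ≤ 2 * b
    n≤2b = ≤-trans n≤1+#A+1 (+-monoʳ-≤ b (≤-trans b>0 (m≤m+n b 0)))
    lem : ∀ k b → k * (2 * b) ≡ 2 * (k * b)
    lem = solve-∀

  k>0 : 0 < n → 0 < k
  k>0 n>0 =
    let s , ws = ∑-positive w (subst (0 <_) (sym ∑w≡n²) (*-mono-≤ n>0 n>0))
    in ∈⇒#>0 s (true-≤ ws)

  X₅ : ℕ
  X₅ = n * (n * (n * (n * n)))

  -- Taking m and m₂ minimal makes both directions exact, without rounding.
  record Thresholded (c : ℕ) : Set where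
    field
      m m₂   : ℕ
      m-big  : X₅ ≤ c * (m * m)
      m₂-big : X₅ ≤ c * m₂
      m-min  : ∀ i → i < m  → c * (i * i) ≤ X₅
      m₂-min : ∀ i → i < m₂ → c * i ≤ X₅

  thresholds : ∀ c → 0 < c → Thresholded c
  thresholds c c>0 =
    let m , big , min = least (λ i → X₅ ≤? c * (i * i)) X₅ start
        m₂ , big₂ , min₂ = least (λ i → X₅ ≤? c * i) X₅ X₅≤cX₅
    in record { m = m ; m₂ = m₂ ; m-big = big ; m₂-big = big₂
              ; m-min = λ i i<m → ≰⇒≥ (min i i<m) ; m₂-min = λ i i<m → ≰⇒≥ (min₂ i i<m) }
    where
    X₅≤cX₅ : X₅ ≤ c * X₅
    X₅≤cX₅ = m≤n*m X₅ c {{>-nonZero c>0}}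
    square : ∀ x → x ≤ x * x
    square zero    = z≤n
    square (suc x) = m≤m*n (suc x) (suc x)
    start : X₅ ≤ c * (X₅ * X₅)
    start = ≤-trans X₅≤cX₅ (*-monoʳ-≤ c (square X₅))

  module Bounds (m m₂ : ℕ) (t τ : F) (sel : Thresholds.Selected m m₂ 128 t τ) where
    open Refinement m m₂ t τ sel
    open Additive 𝔽

    difference-bound : # ((Y − id) Y) * (ζ * (m * m)) ≤ 2 * (q * q * (q * q))
    difference-bound = begin
      # ((Y − id) Y) * (ζ * (m * m))             ≡⟨ ∑-*ʳ (ζ * (m * m)) _ ⟨
      ∑ (λ z → ⟦ (Y − id) Y z ⟧ * (ζ * (m * m))) ≤⟨ (∑-mono λ z → ⟦⟧*-≤ ((Y − id) Y z) (popular z)) ⟩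
      ∑ (λ z → 2 * ρ₄ (z ⊘ t))                   ≡⟨ trans (∑-*ˡ 2 _) (cong (2 *_) (trans (∑-unscale t t≢0 ρ₄) ∑ρ₄)) ⟩
      2 * (q * q * (q * q))                      ∎
      where
      open ≤-Reasoning
      popular : ∀ z → (Y − id) Y z ≡ true → ζ * (m * m) ≤ 2 * ρ₄ (z ⊘ t)
      popular z h with −-elim id z h
      ... | y , Yy , Yz = subst (λ x → ζ * (m * m) ≤ 2 * ρ₄ x)
        (solve 3 (λ z y i → (z :+ y) :* i :+ (:- (y :* i)) := z :* i) refl z y (t ⁻¹))
        (difference-popular Yz Yy)

    module _ {a b c d} (Ya : Y a ≡ true) (Yb : Y b ≡ true) (Yc : Y c ≡ true) (Yd : Y d ≡ true) where
      -- `T₀` is `t / W₄`. An element `t/v + x y` of `T₀ + S₄`, with `x` one of `a , b , c , d`,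
      -- becomes `x y/t + 1/v` on division by `t`, which is the form treated by `sum-popular`.
      T₀ S₄ : FinSet p
      T₀ x = W₄ a b c d (t ⊘ x)
      S₄ x = image (a ⊗_) Y x ∨ (image (b ⊗_) Y x ∨ (image (c ⊗_) Y x ∨ image (d ⊗_) Y x))

      #T₀ : # T₀ ≡ # (W₄ a b c d)
      #T₀ = ∑-quotient t t≢0 (⟦_⟧ ∘ W₄ a b c d)

      S₄-contains : ∀ y → Y y ≡ true → S₄ (a ⊗ y) ≡ true × S₄ (b ⊗ y) ≡ true × S₄ (c ⊗ y) ≡ true × S₄ (d ⊗ y) ≡ true
      S₄-contains y Yy =
        ∨-introˡ (image-intro (a ⊗_) y Yy) ,
        ∨-introʳ (image (a ⊗_) Y (b ⊗ y)) (∨-introˡ (image-intro (b ⊗_) y Yy)) ,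
        ∨-introʳ (image (a ⊗_) Y (c ⊗ y)) (∨-introʳ (image (b ⊗_) Y (c ⊗ y)) (∨-introˡ (image-intro (c ⊗_) y Yy))) ,
        ∨-introʳ (image (a ⊗_) Y (d ⊗ y)) (∨-introʳ (image (b ⊗_) Y (d ⊗ y)) (∨-introʳ (image (c ⊗_) Y (d ⊗ y)) (image-intro (d ⊗_) y Yy)))
        where
        ∨-introˡ : ∀ {x y} → x ≡ true → x ∨ y ≡ true
        ∨-introˡ refl = refl
        ∨-introʳ : ∀ x {y} → y ≡ true → x ∨ y ≡ true
        ∨-introʳ x refl = Boolₚ.∨-zeroʳ x

      -- At least one of the four functions `ρ₅` is large at `σ / t`; adding all four avoids a
      -- choice and gives 8 = 2 · 4.
      sum-bound : # (T₀ · S₄) * (ζ * (m * m₂)) ≤ 8 * (q * q * (q * (q * q)))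
      sum-bound = begin
        # (T₀ · S₄) * (ζ * (m * m₂))               ≡⟨ ∑-*ʳ (ζ * (m * m₂)) _ ⟨
        ∑ (λ σ → ⟦ (T₀ · S₄) σ ⟧ * (ζ * (m * m₂))) ≤⟨ (∑-mono λ σ → ⟦⟧*-≤ ((T₀ · S₄) σ) (popular σ)) ⟩
        ∑ (λ σ → 2 * (ρ₅ a (σ ⊘ t) + (ρ₅ b (σ ⊘ t) + (ρ₅ c (σ ⊘ t) + ρ₅ d (σ ⊘ t)))))
          ≡⟨ trans (∑-unscale t t≢0 λ σ → 2 * (ρ₅ a σ + (ρ₅ b σ + (ρ₅ c σ + ρ₅ d σ))))
             (trans (∑-*ˡ 2 _) (cong (2 *_) (trans (∑-+ (ρ₅ a) _) (cong₂ _+_ (∑ρ₅ a) (trans (∑-+ (ρ₅ b) _) (cong₂ _+_ (∑ρ₅ b) (trans (∑-+ (ρ₅ c) _) (cong₂ _+_ (∑ρ₅ c) (∑ρ₅ d))))))))) ⟩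
        2 * (q⁵ + (q⁵ + (q⁵ + q⁵)))                ≡⟨ lem q⁵ ⟩
        8 * q⁵                                     ∎
        where
        open ≤-Reasoning
        q⁵ = q * q * (q * (q * q))
        lem : ∀ x → 2 * (x + (x + (x + x))) ≡ 8 * x
        lem = solve-∀
        module _ (σ s : F) (Tσ : T₀ (σ ⊝ s) ≡ true) where
          v : F
          v = t ⊘ (σ ⊝ s)
          Wv : W₀ v ≡ true
          Wv = ∧-fst Tσ
          links = ∧-snd {W₀ v} Tσ
          linked-a = ∧-fst {linked a v} links
          links-b = ∧-snd {linked a v} links
          linked-b = ∧-fst {linked b v} links-b
          links-c = ∧-snd {linked b v} links-b
          linked-c = ∧-fst {linked c v} links-c
          linked-d = ∧-snd {linked c v} links-c
          v⁻¹-eq : ∀ x y → s ≡ x ⊗ y → x ⊗ (y ⊘ t) ⊕ v ⁻¹ ≡ σ ⊘ t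
          v⁻¹-eq x y refl = trans (cong (λ u → x ⊗ (y ⊘ t) ⊕ u) v⁻¹≡)
            (solve 4 (λ σ x y i → x :* (y :* i) :+ (σ :+ (:- (x :* y))) :* i := σ :* i) refl σ x y (t ⁻¹))
            where
            v⁻¹≡ : v ⁻¹ ≡ (σ ⊝ x ⊗ y) ⊘ t
            v⁻¹≡ = ⊗-cancelʳ t t≢0 (trans (trans (⊗-comm (v ⁻¹) t) (⊘-⊘ t (σ ⊝ x ⊗ y) t≢0)) (sym (⊘-⊗ (σ ⊝ x ⊗ y) t t≢0)))
          from-image : ∀ x → linked x v ≡ true → image (x ⊗_) Y s ≡ true → ζ * (m * m₂) ≤ 2 * ρ₅ x (σ ⊘ t)
          from-image x link h with image-elim (x ⊗_) s h
          ... | y , Yy , eq = subst (λ u → ζ * (m * m₂) ≤ 2 * ρ₅ x u) (v⁻¹-eq x y eq) (sum-popular Yy Wv link)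
          popular′ : S₄ s ≡ true → ζ * (m * m₂) ≤ 2 * (ρ₅ a (σ ⊘ t) + (ρ₅ b (σ ⊘ t) + (ρ₅ c (σ ⊘ t) + ρ₅ d (σ ⊘ t))))
          popular′ Ss with image (a ⊗_) Y s in ea
          ... | true = ≤-trans (from-image a linked-a ea) (*-monoʳ-≤ 2 (m≤m+n (ρ₅ a (σ ⊘ t)) _))
          ... | false with image (b ⊗_) Y s in eb
          ...   | true = ≤-trans (from-image b linked-b eb) (*-monoʳ-≤ 2 (≤-trans (m≤m+n (ρ₅ b (σ ⊘ t)) _) (m≤n+m _ (ρ₅ a (σ ⊘ t)))))
          ...   | false with image (c ⊗_) Y s in ec
          ...     | true = ≤-trans (from-image c linked-c ec) (*-monoʳ-≤ 2 (≤-trans (m≤m+n (ρ₅ c (σ ⊘ t)) _) (≤-trans (m≤n+m _ (ρ₅ b (σ ⊘ t))) (m≤n+m _ (ρ₅ a (σ ⊘ t))))))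
          ...     | false = ≤-trans (from-image d linked-d Ss) (*-monoʳ-≤ 2 (≤-trans (m≤n+m _ (ρ₅ c (σ ⊘ t))) (≤-trans (m≤n+m _ (ρ₅ b (σ ⊘ t))) (m≤n+m _ (ρ₅ a (σ ⊘ t))))))
        popular : ∀ σ → (T₀ · S₄) σ ≡ true → ζ * (m * m₂) ≤ 2 * (ρ₅ a (σ ⊘ t) + (ρ₅ b (σ ⊘ t) + (ρ₅ c (σ ⊘ t) + ρ₅ d (σ ⊘ t))))
        popular σ h with ·-elim σ h
        ... | s , Ss , Tσ = popular′ σ s Tσ Ss

    large : n * n ≤ p → 1 < n → 1 < # Y → X₅ ≤ 256 * 128 * (k * (k * k)) * (m * m) →
            X₅ ≤ 256 * 128 * (k * (k * k)) * m₂ → n ^ 105 ≤ constant * q ^ 104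
    large n²≤p n>1 Y>1 m-big m₂-big =
      let y , y′ , Yy , Yy′ , y≢y′ = two-elements {Y = Y} Y>1
          r , (a , b , c , d , Ya , Yb , Yc , Yd , c≢d , r-eq) , cubic = pivot Yy Yy′ y≢y′ #Y²≤p
      in ≤-trans
        (power-bound {16} {2} {256 * 128} {2} {256 * (2 * 8 ^ 4)} {n} {q} {k} {ζ} {ω} {m} {m₂} Z-large W-large m-big m₂-big (kn≤2q² n>1)
          (product-bound {# Y} {# ((Y − id) Y)} {# ((Y − (r ⊗_)) Y)} {# (T₀ Ya Yb Yc Yd · S₄ Ya Yb Yc Yd)} {# (T₀ Ya Yb Yc Yd)}
            {ζ} {ω} {ζ * (m * m)} {ζ * (m * m₂)} {2} {8} {q} cubic
            (ratio-bound (T₀>0 Ya Yb Yc Yd) c≢d r-eq (S₄-contains Ya Yb Yc Yd))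
            Y-large (ω≤2T₀ Ya Yb Yc Yd) difference-bound (sum-bound Ya Yb Yc Yd)))
        (*-monoˡ-≤ (q ^ 104) C₁≤constant)
      where
      #Y≤n : # Y ≤ n
      #Y≤n = #-mono {T = A} λ a → Y⇒A
      #Y²≤p : # Y * # Y ≤ p
      #Y²≤p = ≤-trans (*-mono-≤ #Y≤n #Y≤n) n²≤p
      ω≤2T₀ : ∀ {a b c d} (Ya : Y a ≡ true) (Yb : Y b ≡ true) (Yc : Y c ≡ true) (Yd : Y d ≡ true) →
              ω ≤ 2 * # (T₀ Ya Yb Yc Yd)
      ω≤2T₀ {a} {b} {c} {d} Ya Yb Yc Yd = subst (λ x → ω ≤ 2 * x) (sym (#T₀ Ya Yb Yc Yd)) (W₄-large a b c d Ya Yb Yc Yd)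
      T₀>0 : ∀ {a b c d} (Ya : Y a ≡ true) (Yb : Y b ≡ true) (Yc : Y c ≡ true) (Yd : Y d ≡ true) →
             0 < # (T₀ Ya Yb Yc Yd)
      T₀>0 Ya Yb Yc Yd = n≢0⇒n>0 λ eq → <⇒≱ W>0 (≤-trans (ω≤2T₀ Ya Yb Yc Yd) (≤-reflexive (cong (2 *_) eq)))

    small : 1 < n → # Y ≤ 1 → n ^ 105 ≤ constant * q ^ 104
    small n>1 Y≤1 = ≤-trans
      (small-bound {16} {2} {n} {q} {k} {ζ} Z-large (≤-trans Y-large (*-monoʳ-≤ 2 Y≤1)) (kn≤2q² n>1) n≤q)
      (*-monoˡ-≤ (q ^ 104) C₂≤constant)

  growth : n * n ≤ p → 1 < n → n ^ 105 ≤ constant * q ^ 104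
  growth n²≤p n>1 =
    let t , τ , sel = Thresholds.select m m₂ 128 n>0 (k>0 n>0) m-min m₂-min
        open Bounds m m₂ t τ sel
        open Refinement m m₂ t τ sel using (Y)
    in case 2 ≤? # Y of λ where
         (yes Y>1) → large n²≤p n>1 Y>1 m-big m₂-big
         (no Y≯1)  → small n>1 (s≤s⁻¹ (≰⇒> Y≯1))
    where
    n>0 : 0 < n
    n>0 = <⇒≤ n>1
    instance
      k≢0 : NonZero k
      k≢0 = >-nonZero (k>0 n>0)
    c>0 : 0 < 256 * 128 * (k * (k * k))
    c>0 = >-nonZero⁻¹ _ {{m*n≢0 (256 * 128) (k * (k * k)) {{_}} {{m*n≢0 k (k * k) {{k≢0}} {{m*n≢0 k k}}}}}}
    open Thresholded (thresholds (256 * 128 * (k * (k * k))) c>0)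

-- The prime field

module PrimeField (p : ℕ) .{{_ : NonZero p}} (p-prime : Prime p) where

  mod : ℕ → Fin p
  mod m = fromℕ< (m%n<n m p)

  mod-cong : ∀ {m n} → m % p ≡ n % p → mod m ≡ mod n
  mod-cong {m} {n} eq = fromℕ<-cong (m % p) (n % p) eq (m%n<n m p) (m%n<n n p)

  toℕ-mod : ∀ m → toℕ (mod m) ≡ m % p
  toℕ-mod m = toℕ-fromℕ< (m%n<n m p)

  mod-toℕ : ∀ x → mod (toℕ x) ≡ x
  mod-toℕ x = toℕ-injective (trans (toℕ-mod (toℕ x)) (m<n⇒m%n≡m (toℕ<n x)))

  infixl 6 _+ₚ_
  _+ₚ_ : Fin p → Fin p → Fin p
  x +ₚ y = mod (toℕ x + toℕ y)

  -ₚ_ : Fin p → Fin p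
  -ₚ x = mod (p ∸ toℕ x)

  mod-+ : ∀ m n → mod m +ₚ mod n ≡ mod (m + n)
  mod-+ m n = mod-cong (trans (cong₂ (λ a b → (a + b) % p) (toℕ-mod m) (toℕ-mod n)) (sym (%-distribˡ-+ m n p)))

  mod-* : ∀ m n → mod m ·ₚ mod n ≡ mod (m * n)
  mod-* m n = mod-cong (trans (cong₂ (λ a b → (a * b) % p) (toℕ-mod m) (toℕ-mod n)) (sym (%-distribˡ-* m n p)))

  mod-+ˡ : ∀ m y → mod m +ₚ y ≡ mod (m + toℕ y)
  mod-+ˡ m y = trans (cong (mod m +ₚ_) (sym (mod-toℕ y))) (mod-+ m (toℕ y))

  mod-*ˡ : ∀ m y → mod m ·ₚ y ≡ mod (m * toℕ y)
  mod-*ˡ m y = trans (cong (mod m ·ₚ_) (sym (mod-toℕ y))) (mod-* m (toℕ y))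

  +ₚ-comm : ∀ x y → x +ₚ y ≡ y +ₚ x
  +ₚ-comm x y = cong mod (+-comm (toℕ x) (toℕ y))

  ·ₚ-comm : ∀ (x y : Fin p) → x ·ₚ y ≡ y ·ₚ x
  ·ₚ-comm x y = cong mod (*-comm (toℕ x) (toℕ y))

  +ₚ-assoc : ∀ x y z → (x +ₚ y) +ₚ z ≡ x +ₚ (y +ₚ z)
  +ₚ-assoc x y z = trans (mod-+ˡ _ z) (trans (cong mod (+-assoc (toℕ x) (toℕ y) (toℕ z)))
    (sym (trans (+ₚ-comm x _) (trans (mod-+ˡ _ x) (cong mod (+-comm _ (toℕ x)))))))

  ·ₚ-assoc : ∀ (x y z : Fin p) → (x ·ₚ y) ·ₚ z ≡ x ·ₚ (y ·ₚ z)
  ·ₚ-assoc x y z = trans (mod-*ˡ _ z) (trans (cong mod (*-assoc (toℕ x) (toℕ y) (toℕ z)))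
    (sym (trans (·ₚ-comm x _) (trans (mod-*ˡ _ x) (cong mod (*-comm _ (toℕ x)))))))

  0ₚ 1ₚ : Fin p
  0ₚ = mod 0
  1ₚ = mod 1

  +ₚ-identityˡ : ∀ x → 0ₚ +ₚ x ≡ x
  +ₚ-identityˡ x = trans (mod-+ˡ 0 x) (mod-toℕ x)

  ·ₚ-identityˡ : ∀ x → 1ₚ ·ₚ x ≡ x
  ·ₚ-identityˡ x = trans (mod-*ˡ 1 x) (trans (cong mod (*-identityˡ (toℕ x))) (mod-toℕ x))

  -ₚ-inverseˡ : ∀ x → (-ₚ x) +ₚ x ≡ 0ₚ
  -ₚ-inverseˡ x = trans (mod-+ˡ _ x) (mod-cong
    (trans (cong (_% p) (m∸n+n≡m (<⇒≤ (toℕ<n x)))) (trans (n%n≡0 p) (sym (m*n%n≡0 0 p)))))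

  ·ₚ-distribʳ : ∀ x y z → (y +ₚ z) ·ₚ x ≡ (y ·ₚ x) +ₚ (z ·ₚ x)
  ·ₚ-distribʳ x y z = trans (mod-*ˡ _ x) (trans (cong mod (*-distribʳ-+ (toℕ x) (toℕ y) (toℕ z)))
    (sym (mod-+ (toℕ y * toℕ x) (toℕ z * toℕ x))))

  ≢0⇒toℕ≢0 : ∀ {x} → x ≢ 0ₚ → NonZero (toℕ x)
  ≢0⇒toℕ≢0 {x} x≢0 = ≢-nonZero λ eq → x≢0 (trans (sym (mod-toℕ x)) (cong mod eq))

  isCommutativeRing : IsCommutativeRing _≡_ _+ₚ_ _·ₚ_ -ₚ_ 0ₚ 1ₚ
  isCommutativeRing = record
    { isRing = record
      { +-isAbelianGroup = record
        { isGroup = record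
          { isMonoid = record
            { isSemigroup = record
              { isMagma = record { isEquivalence = isEquivalence ; ∙-cong = cong₂ _+ₚ_ }
              ; assoc = +ₚ-assoc }
            ; identity = +ₚ-identityˡ , λ x → trans (+ₚ-comm x 0ₚ) (+ₚ-identityˡ x) }
          ; inverse = -ₚ-inverseˡ , λ x → trans (+ₚ-comm x (-ₚ x)) (-ₚ-inverseˡ x)
          ; ⁻¹-cong = cong -ₚ_ }
        ; comm = +ₚ-comm }
      ; *-cong = cong₂ _·ₚ_
      ; *-assoc = ·ₚ-assoc
      ; *-identity = ·ₚ-identityˡ , λ x → trans (·ₚ-comm x 1ₚ) (·ₚ-identityˡ x)
      ; distrib = (λ x y z → trans (·ₚ-comm x (y +ₚ z))
                    (trans (·ₚ-distribʳ x y z) (cong₂ _+ₚ_ (·ₚ-comm y x) (·ₚ-comm z x))))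
                , ·ₚ-distribʳ }
    ; *-comm = ·ₚ-comm }

  commutativeRing : CommutativeRing 0ℓ 0ℓ
  commutativeRing = record { isCommutativeRing = isCommutativeRing }

  mod-*p : ∀ a → mod (a * p) ≡ 0ₚ
  mod-*p a = mod-cong (trans (m*n%n≡0 a p) (sym (m*n%n≡0 0 p)))

  invertible : ∀ x → x ≢ 0ₚ → ∃ λ y → x ·ₚ y ≡ 1ₚ
  invertible x x≢0 with coprime-Bézout (prime⇒coprime p-prime {{≢0⇒toℕ≢0 x≢0}} (toℕ<n x))
  ... | Bézout.-+ a b eq = mod b , trans (·ₚ-comm x (mod b)) (trans (mod-*ˡ b x)
          (mod-cong (trans (cong (_% p) (sym eq)) ([m+kn]%n≡m%n 1 a p))))
  -- In this case `1 + b x = a p`, so the inverse of `x` is `−b`.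
  ... | Bézout.+- a b eq = -ₚ mod b , trans
          (solve 3 (λ x b u → x :* (:- b) := u :+ (:- (u :+ b :* x))) refl x (mod b) 1ₚ)
          (trans (cong (λ v → 1ₚ +ₚ (-ₚ v)) (trans (cong (1ₚ +ₚ_) (mod-*ˡ b x))
                   (trans (mod-+ 1 (b * toℕ x)) (trans (cong mod eq) (mod-*p a)))))
          (solve 1 (λ u → u :+ (:- con 0ℤ) := u) refl 1ₚ))
    where
    open IntegerCoefficients.Solver commutativeRing

  inverse : Fin p → Fin p
  inverse x with x ≟ᶠ 0ₚ
  ... | yes _  = 0ₚ
  ... | no x≢0 = proj₁ (invertible x x≢0)

  inverseʳ : ∀ x → x ≢ 0ₚ → x ·ₚ inverse x ≡ 1ₚ
  inverseʳ x x≢0 with x ≟ᶠ 0ₚ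
  ... | yes x≡0 = ⊥-elim (x≢0 x≡0)
  ... | no x≢0′ = proj₂ (invertible x x≢0′)

  inverse-0 : inverse 0ₚ ≡ 0ₚ
  inverse-0 with 0ₚ ≟ᶠ 0ₚ
  ... | yes _  = refl
  ... | no 0≢0 = ⊥-elim (0≢0 refl)

  1≢0 : 1ₚ ≢ 0ₚ
  1≢0 eq with trans (sym (m<n⇒m%n≡m (nonTrivial⇒n>1 p {{prime⇒nonTrivial p-prime}})))
                (trans (sym (toℕ-mod 1)) (trans (cong toℕ eq) (trans (toℕ-mod 0) (m*n%n≡0 0 p))))
  ... | ()

  +1≡suc : ∀ x → x +ₚ 1ₚ ≡ sucₚ x
  +1≡suc x = trans (+ₚ-comm x 1ₚ) (mod-+ˡ 1 x)

  generated : (P : Fin p → Set) → P 0ₚ → (∀ x → P x → P (x +ₚ 1ₚ)) → ∀ x → P x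
  generated P P0 P+1 x = subst P (mod-toℕ x) (go (toℕ x))
    where
    go : ∀ m → P (mod m)
    go zero    = P0
    go (suc m) = subst P (trans (mod-+ m 1) (cong mod (+-comm m 1))) (P+1 (mod m) (go m))

  primeField : FiniteField p
  primeField = record
    { _⊕_ = _+ₚ_
    ; _⊗_ = _·ₚ_
    ; ⊖_  = -ₚ_
    ; _⁻¹ = inverse
    ; 𝟘   = 0ₚ
    ; 𝟙   = 1ₚ
    ; isCommutativeRing = isCommutativeRing
    ; ⊗-inverseʳ = inverseʳ
    ; 𝟘⁻¹≡𝟘 = inverse-0
    ; 𝟙≢𝟘 = 1≢0
    ; generated = generated
    }

-- Transfer to subsets of the prime field

InQuot⇒quotSet : ∀ {p} .{{_ : NonZero p}} (A : Subset p) x → InQuot A x → lookup (quotSet A) x ≡ true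
InQuot⇒quotSet A x q = trans (lookup∘tabulate _ x) (trans (isYes≗does quot?) (dec-true quot? q))
  where quot? = any? λ a → any? λ b → (a ∈? A) ×-dec (b ∈? A) ×-dec (x ·ₚ b ≟ᶠ sucₚ a)

constant>0 : 0 < constant
constant>0 = <-≤-trans (s≤s z≤n) C₂≤constant

-- Multiplying by `n⁵ ≤ q⁵` weakens 105/104 to 110/109. The constant is raised to the power 109 so
-- that the root of the inequality reads `n^{110/109} ≤ c q`.
combine : ∀ {n q c} → 0 < c → n ≤ q → n ^ 105 ≤ c * q ^ 104 → n ^ 110 ≤ c ^ 109 * q ^ 109
combine {n} {q} {c} c>0 n≤q h = begin
  n ^ 110                  ≡⟨ ^-distribˡ-+-* n 105 5 ⟩
  n ^ 105 * n ^ 5          ≤⟨ *-mono-≤ h (^-monoˡ-≤ 5 n≤q) ⟩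
  c * q ^ 104 * q ^ 5      ≡⟨ *-assoc c (q ^ 104) (q ^ 5) ⟩
  c * (q ^ 104 * q ^ 5)    ≡⟨ cong (c *_) (sym (^-distribˡ-+-* q 104 5)) ⟩
  c * q ^ 109              ≤⟨ *-monoˡ-≤ (q ^ 109) (m≤m*n c (c ^ 108) {{m^n≢0 c 108 {{>-nonZero c>0}}}}) ⟩
  c ^ 109 * q ^ 109        ∎
  where open ≤-Reasoning

theorem3p4 : Σ ℕ λ K → NonZero K ×
    ((p : ℕ) .{{_ : NonZero p}} → Prime p → (A : Subset p) →
    ((x : Fin p) → toℕ x ≡ 0 → x ∉ A) → ∣ A ∣ ^ 2 ≤ p →
    ∣ A ∣ ^ 110 ≤ K ^ 109 * ∣ quotSet A ∣ ^ 109)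
theorem3p4 = constant , >-nonZero constant>0 , bound
  where
  bound : (p : ℕ) .{{_ : NonZero p}} → Prime p → (A : Subset p) →
    ((x : Fin p) → toℕ x ≡ 0 → x ∉ A) → ∣ A ∣ ^ 2 ≤ p →
    ∣ A ∣ ^ 110 ≤ constant ^ 109 * ∣ quotSet A ∣ ^ 109
  bound p p-prime A A∌0 n²≤p = subst₂ (λ n q → n ^ 110 ≤ constant ^ 109 * q ^ 109)
    (#-lookup A) (#-lookup (quotSet A)) (combine constant>0 G.n≤q small-or-large)
    where
    open PrimeField p p-prime
    lookup∌0 : ∀ x → lookup A x ≡ true → x ≢ 0ₚ
    lookup∌0 x Ax refl = A∌0 x (trans (toℕ-mod 0) (m*n%n≡0 0 p)) (lookup⇒[]= x A Ax)
    module G = Main primeField (lookup A) (lookup (quotSet A)) lookup∌0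
      (λ x a b Aa Ab eq → InQuot⇒quotSet A x
        (a , b , lookup⇒[]= a A Aa , lookup⇒[]= b A Ab , trans eq (+1≡suc a)))
    n = # (lookup A)
    q = # (lookup (quotSet A))
    n*n≤p : n * n ≤ p
    n*n≤p = subst (_≤ p) (trans (cong (∣ A ∣ *_) (*-identityʳ ∣ A ∣)) (sym (cong₂ _*_ (#-lookup A) (#-lookup A)))) n²≤p
    small-or-large : n ^ 105 ≤ constant * q ^ 104
    small-or-large with 2 ≤? n
    ... | yes n>1 = G.growth n*n≤p n>1
    ... | no n≯1 = ≤-trans (tiny n q (s≤s⁻¹ (≰⇒> n≯1)) G.n≤q) (m≤n*m (q ^ 104) constant {{>-nonZero constant>0}})
      where
      tiny : ∀ n q → n ≤ 1 → n ≤ q → n ^ 105 ≤ q ^ 104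
      tiny zero    q _ _ = z≤n
      tiny (suc zero) q _ n≤q = ≤-trans (≤-reflexive (trans (^-zeroˡ 105) (sym (^-zeroˡ 104)))) (^-monoˡ-≤ 104 n≤q)
      tiny (suc (suc n)) q (s≤s ()) _
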